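{- Let $\theta,\alpha\in(0,1)$ with $\theta$ irrational, and let $f(x)\in\mathbb Z[x]$ be a non-constant polynomial. Then the integer sequence $\boldsymbol u=\langle u_m\rangle_{m=0}^\infty$ given by $u_m:=f(\lfloor m\theta+\alpha\rfloor)$ satisfies Condition (*).
   Context: Condition (*): an integer sequence $\boldsymbol u=\langle u_m\rangle_{m\ge0}$ satisfies Condition (*) if there exist an integer $\sigma\ge 0$, integers $b_0,\ldots,b_\sigma$, and an unbounded sequence of positive integers $\langle r_n\rangle_{n\ge 0}$ such that, defining for each $n\in\mathbb N$ the sequence $w_{n,m}:=\sum_{i=0}^\sigma b_i u_{m+ir_n}$ ($m\ge 0$), the following hold: (1) Expanding gaps: for every $n$, the set $\Delta_n:=\{m\in\mathbb N: w_{n,m}\neq 0\}$ is infinite, and there is a constant $c>0$ (independent of $n$) such that the minimum distance $\mu_n$ between any two distinct elements of $\Delta_n$ satisfies $\mu_n\ge c\, r_n$ for all $n$. (2) Polynomial variation: there exist constants $c_0\ge 0$ and $C'>0$ (independent of $n,m,m'$) such that for all $n\in\mathbb N$ and all $m<m'$ in $\Delta_n$, $|w_{n,m'}|\le C'\big((m'-m)^{c_0}+|w_{n,m}|\big)$. -}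

module Defs where

open import Data.Nat.Base as ℕ using (ℕ; zero; suc)
import Data.Nat.Properties as ℕ
open import Data.Integer.Base as ℤ using (ℤ; +_)
import Data.Integer.Properties as ℤ
open import Data.Rational.Base as ℚ using (ℚ; 0ℚ; 1ℚ; ½)
import Data.Rational.Properties as ℚ
open import Algebra.Bundles using (module CommutativeMonoid)
open import Algebra.Properties.CommutativeSemigroup
  (CommutativeMonoid.commutativeSemigroup ℚ.+-0-commutativeMonoid) using (interchange)
open import Data.Fin.Base using (Fin; toℕ)
open import Data.List.Base using (List; foldr; drop)
open import Data.List.Relation.Unary.Any using (Any)
open import Data.Product.Base using (∃-syntax; _×_; _,_; proj₁; proj₂)
open import Data.Sum.Base using (_⊎_)
open import Relation.Nullary using (¬_)
open import Relation.Unary using (Pred; _∈_)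
open import Relation.Binary.PropositionalEquality using (_≡_; _≢_; refl; sym; cong; cong₂; subst; module ≡-Reasoning)
open import Level using (0ℓ)
open import Algebra.Properties.Monoid.Sum ℤ.+-0-monoid using (sum)

-- Real numbers are Cauchy sequences of rationals. The modulus of convergence
-- is part of the data (the Σ-type in `cauchy`), as usual constructively.
record ℝ : Set where
  constructor mkℝ
  field
    seq    : ℕ → ℚ
    cauchy : ∀ ε → 0ℚ ℚ.< ε →
             ∃[ N ] (∀ m n → N ℕ.≤ m → N ℕ.≤ n → ℚ.∣ seq m ℚ.- seq n ∣ ℚ.< ε)

open ℝ public

infix 4 _<_ _≤_ _#_

_<_ : ℝ → ℝ → Set
x < y = ∃[ ε ] (0ℚ ℚ.< ε × (∃[ N ] (∀ n → N ℕ.≤ n → seq x n ℚ.+ ε ℚ.≤ seq y n)))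

_≤_ : ℝ → ℝ → Set
x ≤ y = ¬ (y < x)

-- Apartness: the constructive form of "x and y are different".
_#_ : ℝ → ℝ → Set
x # y = x < y ⊎ y < x

fromℚ : ℚ → ℝ
fromℚ q = mkℝ (λ _ → q) λ ε 0<ε → 0 , λ _ _ _ _ →
  subst (ℚ._< ε) (sym (cong ℚ.∣_∣ (ℚ.+-inverseʳ q))) 0<ε

fromℤ : ℤ → ℝ
fromℤ z = fromℚ (z ℚ./ 1)

fromℕ : ℕ → ℝ
fromℕ n = fromℤ (+ n)

private
  rearrange-+ : ∀ a b c d → (a ℚ.+ b) ℚ.- (c ℚ.+ d) ≡ (a ℚ.- c) ℚ.+ (b ℚ.- d)
  rearrange-+ a b c d = begin
    (a ℚ.+ b) ℚ.- (c ℚ.+ d)             ≡⟨ cong (a ℚ.+ b ℚ.+_) (ℚ.neg-distrib-+ c d) ⟩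
    (a ℚ.+ b) ℚ.+ (ℚ.- c ℚ.+ ℚ.- d)     ≡⟨ interchange a b (ℚ.- c) (ℚ.- d) ⟩
    (a ℚ.- c) ℚ.+ (b ℚ.- d)             ∎
    where open ≡-Reasoning

  telescope : ∀ a b c → (a ℚ.- b) ℚ.+ (b ℚ.- c) ≡ a ℚ.- c
  telescope a b c = begin
    (a ℚ.- b) ℚ.+ (b ℚ.- c)             ≡⟨ ℚ.+-assoc a (ℚ.- b) (b ℚ.- c) ⟩
    a ℚ.+ (ℚ.- b ℚ.+ (b ℚ.- c))         ≡⟨ cong (a ℚ.+_) (ℚ.+-assoc (ℚ.- b) b (ℚ.- c)) ⟨
    a ℚ.+ ((ℚ.- b ℚ.+ b) ℚ.- c)         ≡⟨ cong (λ z → a ℚ.+ (z ℚ.- c)) (ℚ.+-inverseˡ b) ⟩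
    a ℚ.+ (0ℚ ℚ.- c)                    ≡⟨ cong (a ℚ.+_) (ℚ.+-identityˡ (ℚ.- c)) ⟩
    a ℚ.- c                             ∎
    where open ≡-Reasoning

  rearrange-* : ∀ a b c d → a ℚ.* b ℚ.- c ℚ.* d ≡ a ℚ.* (b ℚ.- d) ℚ.+ (a ℚ.- c) ℚ.* d
  rearrange-* a b c d = begin
    a ℚ.* b ℚ.- c ℚ.* d
      ≡⟨ telescope (a ℚ.* b) (a ℚ.* d) (c ℚ.* d) ⟨
    (a ℚ.* b ℚ.- a ℚ.* d) ℚ.+ (a ℚ.* d ℚ.- c ℚ.* d)
      ≡⟨ cong₂ (λ y z → (a ℚ.* b ℚ.+ y) ℚ.+ (a ℚ.* d ℚ.+ z)) (ℚ.neg-distribʳ-* a d) (ℚ.neg-distribˡ-* c d) ⟩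
    (a ℚ.* b ℚ.+ a ℚ.* (ℚ.- d)) ℚ.+ (a ℚ.* d ℚ.+ (ℚ.- c) ℚ.* d)
      ≡⟨ cong₂ ℚ._+_ (ℚ.*-distribˡ-+ a b (ℚ.- d)) (ℚ.*-distribʳ-+ d a (ℚ.- c)) ⟨
    a ℚ.* (b ℚ.- d) ℚ.+ (a ℚ.- c) ℚ.* d ∎
    where open ≡-Reasoning

  split : ∀ a b → a ≡ (a ℚ.- b) ℚ.+ b
  split a b = begin
    a                       ≡⟨ ℚ.+-identityʳ a ⟨
    a ℚ.+ 0ℚ                ≡⟨ cong (a ℚ.+_) (ℚ.+-inverseˡ b) ⟨
    a ℚ.+ (ℚ.- b ℚ.+ b)     ≡⟨ ℚ.+-assoc a (ℚ.- b) b ⟨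
    (a ℚ.- b) ℚ.+ b         ∎
    where open ≡-Reasoning

  halves : ∀ ε → ½ ℚ.* ε ℚ.+ ½ ℚ.* ε ≡ ε
  halves ε = begin
    ½ ℚ.* ε ℚ.+ ½ ℚ.* ε ≡⟨ ℚ.*-distribʳ-+ ε ½ ½ ⟨
    1ℚ ℚ.* ε            ≡⟨ ℚ.*-identityˡ ε ⟩
    ε                   ∎
    where open ≡-Reasoning

  half-pos : ∀ {ε} → 0ℚ ℚ.< ε → 0ℚ ℚ.< ½ ℚ.* ε
  half-pos 0<ε = ℚ.*-monoʳ-<-pos ½ 0<ε

  bounded : ∀ x → ∃[ B ] (0ℚ ℚ.< B × (∃[ N ] (∀ n → N ℕ.≤ n → ℚ.∣ seq x n ∣ ℚ.≤ B)))
  bounded x with cauchy x 1ℚ (ℚ.positive⁻¹ 1ℚ)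
  ... | N , close = 1ℚ ℚ.+ ℚ.∣ seq x N ∣ ,
    ℚ.+-mono-<-≤ (ℚ.positive⁻¹ 1ℚ) (ℚ.0≤∣p∣ (seq x N)) , N , λ n N≤n → begin
      ℚ.∣ seq x n ∣                                   ≡⟨ cong ℚ.∣_∣ (split (seq x n) (seq x N)) ⟩
      ℚ.∣ (seq x n ℚ.- seq x N) ℚ.+ seq x N ∣         ≤⟨ ℚ.∣p+q∣≤∣p∣+∣q∣ (seq x n ℚ.- seq x N) (seq x N) ⟩
      ℚ.∣ seq x n ℚ.- seq x N ∣ ℚ.+ ℚ.∣ seq x N ∣     ≤⟨ ℚ.+-monoˡ-≤ _ (ℚ.<⇒≤ (close n N N≤n ℕ.≤-refl)) ⟩
      1ℚ ℚ.+ ℚ.∣ seq x N ∣                            ∎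
    where open ℚ.≤-Reasoning

infixl 6 _+_
infixl 7 _*_
infixr 8 _^_

_+_ : ℝ → ℝ → ℝ
x + y = mkℝ (λ n → seq x n ℚ.+ seq y n) λ ε 0<ε →
  let Nx , hx = cauchy x (½ ℚ.* ε) (half-pos 0<ε)
      Ny , hy = cauchy y (½ ℚ.* ε) (half-pos 0<ε)
  in Nx ℕ.⊔ Ny , λ m n N≤m N≤n → begin-strict
    ℚ.∣ (seq x m ℚ.+ seq y m) ℚ.- (seq x n ℚ.+ seq y n) ∣
      ≡⟨ cong ℚ.∣_∣ (rearrange-+ (seq x m) (seq y m) (seq x n) (seq y n)) ⟩
    ℚ.∣ (seq x m ℚ.- seq x n) ℚ.+ (seq y m ℚ.- seq y n) ∣
      ≤⟨ ℚ.∣p+q∣≤∣p∣+∣q∣ (seq x m ℚ.- seq x n) (seq y m ℚ.- seq y n) ⟩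
    ℚ.∣ seq x m ℚ.- seq x n ∣ ℚ.+ ℚ.∣ seq y m ℚ.- seq y n ∣
      <⟨ ℚ.+-mono-< (hx m n (ℕ.m⊔n≤o⇒m≤o Nx Ny N≤m) (ℕ.m⊔n≤o⇒m≤o Nx Ny N≤n))
                    (hy m n (ℕ.m⊔n≤o⇒n≤o Nx Ny N≤m) (ℕ.m⊔n≤o⇒n≤o Nx Ny N≤n)) ⟩
    ½ ℚ.* ε ℚ.+ ½ ℚ.* ε
      ≡⟨ halves ε ⟩
    ε ∎
  where open ℚ.≤-Reasoning

private
  *-cauchy : ∀ x y ε → 0ℚ ℚ.< ε → ∃[ N ] (∀ m n → N ℕ.≤ m → N ℕ.≤ n →
             ℚ.∣ seq x m ℚ.* seq y m ℚ.- seq x n ℚ.* seq y n ∣ ℚ.< ε)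
  *-cauchy x y ε 0<ε with bounded x | bounded y
  ... | B , 0<B , Mx , bx | C , 0<C , My , by = N , estimate
    where
    open ℚ.≤-Reasoning

    instance
      B-pos = ℚ.positive 0<B
      B-nonNeg = ℚ.pos⇒nonNeg B
      C-pos = ℚ.positive 0<C
      B+C-pos = ℚ.positive (ℚ.+-mono-< 0<B 0<C)
      B+C-nonZero = ℚ.pos⇒nonZero (B ℚ.+ C)
      ε-pos = ℚ.positive 0<ε
      1/-pos = ℚ.1/pos⇒pos (B ℚ.+ C)

    δ : ℚ
    δ = ℚ.1/ (B ℚ.+ C) ℚ.* ε

    0<δ : 0ℚ ℚ.< δ
    0<δ = ℚ.positive⁻¹ δ {{ℚ.pos*pos⇒pos (ℚ.1/ (B ℚ.+ C)) ε}}

    total : B ℚ.* δ ℚ.+ δ ℚ.* C ≡ ε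
    total = begin-equality
      B ℚ.* δ ℚ.+ δ ℚ.* C                  ≡⟨ cong (B ℚ.* δ ℚ.+_) (ℚ.*-comm δ C) ⟩
      B ℚ.* δ ℚ.+ C ℚ.* δ                  ≡⟨ ℚ.*-distribʳ-+ δ B C ⟨
      (B ℚ.+ C) ℚ.* δ                      ≡⟨ ℚ.*-assoc (B ℚ.+ C) (ℚ.1/ (B ℚ.+ C)) ε ⟨
      (B ℚ.+ C) ℚ.* ℚ.1/ (B ℚ.+ C) ℚ.* ε   ≡⟨ cong (ℚ._* ε) (ℚ.*-inverseʳ (B ℚ.+ C)) ⟩
      1ℚ ℚ.* ε                             ≡⟨ ℚ.*-identityˡ ε ⟩
      ε                                    ∎

    Nx Ny N : ℕ
    Nx = proj₁ (cauchy x δ 0<δ)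
    Ny = proj₁ (cauchy y δ 0<δ)
    N  = (Nx ℕ.⊔ Ny) ℕ.⊔ (Mx ℕ.⊔ My)

    N⇒Nx : ∀ {m} → N ℕ.≤ m → Nx ℕ.≤ m
    N⇒Nx p = ℕ.m⊔n≤o⇒m≤o Nx Ny (ℕ.m⊔n≤o⇒m≤o (Nx ℕ.⊔ Ny) (Mx ℕ.⊔ My) p)
    N⇒Ny : ∀ {m} → N ℕ.≤ m → Ny ℕ.≤ m
    N⇒Ny p = ℕ.m⊔n≤o⇒n≤o Nx Ny (ℕ.m⊔n≤o⇒m≤o (Nx ℕ.⊔ Ny) (Mx ℕ.⊔ My) p)
    N⇒Mx : ∀ {m} → N ℕ.≤ m → Mx ℕ.≤ m
    N⇒Mx p = ℕ.m⊔n≤o⇒m≤o Mx My (ℕ.m⊔n≤o⇒n≤o (Nx ℕ.⊔ Ny) (Mx ℕ.⊔ My) p)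
    N⇒My : ∀ {m} → N ℕ.≤ m → My ℕ.≤ m
    N⇒My p = ℕ.m⊔n≤o⇒n≤o Mx My (ℕ.m⊔n≤o⇒n≤o (Nx ℕ.⊔ Ny) (Mx ℕ.⊔ My) p)

    left : ∀ m n → N ℕ.≤ m → N ℕ.≤ n →
           ℚ.∣ seq x m ℚ.* (seq y m ℚ.- seq y n) ∣ ℚ.≤ B ℚ.* δ
    left m n N≤m N≤n = begin
      ℚ.∣ seq x m ℚ.* (seq y m ℚ.- seq y n) ∣
        ≡⟨ ℚ.∣p*q∣≡∣p∣*∣q∣ (seq x m) (seq y m ℚ.- seq y n) ⟩
      ℚ.∣ seq x m ∣ ℚ.* ℚ.∣ seq y m ℚ.- seq y n ∣
        ≤⟨ ℚ.*-monoʳ-≤-nonNeg ℚ.∣ seq y m ℚ.- seq y n ∣ {{ℚ.∣-∣-nonNeg (seq y m ℚ.- seq y n)}} (bx m (N⇒Mx N≤m)) ⟩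
      B ℚ.* ℚ.∣ seq y m ℚ.- seq y n ∣
        ≤⟨ ℚ.*-monoˡ-≤-nonNeg B
             (ℚ.<⇒≤ (proj₂ (cauchy y δ 0<δ) m n (N⇒Ny N≤m) (N⇒Ny N≤n))) ⟩
      B ℚ.* δ ∎

    right : ∀ m n → N ℕ.≤ m → N ℕ.≤ n →
            ℚ.∣ (seq x m ℚ.- seq x n) ℚ.* seq y n ∣ ℚ.< δ ℚ.* C
    right m n N≤m N≤n = begin-strict
      ℚ.∣ (seq x m ℚ.- seq x n) ℚ.* seq y n ∣
        ≡⟨ ℚ.∣p*q∣≡∣p∣*∣q∣ (seq x m ℚ.- seq x n) (seq y n) ⟩
      ℚ.∣ seq x m ℚ.- seq x n ∣ ℚ.* ℚ.∣ seq y n ∣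
        ≤⟨ ℚ.*-monoˡ-≤-nonNeg ℚ.∣ seq x m ℚ.- seq x n ∣ {{ℚ.∣-∣-nonNeg (seq x m ℚ.- seq x n)}} (by n (N⇒My N≤n)) ⟩
      ℚ.∣ seq x m ℚ.- seq x n ∣ ℚ.* C
        <⟨ ℚ.*-monoˡ-<-pos C (proj₂ (cauchy x δ 0<δ) m n (N⇒Nx N≤m) (N⇒Nx N≤n)) ⟩
      δ ℚ.* C ∎

    estimate : ∀ m n → N ℕ.≤ m → N ℕ.≤ n →
               ℚ.∣ seq x m ℚ.* seq y m ℚ.- seq x n ℚ.* seq y n ∣ ℚ.< ε
    estimate m n N≤m N≤n = begin-strict
      ℚ.∣ seq x m ℚ.* seq y m ℚ.- seq x n ℚ.* seq y n ∣
        ≡⟨ cong ℚ.∣_∣ (rearrange-* (seq x m) (seq y m) (seq x n) (seq y n)) ⟩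
      ℚ.∣ seq x m ℚ.* (seq y m ℚ.- seq y n) ℚ.+ (seq x m ℚ.- seq x n) ℚ.* seq y n ∣
        ≤⟨ ℚ.∣p+q∣≤∣p∣+∣q∣ (seq x m ℚ.* (seq y m ℚ.- seq y n)) ((seq x m ℚ.- seq x n) ℚ.* seq y n) ⟩
      ℚ.∣ seq x m ℚ.* (seq y m ℚ.- seq y n) ∣ ℚ.+ ℚ.∣ (seq x m ℚ.- seq x n) ℚ.* seq y n ∣
        <⟨ ℚ.+-mono-≤-< (left m n N≤m N≤n) (right m n N≤m N≤n) ⟩
      B ℚ.* δ ℚ.+ δ ℚ.* C
        ≡⟨ total ⟩
      ε ∎

_*_ : ℝ → ℝ → ℝ
x * y = mkℝ (λ n → seq x n ℚ.* seq y n) (*-cauchy x y)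

_^_ : ℝ → ℕ → ℝ
x ^ zero  = fromℕ 1
x ^ suc n = x * x ^ n

-- Irrationality in the usual constructive form: θ differs from, in the sense
-- of being apart from, every rational. Classically x # y is just x ≠ y.
Irrational : ℝ → Set
Irrational θ = ∀ q → θ # fromℚ q

-- k = ⌊x⌋. This is a relation because the floor is discontinuous and hence not
-- definable as a function on ℝ constructively.
IsFloor : ℝ → ℤ → Set
IsFloor x k = fromℤ k ≤ x × x < fromℤ (k ℤ.+ + 1)

-- p = d ^ s for an integer base d ≥ 1 and a real exponent s ≥ 0: the real p ≥ 0
-- lying between the rational powers of d, i.e. d^(a/b) ≤ p whenever a/b ≤ s, and
-- p ≤ d^(a/b) whenever s ≤ a/b. Denominators are cleared and b-th powers taken.
IsPower : ℕ → ℝ → ℝ → Set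
IsPower d s p = fromℕ 0 ≤ p × (∀ a b → 0 ℕ.< b →
  (fromℕ a ≤ fromℕ b * s → fromℕ (d ℕ.^ a) ≤ p ^ b) ×
  (fromℕ b * s ≤ fromℕ a → p ^ b ≤ fromℕ (d ℕ.^ a)))

-- ℤ[x], by coefficient lists with the constant coefficient first; trailing
-- zeros are allowed.
Poly : Set
Poly = List ℤ

eval : Poly → ℤ → ℤ
eval f x = foldr (λ a v → a ℤ.+ x ℤ.* v) (+ 0) f

NonConstant : Poly → Set
NonConstant f = Any (_≢ + 0) (drop 1 f)

Infinite : Pred ℕ 0ℓ → Set
Infinite S = ∀ N → ∃[ m ] (N ℕ.≤ m × m ∈ S)

record Condition⋆ (u : ℕ → ℤ) : Set where
  field
    σ           : ℕ
    b           : Fin (suc σ) → ℤ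
    r           : ℕ → ℕ
    r-positive  : ∀ n → 0 ℕ.< r n
    r-unbounded : ∀ B → ∃[ n ] B ℕ.< r n

  w : ℕ → ℕ → ℤ
  w n m = sum (λ i → b i ℤ.* u (m ℕ.+ toℕ i ℕ.* r n))

  Δ : ℕ → Pred ℕ 0ℓ
  Δ n m = w n m ≢ + 0

  field
    Δ-infinite : ∀ n → Infinite (Δ n)

    -- The minimum μₙ of the distances is at least c rₙ iff every distance is.
    expanding-gaps : ∃[ c ] (fromℕ 0 < c ×
      (∀ n m m′ → m ∈ Δ n → m′ ∈ Δ n → m ≢ m′ →
        c * fromℕ (r n) ≤ fromℕ ℕ.∣ m - m′ ∣))

    polynomial-variation : ∃[ c₀ ] ∃[ C′ ] (fromℕ 0 ≤ c₀ × fromℕ 0 < C′ ×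
      (∀ n m m′ → m ∈ Δ n → m′ ∈ Δ n → m ℕ.< m′ →
        ∃[ p ] (IsPower (m′ ℕ.∸ m) c₀ p ×
          fromℕ ℤ.∣ w n m′ ∣ ≤ C′ * (p + fromℕ ℤ.∣ w n m ∣))))

{-# OPTIONS --safe #-}
-- Let k m = ⌊mθ + α⌋, so that |k m′ − k m − (m′ − m)θ| < 1. Choose r with rθ within δ of an integer p,
-- and let w be the σ-th finite difference of u along progressions of step r, where σ > deg f. If σδ < 1,
-- then k (m + jr) = k m + jp ± cⱼ for j ≤ σ, where c is nondecreasing with values in {0, 1}. Without a
-- carry (c = 0) the difference w vanishes; hence two elements m, m′ of Δ both see a carry, and this puts
-- (m′ − m)θ within σδ of an integer. With a carry, w is a nonzero multiple of (k m)^(deg f − 1) up to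
-- terms of lower order in k m, which gives both the nonvanishing for large m and the polynomial variation.
--
-- For the gaps, r must satisfy ‖lθ‖ ≥ σδ whenever 0 < l < r/(4σ). Take neighbours p/q < θ < p′/q′ in the
-- Stern–Brocot tree whose distances qθ − p and p′ − q′θ differ by a factor of at most 2, and X = q + q′;
-- then ‖lθ‖ > 1/(2X) for 0 < l < X. Neighbours further down the tree, at size about 4σX, have a
-- member r ≤ 4σX with δ < 1/(2σX).
--
-- All comparisons take place in the ordered group ℤ + ℤθ, whose order is decidable because θ is
-- irrational in the sense of apartness; reals enter only in setting up this order.
module Submission where

open import Defs using (eval)
open import Data.Nat.Base as ℕ using (ℕ; zero; suc)
import Data.Nat.Properties as ℕ
open import Data.Fin.Base using (toℕ)
open import Data.List.Base using (List; []; _∷_; length)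
open import Data.List.Relation.Unary.Any using (Any; here; there; any?)
open import Data.Product.Base using (∃-syntax; _×_; _,_; proj₁; proj₂)
open import Data.Sum.Base using (_⊎_; inj₁; inj₂; [_,_]′)
open import Data.Empty using (⊥; ⊥-elim)
open import Relation.Nullary using (¬_; yes; no; ¬?)
open import Relation.Nullary.Decidable using (decidable-stable)
open import Relation.Binary using (tri<; tri≈; tri>)
open import Relation.Binary.PropositionalEquality

-- The difficulty in choosing r is that σδ must stay below ‖lθ‖ for all l in a range that is a fixed
-- fraction of r. Convergents alone do not give this: from one to the next, δ may drop by less than
-- the factor σ, and the next denominator may be arbitrarily large. Hence the two scales in the
-- tree. At the first, the distances of the neighbours are balanced because otherwise the smaller
-- one could be far below 1/X. At the second, the descent is stopped by size alone, so that r is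
-- bounded by 4σX whatever the partial quotients are, and r is the smaller of two denominators whose
-- sum is at least 4σX. This r may approximate θ from either side; a sign s records which, and
-- carries of both directions occur.
--
-- The constants must not depend on r, although the lower-order terms of w grow with the shift σp.
-- The gap absorbs them: p ≤ r ≤ 4σ(m′ - m), so whatever the shift contributes is bounded by a power
-- of m′ - m.

module _ where
  open import Data.Integer.Base hiding (suc)
  open import Data.Integer.Properties hiding (pos-+)
  open import Data.Integer.Tactic.RingSolver using (solve-∀)
  import Data.Nat.Tactic.RingSolver as ℕ-Ring
  open import Algebra.Properties.Monoid.Sum +-0-monoid using (sum)

  -- Finite differences

  Σ< : ℕ → (ℕ → ℤ) → ℤ
  Σ< zero    F = 0ℤ
  Σ< (suc n) F = F 0 + Σ< n (λ j → F (suc j))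

  Σ<-cong : ∀ n {F G} → (∀ j → j ℕ.< n → F j ≡ G j) → Σ< n F ≡ Σ< n G
  Σ<-cong zero    F≗G = refl
  Σ<-cong (suc n) F≗G = cong₂ _+_ (F≗G 0 ℕ.z<s) (Σ<-cong n λ j j<n → F≗G (suc j) (ℕ.s<s j<n))

  Σ<-+ : ∀ n F G → Σ< n (λ j → F j + G j) ≡ Σ< n F + Σ< n G
  Σ<-+ zero    F G = refl
  Σ<-+ (suc n) F G = trans (cong (_+_ (F 0 + G 0)) (Σ<-+ n _ _)) (swap (F 0) (G 0) _ _)
    where
    swap : ∀ a b c d → (a + b) + (c + d) ≡ (a + c) + (b + d)
    swap = solve-∀

  Σ<-*ʳ : ∀ n F c → Σ< n (λ j → F j * c) ≡ Σ< n F * c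
  Σ<-*ʳ zero    F c = refl
  Σ<-*ʳ (suc n) F c = trans (cong (_+_ (F 0 * c)) (Σ<-*ʳ n _ c)) (sym (*-distribʳ-+ c (F 0) _))

  Σ<-snoc : ∀ n F → Σ< (suc n) F ≡ Σ< n F + F n
  Σ<-snoc zero    F = trans (+-identityʳ (F 0)) (sym (+-identityˡ (F 0)))
  Σ<-snoc (suc n) F = trans (cong (_+_ (F 0)) (Σ<-snoc n _)) (sym (+-assoc (F 0) _ _))

  sum≡Σ< : ∀ n (F : ℕ → ℤ) → sum {n} (λ i → F (toℕ i)) ≡ Σ< n F
  sum≡Σ< zero    F = refl
  sum≡Σ< (suc n) F = cong (_+_ (F 0)) (sum≡Σ< n (λ j → F (suc j)))

  -- (−1)^(n+j) times the binomial coefficient: the weights of the n-th finite difference.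
  weight : ℕ → ℕ → ℤ
  weight zero    zero    = 1ℤ
  weight zero    (suc j) = 0ℤ
  weight (suc n) zero    = - weight n 0
  weight (suc n) (suc j) = weight n j - weight n (suc j)

  difference : ℕ → (ℕ → ℤ) → ℤ
  difference n G = Σ< (suc n) (λ j → weight n j * G j)

  difference-cong : ∀ n {G H} → (∀ j → j ℕ.≤ n → G j ≡ H j) → difference n G ≡ difference n H
  difference-cong n G≗H = Σ<-cong (suc n) λ j j≤n → cong (weight n j *_) (G≗H j (ℕ.s≤s⁻¹ j≤n))

  weight-over : ∀ n j → n ℕ.< j → weight n j ≡ 0ℤ
  weight-over zero    (suc j) _   = refl
  weight-over (suc n) (suc j) n<j =
    cong₂ _-_ (weight-over n j (ℕ.s<s⁻¹ n<j)) (weight-over n (suc j) (ℕ.m<n⇒m<1+n (ℕ.s<s⁻¹ n<j)))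

  difference-suc : ∀ n G → difference (suc n) G ≡ difference n (λ j → G (suc j) - G j)
  difference-suc n G = begin
    c + Σ< (suc n) (λ j → (weight n j - weight n (suc j)) * G (suc j))
      ≡⟨ cong (_+_ c) (Σ<-cong (suc n) λ j _ → split (weight n j) (weight n (suc j)) (G (suc j))) ⟩
    c + Σ< (suc n) (λ j → l j + r (suc j) * -1ℤ)
      ≡⟨ cong (_+_ c) (Σ<-+ (suc n) l (λ j → r (suc j) * -1ℤ)) ⟩
    c + (Σ< (suc n) l + Σ< (suc n) (λ j → r (suc j) * -1ℤ))
      ≡⟨ cong (λ z → c + (Σ< (suc n) l + z)) (Σ<-*ʳ (suc n) (λ j → r (suc j)) -1ℤ) ⟩
    c + (Σ< (suc n) l + Σ< (suc n) (λ j → r (suc j)) * -1ℤ)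
      ≡⟨ regroup (weight n 0) (G 0) (Σ< (suc n) l) (Σ< (suc n) (λ j → r (suc j))) ⟩
    Σ< (suc n) l + Σ< (suc (suc n)) r * -1ℤ
      ≡⟨ cong (λ z → Σ< (suc n) l + z * -1ℤ) (Σ<-snoc (suc n) r) ⟩
    Σ< (suc n) l + (Σ< (suc n) r + r (suc n)) * -1ℤ
      -- The index n + 1 lies beyond the weights of order n, so the extra term of the second sum is
      -- zero.
      ≡⟨ cong (λ z → Σ< (suc n) l + (Σ< (suc n) r + z * G (suc n)) * -1ℤ)
              (weight-over n (suc n) ℕ.≤-refl) ⟩
    Σ< (suc n) l + (Σ< (suc n) r + 0ℤ) * -1ℤ
      ≡⟨ cong (λ z → Σ< (suc n) l + z * -1ℤ) (+-identityʳ (Σ< (suc n) r)) ⟩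
    Σ< (suc n) l + Σ< (suc n) r * -1ℤ
      ≡⟨ cong (_+_ (Σ< (suc n) l)) (Σ<-*ʳ (suc n) r -1ℤ) ⟨
    Σ< (suc n) l + Σ< (suc n) (λ j → r j * -1ℤ)
      ≡⟨ Σ<-+ (suc n) l (λ j → r j * -1ℤ) ⟨
    Σ< (suc n) (λ j → l j + r j * -1ℤ)
      ≡⟨ Σ<-cong (suc n) (λ j _ → join (weight n j) (G (suc j)) (G j)) ⟩
    difference n (λ j → G (suc j) - G j) ∎
    where
    open ≡-Reasoning
    c : ℤ
    c = - weight n 0 * G 0
    l r : ℕ → ℤ
    l j = weight n j * G (suc j)
    r j = weight n j * G j
    split : ∀ a b c → (a - b) * c ≡ a * c + b * c * -1ℤ
    split = solve-∀
    regroup : ∀ a b c d → - a * b + (c + d * -1ℤ) ≡ c + (a * b + d) * -1ℤ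
    regroup = solve-∀
    join : ∀ a b c → a * b + a * c * -1ℤ ≡ a * (b - c)
    join = solve-∀

  -- PolySeq n G: G is a polynomial sequence of degree < n.
  PolySeq : ℕ → (ℕ → ℤ) → Set
  PolySeq zero    G = ∀ j → G j ≡ 0ℤ
  PolySeq (suc n) G = PolySeq n (λ j → G (suc j) - G j)

  PolySeq-cong : ∀ n {G H} → (∀ j → G j ≡ H j) → PolySeq n G → PolySeq n H
  PolySeq-cong zero    G≗H p j = trans (sym (G≗H j)) (p j)
  PolySeq-cong (suc n) G≗H p   = PolySeq-cong n (λ j → cong₂ _-_ (G≗H (suc j)) (G≗H j)) p

  PolySeq-0 : ∀ n → PolySeq n (λ _ → 0ℤ)
  PolySeq-0 zero    j = refl
  PolySeq-0 (suc n)   = PolySeq-0 n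

  PolySeq-suc : ∀ n {G} → PolySeq n G → PolySeq (suc n) G
  PolySeq-suc zero    p j = cong₂ _-_ (p (suc j)) (p j)
  PolySeq-suc (suc n) p   = PolySeq-suc n p

  PolySeq-shift : ∀ n {G} → PolySeq n G → PolySeq n (λ j → G (suc j))
  PolySeq-shift zero    p j = p (suc j)
  PolySeq-shift (suc n) p   = PolySeq-shift n p

  PolySeq-+ : ∀ n {G H} → PolySeq n G → PolySeq n H → PolySeq n (λ j → G j + H j)
  PolySeq-+ zero    p q j = cong₂ _+_ (p j) (q j)
  PolySeq-+ (suc n) {G} {H} p q =
    PolySeq-cong n (λ j → swap (G (suc j)) (G j) (H (suc j)) (H j)) (PolySeq-+ n p q)
    where
    swap : ∀ a b c d → (a - b) + (c - d) ≡ (a + c) - (b + d)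
    swap = solve-∀

  PolySeq-* : ∀ n {G} c → PolySeq n G → PolySeq n (λ j → c * G j)
  PolySeq-* zero    c p j = trans (cong (c *_) (p j)) (*-zeroʳ c)
  PolySeq-* (suc n) {G} c p =
    PolySeq-cong n (λ j → distrib c (G (suc j)) (G j)) (PolySeq-* n c p)
    where
    distrib : ∀ c a b → c * (a - b) ≡ c * a - c * b
    distrib = solve-∀

  -- Induction by the product rule: the difference of L G, for the progression L j = k + jp, is L
  -- times the difference of G, plus p times the shift of G.
  PolySeq-*-AP : ∀ n {G} k p → PolySeq n G → PolySeq (suc n) (λ j → (k + + j * p) * G j)
  PolySeq-*-AP zero {G} k p z = PolySeq-suc zero λ j → trans (cong ((k + + j * p) *_) (z j)) (*-zeroʳ (k + + j * p))
  PolySeq-*-AP (suc n) {G} k p q =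
    PolySeq-cong (suc n) (λ j → trans (product-rule k p (G j) (G (suc j)) (+ j))
                                      (cong (λ z → (k + z * p) * G (suc j) - (k + + j * p) * G j) (+-comm (+ j) 1ℤ)))
      (PolySeq-+ (suc n) {λ j → (k + + j * p) * (G (suc j) - G j)} {λ j → p * G (suc j)}
        (PolySeq-*-AP n k p q)
        (PolySeq-* (suc n) {λ j → G (suc j)} p (PolySeq-shift (suc n) {G} q)))
    where
    product-rule : ∀ k p a b j →
      (k + j * p) * (b - a) + p * b ≡ (k + (j + 1ℤ) * p) * b - (k + j * p) * a
    product-rule = solve-∀

  -- Every step of Horner's rule multiplies by the progression k + jp and so raises the order by
  -- one.
  eval-PolySeq : ∀ f k p → PolySeq (length f) (λ j → eval f (k + + j * p))
  eval-PolySeq []      k p j = refl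
  eval-PolySeq (a ∷ f) k p =
    PolySeq-+ (suc (length f)) {λ _ → a}
      (PolySeq-cong (length f) (λ _ → sym (+-inverseʳ a)) (PolySeq-0 (length f)))
      (PolySeq-*-AP (length f) k p (eval-PolySeq f k p))

  difference-PolySeq : ∀ n {G} → PolySeq n G → difference n G ≡ 0ℤ
  difference-PolySeq zero    {G} p = trans (+-identityʳ _) (trans (*-identityˡ (G 0)) (p 0))
  difference-PolySeq (suc n) {G} p = trans (difference-suc n G) (difference-PolySeq n p)

  -- the sequence 0, …, 0, 1, 1, … whose last 0 is at i
  step : ℕ → ℕ → ℤ
  step i       zero    = 0ℤ
  step zero    (suc j) = 1ℤ
  step (suc i) (suc j) = step i j

  step-0∨1 : ∀ i j → step i j ≡ 0ℤ ⊎ step i j ≡ 1ℤ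
  step-0∨1 i       zero    = inj₁ refl
  step-0∨1 zero    (suc j) = inj₂ refl
  step-0∨1 (suc i) (suc j) = step-0∨1 i j

  step-≤ : ∀ i j → j ℕ.≤ i → step i j ≡ 0ℤ
  step-≤ i zero _ = refl
  step-≤ (suc i) (suc j) (ℕ.s≤s p) = step-≤ i j p

  step-> : ∀ i j → i ℕ.< j → step i j ≡ 1ℤ
  step-> zero (suc j) _ = refl
  step-> (suc i) (suc j) (ℕ.s≤s p) = step-> i j p

  kronecker : ∀ n (W : ℕ → ℤ) i → i ℕ.< n → Σ< n (λ j → W j * (step i (suc j) - step i j)) ≡ W i
  kronecker (suc n) W zero _ = trans (cong (_+_ (W 0 * 1ℤ)) (zeros n (λ j → W (suc j))))
    (trans (+-identityʳ _) (*-identityʳ (W 0)))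
    where
    zeros : ∀ n (W : ℕ → ℤ) → Σ< n (λ j → W j * (1ℤ - 1ℤ)) ≡ 0ℤ
    zeros n W = trans (Σ<-*ʳ n W 0ℤ) (*-zeroʳ (Σ< n W))
  kronecker (suc n) W (suc i) (ℕ.s≤s p) =
    trans (cong₂ _+_ (*-zeroʳ (W 0)) (kronecker n (λ j → W (suc j)) i p)) (+-identityˡ _)

  -- The first difference of `step i` is the Kronecker delta at i, so a single weight of order n
  -- survives. It is a signed binomial coefficient, which is why one carry can never cancel out of
  -- the difference.
  difference-step : ∀ n i → i ℕ.≤ n → difference (suc n) (step i) ≡ weight n i
  difference-step n i i≤n = trans (difference-suc n (step i)) (kronecker (suc n) (weight n) i (ℕ.s≤s i≤n))

  sgn : ℕ → ℤ
  sgn zero    = 1ℤ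
  sgn (suc n) = - sgn n

  private
    double-neg : ∀ a b → a * b ≡ - a * - b
    double-neg = solve-∀

    pascal : ∀ n j → sgn (n ℕ.+ j) * weight n j + sgn (n ℕ.+ suc j) * weight n (suc j)
                     ≡ sgn (suc n ℕ.+ suc j) * weight (suc n) (suc j)
    pascal n j rewrite ℕ.+-suc n j = expand (sgn (n ℕ.+ j)) (weight n j) (weight n (suc j))
      where
      expand : ∀ a b c → a * b + - a * c ≡ - - a * (b - c)
      expand = solve-∀

  -- With the sign removed the weight is the binomial coefficient, and `pascal` is Pascal's rule.
  -- The weak inequality covers all j because one summand of that rule vanishes at the end of the
  -- row.
  0≤sgn*weight : ∀ n j → 0ℤ ≤ sgn (n ℕ.+ j) * weight n j
  0≤sgn*weight zero    zero    = +≤+ ℕ.z≤n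
  0≤sgn*weight zero    (suc j) = ≤-reflexive (sym (*-zeroʳ (- sgn j)))
  0≤sgn*weight (suc n) zero    =
    subst (0ℤ ≤_) (double-neg (sgn (n ℕ.+ 0)) (weight n 0)) (0≤sgn*weight n 0)
  0≤sgn*weight (suc n) (suc j) =
    subst (0ℤ ≤_) (pascal n j) (+-mono-≤ (0≤sgn*weight n j) (0≤sgn*weight n (suc j)))

  0<sgn*weight : ∀ n j → j ℕ.≤ n → 0ℤ < sgn (n ℕ.+ j) * weight n j
  0<sgn*weight zero    zero    _ = +<+ ℕ.z<s
  0<sgn*weight (suc n) zero    _ =
    subst (0ℤ <_) (double-neg (sgn (n ℕ.+ 0)) (weight n 0)) (0<sgn*weight n 0 ℕ.z≤n)
  0<sgn*weight (suc n) (suc j) (ℕ.s≤s j≤n) =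
    subst (0ℤ <_) (pascal n j) (+-mono-<-≤ (0<sgn*weight n j j≤n) (0≤sgn*weight n (suc j)))

  weight≢0 : ∀ n i → i ℕ.≤ n → weight n i ≢ 0ℤ
  weight≢0 n i i≤n eq = <-irrefl (sym (trans (cong (sgn (n ℕ.+ i) *_) eq) (*-zeroʳ (sgn (n ℕ.+ i)))))
    (0<sgn*weight n i i≤n)

  -- Leading terms of polynomials

  abs-^ : ∀ x n → ∣ x ^ n ∣ ≡ ∣ x ∣ ℕ.^ n
  abs-^ x zero    = refl
  abs-^ x (suc n) = trans (abs-* x (x ^ n)) (cong (∣ x ∣ ℕ.*_) (abs-^ x n))

  ^-distribʳ-* : ∀ n a b → (a ℕ.* b) ℕ.^ n ≡ a ℕ.^ n ℕ.* b ℕ.^ n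
  ^-distribʳ-* zero    a b = refl
  ^-distribʳ-* (suc n) a b =
    trans (cong (a ℕ.* b ℕ.*_) (^-distribʳ-* n a b)) (swap a b (a ℕ.^ n) (b ℕ.^ n))
    where
    swap : ∀ a b c d → a ℕ.* b ℕ.* (c ℕ.* d) ≡ a ℕ.* c ℕ.* (b ℕ.* d)
    swap = ℕ-Ring.solve-∀

  scale : ℤ → ℕ → ℕ
  scale x H = suc (∣ x ∣ ℕ.+ H)

  -- F has leading term a xᴰ, with an error of order D − 1 that is uniform over translates by at most H.
  -- The extra factor `scale x H` on the left avoids the exponent D − 1.
  record Asymptotic (F : ℤ → ℤ) (a : ℤ) (D A : ℕ) : Set where
    constructor asym
    field
      error : ∀ x y H → ∣ y - x ∣ ℕ.≤ H →
              scale x H ℕ.* ∣ F y - a * x ^ D ∣ ℕ.≤ A ℕ.* suc H ℕ.* scale x H ℕ.^ D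

  open Asymptotic

  private
    ∣y∣≤scale : ∀ x y H → ∣ y - x ∣ ℕ.≤ H → ∣ y ∣ ℕ.≤ scale x H
    ∣y∣≤scale x y H y-x≤H = begin
      ∣ y ∣                     ≡⟨ cong ∣_∣ (split x y) ⟩
      ∣ x + (y - x) ∣           ≤⟨ ∣i+j∣≤∣i∣+∣j∣ x (y - x) ⟩
      ∣ x ∣ ℕ.+ ∣ y - x ∣       ≤⟨ ℕ.+-monoʳ-≤ ∣ x ∣ y-x≤H ⟩
      ∣ x ∣ ℕ.+ H               ≤⟨ ℕ.n≤1+n _ ⟩
      scale x H                 ∎
      where
      open ℕ.≤-Reasoning
      split : ∀ x y → y ≡ x + (y - x)
      split = solve-∀

  asymptotic-cong : ∀ {F G a D A} → (∀ x → F x ≡ G x) → Asymptotic F a D A → Asymptotic G a D A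
  asymptotic-cong {a = a} {D} {A} F≗G (asym est) .error x y H h = 
    subst (λ z → scale x H ℕ.* ∣ z - a * x ^ D ∣ ℕ.≤ A ℕ.* suc H ℕ.* scale x H ℕ.^ D) (F≗G y) (est x y H h)

  asymptotic-weaken : ∀ {F a D A A′} → A ℕ.≤ A′ → Asymptotic F a D A → Asymptotic F a D A′
  asymptotic-weaken {D = D} A≤A′ (asym est) .error x y H h = 
    ℕ.≤-trans (est x y H h) (ℕ.*-monoˡ-≤ (scale x H ℕ.^ D) (ℕ.*-monoˡ-≤ (suc H) A≤A′))

  asymptotic-const : ∀ c → Asymptotic (λ _ → c) c 0 0
  asymptotic-const c .error x y H h = ℕ.≤-reflexive (trans
    (cong (λ z → scale x H ℕ.* ∣ z ∣) (trans (cong (_-_ c) (*-identityʳ c)) (+-inverseʳ c)))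
    (ℕ.*-zeroʳ (scale x H)))

  asymptotic-neg : ∀ {F a D A} → Asymptotic F a D A → Asymptotic (λ x → - F x) (- a) D A
  asymptotic-neg {F} {a} {D} {A} (asym est) .error x y H h = 
    subst (λ z → scale x H ℕ.* z ℕ.≤ A ℕ.* suc H ℕ.* scale x H ℕ.^ D)
      (trans (sym (∣-i∣≡∣i∣ (F y - a * x ^ D))) (cong ∣_∣ (distrib (F y) a (x ^ D)))) (est x y H h)
    where
    distrib : ∀ u a v → - (u - a * v) ≡ - u - - a * v
    distrib = solve-∀

  asymptotic-+ : ∀ {F G a b D A B} → Asymptotic F a D A → Asymptotic G b D B →
                 Asymptotic (λ x → F x + G x) (a + b) D (A ℕ.+ B)
  asymptotic-+ {F} {G} {a} {b} {D} {A} {B} (asym estF) (asym estG) .error x y H h = begin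
    N ℕ.* ∣ F y + G y - (a + b) * x ^ D ∣
      ≡⟨ cong (λ z → N ℕ.* ∣ z ∣) (regroup (F y) (G y) a b (x ^ D)) ⟩
    N ℕ.* ∣ (F y - a * x ^ D) + (G y - b * x ^ D) ∣
      ≤⟨ ℕ.*-monoʳ-≤ N (∣i+j∣≤∣i∣+∣j∣ (F y - a * x ^ D) (G y - b * x ^ D)) ⟩
    N ℕ.* (∣ F y - a * x ^ D ∣ ℕ.+ ∣ G y - b * x ^ D ∣)
      ≡⟨ ℕ.*-distribˡ-+ N (∣ F y - a * x ^ D ∣) (∣ G y - b * x ^ D ∣) ⟩
    N ℕ.* ∣ F y - a * x ^ D ∣ ℕ.+ N ℕ.* ∣ G y - b * x ^ D ∣
      ≤⟨ ℕ.+-mono-≤ (estF x y H h) (estG x y H h) ⟩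
    A ℕ.* suc H ℕ.* N ℕ.^ D ℕ.+ B ℕ.* suc H ℕ.* N ℕ.^ D
      ≡⟨ factor A B (suc H) (N ℕ.^ D) ⟩
    (A ℕ.+ B) ℕ.* suc H ℕ.* N ℕ.^ D ∎
    where
    open ℕ.≤-Reasoning
    N : ℕ
    N = scale x H
    regroup : ∀ u v a b z → u + v - (a + b) * z ≡ (u - a * z) + (v - b * z)
    regroup = solve-∀
    factor : ∀ a b c d → a ℕ.* c ℕ.* d ℕ.+ b ℕ.* c ℕ.* d ≡ (a ℕ.+ b) ℕ.* c ℕ.* d
    factor = ℕ-Ring.solve-∀

  -- With e = F y - a xᴰ, the error is c + y e + a (y - x) xᴰ. The three summands account for ∣c∣, A
  -- and ∣a∣; the last one is where the translation by at most H enters.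
  asymptotic-horner : ∀ {F a D A} c → Asymptotic F a D A →
                      Asymptotic (λ x → c + x * F x) a (suc D) (∣ c ∣ ℕ.+ A ℕ.+ ∣ a ∣)
  asymptotic-horner {F} {a} {D} {A} c (asym est) .error x y H h = begin
    N ℕ.* ∣ c + y * F y - a * (x * x ^ D) ∣
      ≡⟨ cong (λ z → N ℕ.* ∣ z ∣) (regroup c x y (F y) a (x ^ D)) ⟩
    N ℕ.* ∣ c + y * e + a * (y - x) * x ^ D ∣
      ≤⟨ ℕ.*-monoʳ-≤ N (ℕ.≤-trans (∣i+j∣≤∣i∣+∣j∣ (c + y * e) (a * (y - x) * x ^ D))
           (ℕ.+-mono-≤ (∣i+j∣≤∣i∣+∣j∣ c (y * e)) ℕ.≤-refl)) ⟩
    N ℕ.* (∣ c ∣ ℕ.+ ∣ y * e ∣ ℕ.+ ∣ a * (y - x) * x ^ D ∣)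
      ≡⟨ cong₂ (λ u v → N ℕ.* (∣ c ∣ ℕ.+ u ℕ.+ v)) (abs-* y e) abs-last ⟩
    N ℕ.* (∣ c ∣ ℕ.+ ∣ y ∣ ℕ.* ∣ e ∣ ℕ.+ ∣ a ∣ ℕ.* ∣ y - x ∣ ℕ.* ∣ x ∣ ℕ.^ D)
      ≤⟨ ℕ.*-monoʳ-≤ N (ℕ.+-mono-≤ (ℕ.+-monoʳ-≤ ∣ c ∣ (ℕ.*-monoˡ-≤ ∣ e ∣ (∣y∣≤scale x y H h)))
           (ℕ.*-mono-≤ (ℕ.*-monoʳ-≤ ∣ a ∣ (ℕ.≤-trans h (ℕ.n≤1+n H)))
                       (ℕ.^-monoˡ-≤ D (ℕ.m≤n⇒m≤1+n (ℕ.m≤m+n ∣ x ∣ H))))) ⟩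
    N ℕ.* (∣ c ∣ ℕ.+ N ℕ.* ∣ e ∣ ℕ.+ ∣ a ∣ ℕ.* suc H ℕ.* N ℕ.^ D)
      ≤⟨ ℕ.*-monoʳ-≤ N (ℕ.+-monoˡ-≤ _ (ℕ.+-mono-≤ c-bound (est x y H h))) ⟩
    N ℕ.* (∣ c ∣ ℕ.* suc H ℕ.* N ℕ.^ D ℕ.+ A ℕ.* suc H ℕ.* N ℕ.^ D ℕ.+ ∣ a ∣ ℕ.* suc H ℕ.* N ℕ.^ D)
      ≡⟨ factor N (∣ c ∣) A (∣ a ∣) (suc H) (N ℕ.^ D) ⟩
    (∣ c ∣ ℕ.+ A ℕ.+ ∣ a ∣) ℕ.* suc H ℕ.* (N ℕ.* N ℕ.^ D) ∎
    where
    open ℕ.≤-Reasoning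
    N : ℕ
    N = scale x H
    e : ℤ
    e = F y - a * x ^ D
    regroup : ∀ c x y u a z → c + y * u - a * (x * z) ≡ c + y * (u - a * z) + a * (y - x) * z
    regroup = solve-∀
    abs-last : ∣ a * (y - x) * x ^ D ∣ ≡ ∣ a ∣ ℕ.* ∣ y - x ∣ ℕ.* ∣ x ∣ ℕ.^ D
    abs-last = trans (abs-* (a * (y - x)) (x ^ D)) (cong₂ ℕ._*_ (abs-* a (y - x)) (abs-^ x D))
    c-bound : ∣ c ∣ ℕ.≤ ∣ c ∣ ℕ.* suc H ℕ.* N ℕ.^ D
    c-bound = ℕ.≤-trans (ℕ.m≤m*n (∣ c ∣) (suc H)) (ℕ.m≤m*n (∣ c ∣ ℕ.* suc H) (N ℕ.^ D) {{ℕ.m^n≢0 N D}})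
    factor : ∀ n c a b s z → n ℕ.* (c ℕ.* s ℕ.* z ℕ.+ a ℕ.* s ℕ.* z ℕ.+ b ℕ.* s ℕ.* z)
             ≡ (c ℕ.+ a ℕ.+ b) ℕ.* s ℕ.* (n ℕ.* z)
    factor = ℕ-Ring.solve-∀

  -- The shift is absorbed by replacing H with H + 1. This at most doubles both `suc H` and the
  -- scale, hence the factors 2 and 2ᴰ.
  asymptotic-shift : ∀ {F a D A} s → ∣ s ∣ ≡ 1 → Asymptotic F a D A →
                     Asymptotic (λ x → F (x + s)) a D (A ℕ.* 2 ℕ.* 2 ℕ.^ D)
  asymptotic-shift {F} {a} {D} {A} s ∣s∣≡1 (asym est) .error x y H h = begin
    N ℕ.* E
      ≤⟨ ℕ.*-monoˡ-≤ E (ℕ.s≤s (ℕ.+-monoʳ-≤ ∣ x ∣ (ℕ.n≤1+n H))) ⟩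
    scale x (suc H) ℕ.* E
      ≤⟨ est x (y + s) (suc H) shifted ⟩
    A ℕ.* suc (suc H) ℕ.* scale x (suc H) ℕ.^ D
      ≤⟨ ℕ.*-mono-≤ (ℕ.*-monoʳ-≤ A (double (suc H)))
                     (ℕ.^-monoˡ-≤ D (ℕ.≤-trans (ℕ.≤-reflexive (cong suc (ℕ.+-suc ∣ x ∣ H))) (double N))) ⟩
    A ℕ.* (2 ℕ.* suc H) ℕ.* (2 ℕ.* N) ℕ.^ D
      ≡⟨ cong (A ℕ.* (2 ℕ.* suc H) ℕ.*_) (^-distribʳ-* D 2 N) ⟩
    A ℕ.* (2 ℕ.* suc H) ℕ.* (2 ℕ.^ D ℕ.* N ℕ.^ D)
      ≡⟨ regroup A (suc H) (2 ℕ.^ D) (N ℕ.^ D) ⟩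
    A ℕ.* 2 ℕ.* 2 ℕ.^ D ℕ.* suc H ℕ.* N ℕ.^ D ∎
    where
    open ℕ.≤-Reasoning
    N E : ℕ
    N = scale x H
    E = ∣ F (y + s) - a * x ^ D ∣
    double : ∀ n {{_ : ℕ.NonZero n}} → suc n ℕ.≤ 2 ℕ.* n
    double (suc n) =
      ℕ.s≤s (ℕ.≤-trans (ℕ.m≤n+m (suc n) n) (ℕ.≤-reflexive (cong (λ z → n ℕ.+ suc z) (sym (ℕ.+-identityʳ n)))))
    assoc : ∀ y s x → y + s - x ≡ (y - x) + s
    assoc = solve-∀
    shifted : ∣ y + s - x ∣ ℕ.≤ suc H
    shifted = begin
      ∣ y + s - x ∣          ≡⟨ cong ∣_∣ (assoc y s x) ⟩
      ∣ (y - x) + s ∣        ≤⟨ ∣i+j∣≤∣i∣+∣j∣ (y - x) s ⟩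
      ∣ y - x ∣ ℕ.+ ∣ s ∣    ≤⟨ ℕ.+-mono-≤ h (ℕ.≤-reflexive ∣s∣≡1) ⟩
      H ℕ.+ 1                ≡⟨ ℕ.+-comm H 1 ⟩
      suc H                  ∎
    regroup : ∀ a h d n → a ℕ.* (2 ℕ.* h) ℕ.* (d ℕ.* n) ≡ a ℕ.* 2 ℕ.* d ℕ.* h ℕ.* n
    regroup = ℕ-Ring.solve-∀

  record Degree (F : ℤ → ℤ) (D : ℕ) : Set where
    constructor degree
    field
      lead            : ℤ
      lead≢0          : lead ≢ 0ℤ
      {A A′}          : ℕ
      asymptotic      : Asymptotic F lead (suc D) A
      asymptotic-step : Asymptotic (λ x → F (x + 1ℤ) - F x) (+ suc D * lead) D A′

  eval-zero : ∀ f → ¬ Any (_≢ 0ℤ) f → ∀ x → eval f x ≡ 0ℤ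
  eval-zero []      _    x = refl
  eval-zero (a ∷ f) none x = cong₂ _+_
    (decidable-stable (a ≟ 0ℤ) (λ a≢0 → none (here a≢0)))
    (trans (cong (x *_) (eval-zero f (λ any → none (there any)) x)) (*-zeroʳ x))

  -- The leading term of the difference cannot be read off from that of F, whose error has the same
  -- order D as the difference itself; so the induction carries both. The difference of a + x F x is
  -- x times the difference of F, plus F (x + 1), which turns the coefficient d c into (d + 1) c.
  -- Testing whether the tail vanishes keeps trailing zeros from posing as the leading coefficient.
  eval-degree : ∀ a f → Any (_≢ 0ℤ) f → ∃[ D ] Degree (eval (a ∷ f)) D
  eval-degree a (b ∷ f) any with any? (λ c → ¬? (c ≟ 0ℤ)) f
  ... | no none = 0 , degree b (head≢0 any)
      (asymptotic-horner a (asymptotic-cong (λ x → sym (const x)) (asymptotic-const b)))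
      (asymptotic-cong (λ x → difference-linear x)
        (subst (λ c → Asymptotic (λ _ → b) c 0 0) (sym (one b)) (asymptotic-const b)))
    where
    one : ∀ b → 1ℤ * b ≡ b
    one = solve-∀
    const : ∀ x → eval (b ∷ f) x ≡ b
    const x = trans (cong (_+_ b) (trans (cong (x *_) (eval-zero f none x)) (*-zeroʳ x))) (+-identityʳ b)
    linear : ∀ a b x → b ≡ (a + (x + 1ℤ) * b) - (a + x * b)
    linear = solve-∀
    difference-linear : ∀ x → b ≡ eval (a ∷ b ∷ f) (x + 1ℤ) - eval (a ∷ b ∷ f) x
    difference-linear x = trans (linear a b x)
      (cong₂ (λ u v → (a + (x + 1ℤ) * u) - (a + x * v)) (sym (const (x + 1ℤ))) (sym (const x)))
    head≢0 : Any (_≢ 0ℤ) (b ∷ f) → b ≢ 0ℤ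
    head≢0 (here b≢0) = b≢0
    head≢0 (there r)  = ⊥-elim (none r)
  ... | yes some with eval-degree b f some
  ...   | D , degree c c≢0 {A₀} {A₁} est est-step = suc D , degree c c≢0 (asymptotic-horner a est)
      (asymptotic-cong (λ x → product-rule a x (F x) (F (x + 1ℤ)))
        (subst (λ z → Asymptotic (λ x → (0ℤ + x * (F (x + 1ℤ) - F x)) + F (x + 1ℤ)) z (suc D)
                          (A₁ ℕ.+ ∣ + suc D * c ∣ ℕ.+ A₀ ℕ.* 2 ℕ.* 2 ℕ.^ suc D))
               (coefficient (+ suc D) c)
          (asymptotic-+ (asymptotic-horner 0ℤ est-step) (asymptotic-shift 1ℤ refl est))))
    where
    F : ℤ → ℤ
    F = eval (b ∷ f)
    product-rule : ∀ a x u v → (0ℤ + x * (v - u)) + v ≡ (a + (x + 1ℤ) * v) - (a + x * u)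
    product-rule = solve-∀
    coefficient : ∀ d c → d * c + c ≡ (1ℤ + d) * c
    coefficient = solve-∀

  -- A carry moves the floor up if p/r < θ and down if p/r > θ, so the effect of both unit steps on
  -- F is required.
  record JumpAsymptotic (F : ℤ → ℤ) : Set where
    field
      D A         : ℕ
      lead        : ℤ
      lead≢0      : lead ≢ 0ℤ
      up          : Asymptotic (λ x → F (x + 1ℤ) - F x) lead D A
      down        : Asymptotic (λ x → F (x + -1ℤ) - F x) (- lead) D A

  eval-jump : ∀ a f → Any (_≢ 0ℤ) f → JumpAsymptotic (eval (a ∷ f))
  eval-jump a f any with eval-degree a f any
  ... | D , degree c c≢0 {A′ = A} _ est = record
    { D = D ; A = A ℕ.+ A ℕ.* 2 ℕ.* 2 ℕ.^ D ; lead = + suc D * c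
    ; lead≢0 = λ eq → c≢0 ([ (λ ()) , (λ z → z) ]′ (i*j≡0⇒i≡0∨j≡0 (+ suc D) eq))
    ; up = asymptotic-weaken (ℕ.m≤m+n A _) est
    ; down = asymptotic-weaken (ℕ.m≤n+m _ A)
        (asymptotic-cong (λ x → trans (flip (F (x + -1ℤ + 1ℤ)) (F (x + -1ℤ)))
                                (cong (λ z → F (x + -1ℤ) - F z) (back x)))
          (asymptotic-neg (asymptotic-shift -1ℤ refl est)))
    }
    where
    F : ℤ → ℤ
    F = eval (a ∷ f)
    back : ∀ x → x + -1ℤ + 1ℤ ≡ x
    back = solve-∀
    flip : ∀ u v → - (u - v) ≡ v - u
    flip = solve-∀

  -- Differences of a polynomial along a progression with one jump

  norm : ℕ → (ℕ → ℤ) → ℕ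
  norm zero    W = 0
  norm (suc n) W = ∣ W 0 ∣ ℕ.+ norm n (λ j → W (suc j))

  weighted-sum-bound : ∀ n (W G : ℕ → ℤ) (N E : ℕ) → (∀ j → j ℕ.< n → N ℕ.* ∣ G j ∣ ℕ.≤ E) →
                       N ℕ.* ∣ Σ< n (λ j → W j * G j) ∣ ℕ.≤ norm n W ℕ.* E
  weighted-sum-bound zero    W G N E bound = ℕ.≤-reflexive (ℕ.*-zeroʳ N)
  weighted-sum-bound (suc n) W G N E bound = begin
    N ℕ.* ∣ W 0 * G 0 + Σ< n (λ j → W (suc j) * G (suc j)) ∣
      ≤⟨ ℕ.*-monoʳ-≤ N (∣i+j∣≤∣i∣+∣j∣ (W 0 * G 0) (Σ< n (λ j → W (suc j) * G (suc j)))) ⟩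
    N ℕ.* (∣ W 0 * G 0 ∣ ℕ.+ rest)
      ≡⟨ cong (λ z → N ℕ.* (z ℕ.+ rest)) (abs-* (W 0) (G 0)) ⟩
    N ℕ.* (∣ W 0 ∣ ℕ.* ∣ G 0 ∣ ℕ.+ rest)
      ≡⟨ distrib N (∣ W 0 ∣) (∣ G 0 ∣) rest ⟩
    ∣ W 0 ∣ ℕ.* (N ℕ.* ∣ G 0 ∣) ℕ.+ N ℕ.* rest
      ≤⟨ ℕ.+-mono-≤ (ℕ.*-monoʳ-≤ (∣ W 0 ∣) (bound 0 ℕ.z<s))
           (weighted-sum-bound n (λ j → W (suc j)) (λ j → G (suc j)) N E (λ j j<n → bound (suc j) (ℕ.s<s j<n))) ⟩
    ∣ W 0 ∣ ℕ.* E ℕ.+ norm n (λ j → W (suc j)) ℕ.* E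
      ≡⟨ ℕ.*-distribʳ-+ E (∣ W 0 ∣) (norm n (λ j → W (suc j))) ⟨
    norm (suc n) W ℕ.* E ∎
    where
    open ℕ.≤-Reasoning
    rest : ℕ
    rest = ∣ Σ< n (λ j → W (suc j) * G (suc j)) ∣
    distrib : ∀ n w g r → n ℕ.* (w ℕ.* g ℕ.+ r) ≡ w ℕ.* (n ℕ.* g) ℕ.+ n ℕ.* r
    distrib = ℕ-Ring.solve-∀

  jump-window : (ℤ → ℤ) → ℕ → ℤ → ℕ → ℤ → ℤ → ℤ
  jump-window F σ s i k p = difference σ (λ j → F (k + + j * p + s * step i j))

  total-weight : ℕ → ℕ
  total-weight σ = norm (suc σ) (weight σ)

  -- In the upper bound, c stands for the leading coefficient and A for the error, each passed
  -- through the weights. The lower bound is a threshold for ∣k∣ in units of 1 + spread: above it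
  -- the scale is at most 2∣k∣, whence 2ᴰ, and the total error is at most half of ∣k∣ᴰ.
  upperBound lowerBound : ℕ → ℕ → ℕ → ℕ → ℕ
  upperBound σ D A c = total-weight σ ℕ.* (c ℕ.+ A)
  lowerBound σ D A c = suc (2 ℕ.* total-weight σ ℕ.* A ℕ.* 2 ℕ.^ D)

  -- The bound c is kept apart from a so that upward and downward jumps, with leading coefficients
  -- of opposite sign, yield literally the same constants.
  module Window
    (F : ℤ → ℤ) (n : ℕ) (s a : ℤ) (D A c : ℕ) (a≢0 : a ≢ 0ℤ) (∣a∣≤c : ∣ a ∣ ℕ.≤ c)
    (jump : Asymptotic (λ x → F (x + s) - F x) a D A)
    (flat : ∀ k p → PolySeq (suc n) (λ j → F (k + + j * p)))
    where

    window : ℕ → ℤ → ℤ → ℤ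
    window = jump-window F (suc n) s

    weights upperC lowerC : ℕ
    weights = total-weight (suc n)
    upperC  = upperBound (suc n) D A c
    lowerC  = lowerBound (suc n) D A c

    spread : ℤ → ℕ
    spread p = suc n ℕ.* ∣ p ∣

    private
      N : ℤ → ℤ → ℕ
      N k p = scale k (spread p)

      T : ℕ → ℤ
      T = weight n

      err : ℕ → ℤ → ℤ → ℕ → ℤ
      err i k p j = step i j * (F (k + + j * p + s) - F (k + + j * p) - a * k ^ D)

      jump-when-stepped : ∀ i k p j →
        F (k + + j * p + s * step i j) ≡ F (k + + j * p) + (err i k p j + step i j * (a * k ^ D))
      jump-when-stepped i k p j with step-0∨1 i j
      ... | inj₁ eq rewrite eq = trans
        (cong F (trans (cong (_+_ (k + + j * p)) (*-zeroʳ s)) (+-identityʳ (k + + j * p))))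
        (sym (zeros (F (k + + j * p)) (F (k + + j * p + s) - F (k + + j * p) - a * k ^ D) (a * k ^ D)))
        where
        zeros : ∀ u v w → u + (0ℤ * v + 0ℤ * w) ≡ u
        zeros = solve-∀
      ... | inj₂ eq rewrite eq = trans
        (cong F (cong (_+_ (k + + j * p)) (*-identityʳ s)))
        (ones (F (k + + j * p + s)) (F (k + + j * p)) (a * k ^ D))
        where
        ones : ∀ u v w → u ≡ v + (1ℤ * (u - v - w) + 1ℤ * w)
        ones = solve-∀

      -- Each value of F is its value without the carry plus, where the step is 1, a jump. The σ-th
      -- difference annihilates the first part. Replacing all jumps by a kᴰ, with the same k for
      -- every j, leaves the difference of `step i` as the factor of the main term.
      window-error : ∀ i k p → i ℕ.≤ n →
        window i k p ≡ Σ< (suc (suc n)) (λ j → weight (suc n) j * err i k p j) + T i * (a * k ^ D)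
      window-error i k p i≤n = begin
        window i k p
          ≡⟨ Σ<-cong (suc (suc n)) (λ j _ → trans (cong (w j *_) (jump-when-stepped i k p j))
               (distrib (w j) (F (k + + j * p)) (err i k p j) (step i j) (a * k ^ D))) ⟩
        Σ< (suc (suc n)) (λ j → w j * F (k + + j * p) + (w j * err i k p j + w j * step i j * (a * k ^ D)))
          ≡⟨ Σ<-+ (suc (suc n)) (λ j → w j * F (k + + j * p))
                                 (λ j → w j * err i k p j + w j * step i j * (a * k ^ D)) ⟩
        difference (suc n) (λ j → F (k + + j * p))
          + Σ< (suc (suc n)) (λ j → w j * err i k p j + w j * step i j * (a * k ^ D))
          ≡⟨ cong₂ _+_ (difference-PolySeq (suc n) {λ j → F (k + + j * p)} (flat k p))
               (Σ<-+ (suc (suc n)) (λ j → w j * err i k p j) (λ j → w j * step i j * (a * k ^ D))) ⟩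
        0ℤ + (Σ< (suc (suc n)) (λ j → w j * err i k p j) + Σ< (suc (suc n)) (λ j → w j * step i j * (a * k ^ D)))
          ≡⟨ +-identityˡ (Σ< (suc (suc n)) (λ j → w j * err i k p j)
                          + Σ< (suc (suc n)) (λ j → w j * step i j * (a * k ^ D))) ⟩
        Σ< (suc (suc n)) (λ j → w j * err i k p j) + Σ< (suc (suc n)) (λ j → w j * step i j * (a * k ^ D))
          ≡⟨ cong (_+_ (Σ< (suc (suc n)) (λ j → w j * err i k p j)))
               (trans (Σ<-*ʳ (suc (suc n)) (λ j → w j * step i j) (a * k ^ D))
                      (cong (_* (a * k ^ D)) (difference-step n i i≤n))) ⟩
        Σ< (suc (suc n)) (λ j → w j * err i k p j) + T i * (a * k ^ D) ∎
        where
        open ≡-Reasoning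
        w : ℕ → ℤ
        w = weight (suc n)
        distrib : ∀ w f e t z → w * (f + (e + t * z)) ≡ w * f + (w * e + w * t * z)
        distrib = solve-∀

      E : ℤ → ℤ → ℕ
      E k p = weights ℕ.* (A ℕ.* suc (spread p) ℕ.* N k p ℕ.^ D)

      err-bound : ∀ i k p j → j ℕ.< suc (suc n) →
        N k p ℕ.* ∣ err i k p j ∣ ℕ.≤ A ℕ.* suc (spread p) ℕ.* N k p ℕ.^ D
      err-bound i k p j j≤n = ℕ.≤-trans (ℕ.*-monoʳ-≤ (N k p) drop-step)
        (Asymptotic.error jump k (k + + j * p) (spread p) near)
        where
        open ℕ.≤-Reasoning
        V : ℤ
        V = F (k + + j * p + s) - F (k + + j * p) - a * k ^ D
        drop-step : ∣ err i k p j ∣ ℕ.≤ ∣ V ∣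
        drop-step with step-0∨1 i j
        ... | inj₁ eq rewrite eq = subst (λ z → ∣ z ∣ ℕ.≤ ∣ V ∣) (sym (*-zeroˡ V)) ℕ.z≤n
        ... | inj₂ eq rewrite eq = ℕ.≤-reflexive (cong ∣_∣ (*-identityˡ V))
        cancel : ∀ k z → k + z - k ≡ z
        cancel = solve-∀
        near : ∣ k + + j * p - k ∣ ℕ.≤ spread p
        near = begin
          ∣ k + + j * p - k ∣   ≡⟨ cong ∣_∣ (cancel k (+ j * p)) ⟩
          ∣ + j * p ∣           ≡⟨ abs-* (+ j) p ⟩
          j ℕ.* ∣ p ∣           ≤⟨ ℕ.*-monoˡ-≤ (∣ p ∣) (ℕ.s≤s⁻¹ j≤n) ⟩
          suc n ℕ.* ∣ p ∣       ∎

      total-error : ∀ i k p → i ℕ.≤ n →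
        N k p ℕ.* ∣ Σ< (suc (suc n)) (λ j → weight (suc n) j * err i k p j) ∣ ℕ.≤ E k p
      total-error i k p i≤n =
        weighted-sum-bound (suc (suc n)) (weight (suc n)) (err i k p) (N k p) (A ℕ.* suc (spread p) ℕ.* N k p ℕ.^ D) (err-bound i k p)

      ∣T∣≤weights : ∀ i → i ℕ.≤ n → ∣ T i ∣ ℕ.≤ weights
      ∣T∣≤weights i i≤n = begin
        ∣ T i ∣                                     ≡⟨ cong ∣_∣ (difference-step n i i≤n) ⟨
        ∣ difference (suc n) (step i) ∣              ≡⟨ ℕ.*-identityˡ (∣ difference (suc n) (step i) ∣) ⟨
        1 ℕ.* ∣ difference (suc n) (step i) ∣        
          ≤⟨ weighted-sum-bound (suc (suc n)) (weight (suc n)) (step i) 1 1 (λ j _ → small j) ⟩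
        weights ℕ.* 1                               ≡⟨ ℕ.*-identityʳ weights ⟩
        weights                                     ∎
        where
        open ℕ.≤-Reasoning
        small : ∀ j → 1 ℕ.* ∣ step i j ∣ ℕ.≤ 1
        small j with step-0∨1 i j
        ... | inj₁ eq rewrite eq = ℕ.z≤n
        ... | inj₂ eq rewrite eq = ℕ.≤-refl

      main-abs : ∀ i k → ∣ T i * (a * k ^ D) ∣ ≡ ∣ T i ∣ ℕ.* (∣ a ∣ ℕ.* ∣ k ∣ ℕ.^ D)
      main-abs i k = trans (abs-* (T i) (a * k ^ D))
        (cong (∣ T i ∣ ℕ.*_) (trans (abs-* a (k ^ D)) (cong (∣ a ∣ ℕ.*_) (abs-^ k D))))

      k≤N : ∀ k p → ∣ k ∣ ℕ.≤ N k p
      k≤N k p = ℕ.m≤n⇒m≤1+n (ℕ.m≤m+n (∣ k ∣) (spread p))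

      1+H≤N : ∀ k p → suc (spread p) ℕ.≤ N k p
      1+H≤N k p = ℕ.s≤s (ℕ.m≤n+m (spread p) (∣ k ∣))

    window-upper : ∀ i k p → i ℕ.≤ n → ∣ window i k p ∣ ℕ.≤ upperC ℕ.* scale k (spread p) ℕ.^ D
    window-upper i k p i≤n = ℕ.*-cancelˡ-≤ (N k p) (begin
      N k p ℕ.* ∣ window i k p ∣
        ≡⟨ cong (λ z → N k p ℕ.* ∣ z ∣) (window-error i k p i≤n) ⟩
      N k p ℕ.* ∣ e + T i * (a * k ^ D) ∣
        ≤⟨ ℕ.*-monoʳ-≤ (N k p) (∣i+j∣≤∣i∣+∣j∣ e (T i * (a * k ^ D))) ⟩
      N k p ℕ.* (∣ e ∣ ℕ.+ ∣ T i * (a * k ^ D) ∣)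
        ≡⟨ ℕ.*-distribˡ-+ (N k p) (∣ e ∣) (∣ T i * (a * k ^ D) ∣) ⟩
      N k p ℕ.* ∣ e ∣ ℕ.+ N k p ℕ.* ∣ T i * (a * k ^ D) ∣
        ≤⟨ ℕ.+-mono-≤ (ℕ.≤-trans (total-error i k p i≤n)
             (ℕ.*-monoʳ-≤ weights (ℕ.*-monoˡ-≤ (N k p ℕ.^ D) (ℕ.*-monoʳ-≤ A (1+H≤N k p)))))
           (ℕ.*-monoʳ-≤ (N k p) (ℕ.≤-trans (ℕ.≤-reflexive (main-abs i k))
             (ℕ.*-mono-≤ (∣T∣≤weights i i≤n) (ℕ.*-mono-≤ ∣a∣≤c (ℕ.^-monoˡ-≤ D (k≤N k p)))))) ⟩
      weights ℕ.* (A ℕ.* N k p ℕ.* N k p ℕ.^ D) ℕ.+ N k p ℕ.* (weights ℕ.* (c ℕ.* N k p ℕ.^ D))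
        ≡⟨ factor weights A c (N k p) (N k p ℕ.^ D) ⟩
      N k p ℕ.* (upperC ℕ.* N k p ℕ.^ D) ∎)
      where
      open ℕ.≤-Reasoning
      e : ℤ
      e = Σ< (suc (suc n)) (λ j → weight (suc n) j * err i k p j)
      factor : ∀ w A a m z → w ℕ.* (A ℕ.* m ℕ.* z) ℕ.+ m ℕ.* (w ℕ.* (a ℕ.* z)) ≡ m ℕ.* (w ℕ.* (a ℕ.+ A) ℕ.* z)
      factor = ℕ-Ring.solve-∀

    window-lower : ∀ i k p → i ℕ.≤ n → lowerC ℕ.* suc (spread p) ℕ.≤ ∣ k ∣ →
                   ∣ k ∣ ℕ.^ D ℕ.≤ 2 ℕ.* ∣ window i k p ∣
    window-lower i k p i≤n large =
      ℕ.*-cancelˡ-≤ (N k p) (ℕ.+-cancelʳ-≤ (N k p ℕ.* K) (N k p ℕ.* K) (N k p ℕ.* (2 ℕ.* ∣ window i k p ∣)) (begin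
      N k p ℕ.* K ℕ.+ N k p ℕ.* K
        ≡⟨ double (N k p ℕ.* K) ⟩
      2 ℕ.* (N k p ℕ.* K)
        ≤⟨ ℕ.*-monoʳ-≤ 2 (ℕ.*-monoʳ-≤ (N k p) K≤) ⟩
      2 ℕ.* (N k p ℕ.* (∣ window i k p ∣ ℕ.+ ∣ e ∣))
        ≡⟨ expand (N k p) (∣ window i k p ∣) (∣ e ∣) ⟩
      N k p ℕ.* (2 ℕ.* ∣ window i k p ∣) ℕ.+ 2 ℕ.* (N k p ℕ.* ∣ e ∣)
        ≤⟨ ℕ.+-monoʳ-≤ (N k p ℕ.* (2 ℕ.* ∣ window i k p ∣)) (ℕ.*-monoʳ-≤ 2 (ℕ.≤-trans (total-error i k p i≤n)
             (ℕ.*-monoʳ-≤ weights (ℕ.*-monoʳ-≤ (A ℕ.* suc (spread p)) (ℕ.^-monoˡ-≤ D N≤2k))))) ⟩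
      N k p ℕ.* (2 ℕ.* ∣ window i k p ∣) ℕ.+ 2 ℕ.* (weights ℕ.* (A ℕ.* suc (spread p) ℕ.* (2 ℕ.* ∣ k ∣) ℕ.^ D))
        ≡⟨ cong (λ z → N k p ℕ.* (2 ℕ.* ∣ window i k p ∣) ℕ.+ z)
             (trans (cong (λ z → 2 ℕ.* (weights ℕ.* (A ℕ.* suc (spread p) ℕ.* z))) (^-distribʳ-* D 2 (∣ k ∣)))
                    (regroup weights A (suc (spread p)) (2 ℕ.^ D) K)) ⟩
      N k p ℕ.* (2 ℕ.* ∣ window i k p ∣) ℕ.+ 2 ℕ.* weights ℕ.* A ℕ.* 2 ℕ.^ D ℕ.* suc (spread p) ℕ.* K
        ≤⟨ ℕ.+-monoʳ-≤ (N k p ℕ.* (2 ℕ.* ∣ window i k p ∣))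
             (ℕ.*-monoˡ-≤ K (ℕ.≤-trans (ℕ.≤-trans (ℕ.*-monoˡ-≤ (suc (spread p)) (ℕ.n≤1+n (2 ℕ.* weights ℕ.* A ℕ.* 2 ℕ.^ D)))
               large) (k≤N k p))) ⟩
      N k p ℕ.* (2 ℕ.* ∣ window i k p ∣) ℕ.+ N k p ℕ.* K ∎))
      where
      open ℕ.≤-Reasoning
      e : ℤ
      e = Σ< (suc (suc n)) (λ j → weight (suc n) j * err i k p j)
      K : ℕ
      K = ∣ k ∣ ℕ.^ D
      double : ∀ x → x ℕ.+ x ≡ 2 ℕ.* x
      double = ℕ-Ring.solve-∀
      expand : ∀ m w e → 2 ℕ.* (m ℕ.* (w ℕ.+ e)) ≡ m ℕ.* (2 ℕ.* w) ℕ.+ 2 ℕ.* (m ℕ.* e)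
      expand = ℕ-Ring.solve-∀
      regroup : ∀ w A h t z → 2 ℕ.* (w ℕ.* (A ℕ.* h ℕ.* (t ℕ.* z))) ≡ 2 ℕ.* w ℕ.* A ℕ.* t ℕ.* h ℕ.* z
      regroup = ℕ-Ring.solve-∀
      1≤∣_∣ : ∀ {x} → x ≢ 0ℤ → 1 ℕ.≤ ∣ x ∣
      1≤∣_∣ x≢0 = ℕ.n≢0⇒n>0 (λ eq → x≢0 (∣i∣≡0⇒i≡0 eq))
      cancel : ∀ e t → t ≡ (e + t) + - e
      cancel = solve-∀
      K≤ : K ℕ.≤ ∣ window i k p ∣ ℕ.+ ∣ e ∣
      K≤ = begin
        K                                     ≡⟨ trans (ℕ.*-identityˡ (1 ℕ.* K)) (ℕ.*-identityˡ K) ⟨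
        1 ℕ.* (1 ℕ.* K)                       ≤⟨ ℕ.*-mono-≤ 1≤∣ weight≢0 n i i≤n ∣ (ℕ.*-monoˡ-≤ K 1≤∣ a≢0 ∣) ⟩
        ∣ T i ∣ ℕ.* (∣ a ∣ ℕ.* K)             ≡⟨ main-abs i k ⟨
        ∣ T i * (a * k ^ D) ∣                 ≡⟨ cong ∣_∣ (cancel e (T i * (a * k ^ D))) ⟩
        ∣ (e + T i * (a * k ^ D)) + - e ∣     ≤⟨ ∣i+j∣≤∣i∣+∣j∣ (e + T i * (a * k ^ D)) (- e) ⟩
        ∣ e + T i * (a * k ^ D) ∣ ℕ.+ ∣ - e ∣ ≡⟨ cong₂ ℕ._+_ (cong ∣_∣ (sym (window-error i k p i≤n))) (∣-i∣≡∣i∣ e) ⟩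
        ∣ window i k p ∣ ℕ.+ ∣ e ∣            ∎
      N≤2k : N k p ℕ.≤ 2 ℕ.* ∣ k ∣
      N≤2k = begin
        suc (∣ k ∣ ℕ.+ spread p)      ≡⟨ ℕ.+-suc (∣ k ∣) (spread p) ⟨
        ∣ k ∣ ℕ.+ suc (spread p)      ≤⟨ ℕ.+-monoʳ-≤ (∣ k ∣) (ℕ.≤-trans (ℕ.m≤n*m (suc (spread p)) lowerC) large) ⟩
        ∣ k ∣ ℕ.+ ∣ k ∣               ≡⟨ double (∣ k ∣) ⟩
        2 ℕ.* ∣ k ∣                   ∎

  record JumpBounds (F : ℤ → ℤ) (σ : ℕ) : Set where
    field
      D C L : ℕ
      window-upper : ∀ {s} → s ≡ 1ℤ ⊎ s ≡ -1ℤ → ∀ i k p → i ℕ.< σ →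
              ∣ jump-window F σ s i k p ∣ ℕ.≤ C ℕ.* scale k (σ ℕ.* ∣ p ∣) ℕ.^ D
      window-lower : ∀ {s} → s ≡ 1ℤ ⊎ s ≡ -1ℤ → ∀ i k p → i ℕ.< σ → suc L ℕ.* suc (σ ℕ.* ∣ p ∣) ℕ.≤ ∣ k ∣ →
              ∣ k ∣ ℕ.^ D ℕ.≤ 2 ℕ.* ∣ jump-window F σ s i k p ∣

    jump-window≢0 : ∀ {s} → s ≡ 1ℤ ⊎ s ≡ -1ℤ → ∀ i k p → i ℕ.< σ → suc L ℕ.* suc (σ ℕ.* ∣ p ∣) ℕ.≤ ∣ k ∣ →
                    jump-window F σ s i k p ≢ 0ℤ
    jump-window≢0 {s} s≡±1 i k p i<σ large eq = ℕ.<-irrefl refl (begin-strict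
      0                                        <⟨ ℕ.m^n>0 (∣ k ∣) {{ℕ.>-nonZero (ℕ.≤-trans (ℕ.s≤s ℕ.z≤n) large)}} D ⟩
      ∣ k ∣ ℕ.^ D                              ≤⟨ window-lower s≡±1 i k p i<σ large ⟩
      2 ℕ.* ∣ jump-window F σ s i k p ∣        ≡⟨ cong (λ z → 2 ℕ.* ∣ z ∣) eq ⟩
      0                                        ∎)
      where open ℕ.≤-Reasoning

  jump-bounds : ∀ F n → JumpAsymptotic F → (∀ k p → PolySeq (suc n) (λ j → F (k + + j * p))) → JumpBounds F (suc n)
  jump-bounds F n asymptotics flat = record
    { D = D ; C = upperBound (suc n) D A (∣ lead ∣) ; L = 2 ℕ.* total-weight (suc n) ℕ.* A ℕ.* 2 ℕ.^ D
    -- `jump-window` takes σ = n + 1 differences, and a jump after index i < σ is what `Window`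
    -- phrases as i ≤ n.
    ; window-upper = λ { (inj₁ refl) i k p i<σ → Up.window-upper i k p (ℕ.s≤s⁻¹ i<σ)
                ; (inj₂ refl) i k p i<σ → Down.window-upper i k p (ℕ.s≤s⁻¹ i<σ) }
    ; window-lower = λ { (inj₁ refl) i k p i<σ → Up.window-lower i k p (ℕ.s≤s⁻¹ i<σ)
                ; (inj₂ refl) i k p i<σ → Down.window-lower i k p (ℕ.s≤s⁻¹ i<σ) }
    }
    where
    open JumpAsymptotic asymptotics
    module Up   = Window F n 1ℤ lead D A (∣ lead ∣) lead≢0 ℕ.≤-refl up flat
    module Down = Window F n -1ℤ (- lead) D A (∣ lead ∣) (λ eq → lead≢0 (neg-injective eq))
                         (ℕ.≤-reflexive (∣-i∣≡∣i∣ lead)) down flat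

  -- Either the gap l dominates x, or x is large and then controls xᴰ through V.
  variation : ∀ D C L Q {x y h l U V} → 
    h ℕ.≤ Q ℕ.* l → y ℕ.≤ x ℕ.+ l →
    U ℕ.≤ C ℕ.* (y ℕ.+ h) ℕ.^ D → (L ℕ.* h ℕ.≤ x → x ℕ.^ D ℕ.≤ 2 ℕ.* V) →
    U ℕ.≤ C ℕ.* (L ℕ.* Q ℕ.+ 2 ℕ.+ Q) ℕ.^ D ℕ.* 2 ℕ.* (l ℕ.^ D ℕ.+ V)
  variation D C L Q {x} {y} {h} {l} {U} {V} h≤ y≤ U≤ lower = begin
    U                                             ≤⟨ U≤ ⟩
    C ℕ.* (y ℕ.+ h) ℕ.^ D                         ≤⟨ ℕ.*-monoʳ-≤ C power ⟩
    C ℕ.* (R ℕ.^ D ℕ.* (2 ℕ.* (l ℕ.^ D ℕ.+ V)))   ≡⟨ assoc C (R ℕ.^ D) (l ℕ.^ D ℕ.+ V) ⟩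
    C ℕ.* R ℕ.^ D ℕ.* 2 ℕ.* (l ℕ.^ D ℕ.+ V)       ∎
    where
    open ℕ.≤-Reasoning
    R : ℕ
    R = L ℕ.* Q ℕ.+ 2 ℕ.+ Q
    assoc : ∀ c r v → c ℕ.* (r ℕ.* (2 ℕ.* v)) ≡ c ℕ.* r ℕ.* 2 ℕ.* v
    assoc = ℕ-Ring.solve-∀
    y+h≤ : y ℕ.+ h ℕ.≤ x ℕ.+ (1 ℕ.+ Q) ℕ.* l
    y+h≤ = ℕ.≤-trans (ℕ.+-mono-≤ y≤ h≤) (ℕ.≤-reflexive (collect x Q l))
      where
      collect : ∀ x q l → x ℕ.+ l ℕ.+ q ℕ.* l ≡ x ℕ.+ (1 ℕ.+ q) ℕ.* l
      collect = ℕ-Ring.solve-∀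
    power : (y ℕ.+ h) ℕ.^ D ℕ.≤ R ℕ.^ D ℕ.* (2 ℕ.* (l ℕ.^ D ℕ.+ V))
    power with ℕ.≤-total x ((L ℕ.* Q ℕ.+ 1) ℕ.* l)
    ... | inj₁ x≤ = begin
      (y ℕ.+ h) ℕ.^ D                     ≤⟨ ℕ.^-monoˡ-≤ D (ℕ.≤-trans y+h≤ (ℕ.+-monoˡ-≤ _ x≤)) ⟩
      ((L ℕ.* Q ℕ.+ 1) ℕ.* l ℕ.+ (1 ℕ.+ Q) ℕ.* l) ℕ.^ D
                                          ≡⟨ cong (ℕ._^ D) (collect (L ℕ.* Q) Q l) ⟩
      (R ℕ.* l) ℕ.^ D                     ≡⟨ ^-distribʳ-* D R l ⟩
      R ℕ.^ D ℕ.* l ℕ.^ D                 ≤⟨ ℕ.*-monoʳ-≤ (R ℕ.^ D) (ℕ.≤-trans (ℕ.m≤m+n (l ℕ.^ D) V) (ℕ.m≤n*m _ 2)) ⟩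
      R ℕ.^ D ℕ.* (2 ℕ.* (l ℕ.^ D ℕ.+ V)) ∎
      where
      collect : ∀ m q l → (m ℕ.+ 1) ℕ.* l ℕ.+ (1 ℕ.+ q) ℕ.* l ≡ (m ℕ.+ 2 ℕ.+ q) ℕ.* l
      collect = ℕ-Ring.solve-∀
    ... | inj₂ ≤x = begin
      (y ℕ.+ h) ℕ.^ D                     
        ≤⟨ ℕ.^-monoˡ-≤ D (ℕ.≤-trans y+h≤ (ℕ.+-monoʳ-≤ x (ℕ.*-monoʳ-≤ (1 ℕ.+ Q) l≤x))) ⟩
      (x ℕ.+ (1 ℕ.+ Q) ℕ.* x) ℕ.^ D       ≤⟨ ℕ.^-monoˡ-≤ D (ℕ.*-monoˡ-≤ x (ℕ.+-monoˡ-≤ Q (ℕ.m≤n+m 2 (L ℕ.* Q)))) ⟩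
      (R ℕ.* x) ℕ.^ D                     ≡⟨ ^-distribʳ-* D R x ⟩
      R ℕ.^ D ℕ.* x ℕ.^ D                 
        ≤⟨ ℕ.*-monoʳ-≤ (R ℕ.^ D) (ℕ.≤-trans (lower Lh≤x) (ℕ.*-monoʳ-≤ 2 (ℕ.m≤n+m V (l ℕ.^ D)))) ⟩
      R ℕ.^ D ℕ.* (2 ℕ.* (l ℕ.^ D ℕ.+ V)) ∎
      where
      l≤x : l ℕ.≤ x
      l≤x = ℕ.≤-trans (ℕ.m≤n*m l (L ℕ.* Q ℕ.+ 1) {{ℕ.>-nonZero (ℕ.m≤n+m 1 (L ℕ.* Q))}}) ≤x
      Lh≤x : L ℕ.* h ℕ.≤ x
      Lh≤x = begin
        L ℕ.* h                     ≤⟨ ℕ.*-monoʳ-≤ L h≤ ⟩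
        L ℕ.* (Q ℕ.* l)             ≡⟨ ℕ.*-assoc L Q l ⟨
        L ℕ.* Q ℕ.* l               ≤⟨ ℕ.*-monoˡ-≤ l (ℕ.m≤m+n (L ℕ.* Q) 1) ⟩
        (L ℕ.* Q ℕ.+ 1) ℕ.* l       ≤⟨ ≤x ⟩
        x                           ∎

  -- Rational approximation in the ordered group ℤ + ℤθ

  -- An order on ℤ², where `Pos a b` stands for 0 < aθ + b.
  record Order (Pos : ℤ → ℤ → Set) : Set where
    field
      pos-+  : ∀ {a b c d} → Pos a b → Pos c d → Pos (a + c) (b + d)
      pos-1  : Pos 0ℤ 1ℤ
      pos⇒0< : ∀ {b} → Pos 0ℤ b → 0ℤ < b

  module OrderProperties {Pos : ℤ → ℤ → Set} (order : Order Pos) where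
    open Order order public

    ¬pos-0 : ¬ Pos 0ℤ 0ℤ
    ¬pos-0 p = <-irrefl refl (pos⇒0< p)

    pos-≡ : ∀ {a b c d} → a ≡ c → b ≡ d → Pos a b → Pos c d
    pos-≡ = subst₂ Pos

    pos-+* : ∀ {a b c d} → Pos c d → ∀ n → Pos a b → Pos (c + + n * a) (d + + n * b)
    pos-+* {a} {b} {c} {d} base zero    p = pos-≡ (sym (+-identityʳ c)) (sym (+-identityʳ d)) base
    pos-+* {a} {b} {c} {d} base (suc n) p =
      pos-≡ (collect c a (+ n)) (collect d b (+ n)) (pos-+ (pos-+* base n p) p)
      where
      collect : ∀ c a n → c + n * a + a ≡ c + (1ℤ + n) * a
      collect = solve-∀

    pos-scale : ∀ n {a b} → 1 ℕ.≤ n → Pos a b → Pos (+ n * a) (+ n * b)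
    pos-scale (suc n) {a} {b} _ p = pos-≡ (collect a (+ n)) (collect b (+ n)) (pos-+* p n p)
      where
      collect : ∀ a n → a + n * a ≡ (1ℤ + n) * a
      collect = solve-∀

  module Approximation
    {Pos : ℤ → ℤ → Set} (order : Order Pos)
    (compare : ∀ a b → a ≢ 0ℤ → Pos a b ⊎ Pos (- a) (- b))
    (archimedean : ∀ {a b} → Pos a b → ∃[ n ] Pos (+ n * a) (+ n * b - 1ℤ))
    (0<θ : Pos 1ℤ 0ℤ) (θ<1 : Pos -1ℤ 1ℤ)
    where

    open OrderProperties order

    -- Neighbouring fractions p/q < θ < p′/q′ of the Stern–Brocot tree.
    record Neighbours : Set where
      field
        q p q′ p′ : ℕ
        1≤q       : 1 ℕ.≤ q
        1≤q′      : 1 ℕ.≤ q′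
        p≤q       : p ℕ.≤ q
        p′≤q′     : p′ ℕ.≤ q′
        det       : + p′ * + q ≡ + p * + q′ + 1ℤ
        below     : Pos (+ q) (- + p)
        above     : Pos (- + q′) (+ p′)

      size : ℕ
      size = q ℕ.+ q′

    open Neighbours

    root : Neighbours
    root = record
      { q = 1 ; p = 0 ; q′ = 1 ; p′ = 1
      ; 1≤q = ℕ.≤-refl ; 1≤q′ = ℕ.≤-refl ; p≤q = ℕ.z≤n ; p′≤q′ = ℕ.≤-refl
      ; det = refl ; below = 0<θ ; above = θ<1 }

    raise : (S : Neighbours) → Pos (+ size S) (- + (p S ℕ.+ p′ S)) → Neighbours
    raise S pos = record
      { q = q S ℕ.+ q′ S ; p = p S ℕ.+ p′ S ; q′ = q′ S ; p′ = p′ S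
      ; 1≤q = ℕ.≤-trans (1≤q S) (ℕ.m≤m+n _ _) ; 1≤q′ = 1≤q′ S
      ; p≤q = ℕ.+-mono-≤ (p≤q S) (p′≤q′ S) ; p′≤q′ = p′≤q′ S
      ; det = trans (left (+ p′ S) (+ q S) (+ q′ S))
                    (trans (cong (_+ + p′ S * + q′ S) (det S)) (right (+ p S) (+ q′ S) (+ p′ S)))
      ; below = pos ; above = above S }
      where
      left : ∀ a b c → a * (b + c) ≡ a * b + a * c
      left = solve-∀
      right : ∀ a c b → a * c + 1ℤ + b * c ≡ (a + b) * c + 1ℤ
      right = solve-∀

    lower : (S : Neighbours) → Pos (- + size S) (+ (p S ℕ.+ p′ S)) → Neighbours
    lower S pos = record
      { q = q S ; p = p S ; q′ = q S ℕ.+ q′ S ; p′ = p S ℕ.+ p′ S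
      ; 1≤q = 1≤q S ; 1≤q′ = ℕ.≤-trans (1≤q S) (ℕ.m≤m+n _ _)
      ; p≤q = p≤q S ; p′≤q′ = ℕ.+-mono-≤ (p≤q S) (p′≤q′ S)
      ; det = trans (left (+ p S) (+ p′ S) (+ q S))
                    (trans (cong (_+_ (+ p S * + q S)) (det S)) (right (+ p S) (+ q S) (+ q′ S)))
      ; below = below S ; above = pos }
      where
      left : ∀ a b c → (a + b) * c ≡ a * c + b * c
      left = solve-∀
      right : ∀ a b c → a * b + (a * c + 1ℤ) ≡ a * (b + c) + 1ℤ
      right = solve-∀

    -- q (p′ − q′θ) + q′ (qθ − p) = 1, so each summand is less than 1.
    below-small : (S : Neighbours) → Pos (- (+ q′ S * + q S)) (1ℤ + + q′ S * + p S)
    below-small S = pos-≡ (swap (+ q S) (+ q′ S))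
      (trans (comm (+ q S) (+ p′ S)) (trans (det S) (comm′ (+ p S) (+ q′ S))))
      (pos-scale (q S) (1≤q S) (above S))
      where
      swap : ∀ a b → a * - b ≡ - (b * a)
      swap = solve-∀
      comm : ∀ a b → a * b ≡ b * a
      comm = solve-∀
      comm′ : ∀ a b → a * b + 1ℤ ≡ 1ℤ + b * a
      comm′ = solve-∀

    above-small : (S : Neighbours) → Pos (+ q S * + q′ S) (1ℤ - + q S * + p′ S)
    above-small S = pos-≡ (swap (+ q S) (+ q′ S))
      (trans (expand (+ p S) (+ q′ S)) (trans (cong (_-_ 1ℤ) (sym (det S))) (comm (+ p′ S) (+ q S))))
      (pos-scale (q′ S) (1≤q′ S) (below S))
      where
      swap : ∀ a b → b * a ≡ a * b
      swap = solve-∀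
      expand : ∀ a b → b * - a ≡ 1ℤ - (a * b + 1ℤ)
      expand = solve-∀
      comm : ∀ a b → 1ℤ - a * b ≡ 1ℤ - b * a
      comm = solve-∀

    -- By `below-small`, q′ copies of the distance stay below 1; all copies but one are dropped.
    -- Together with the Archimedean property this bounds the number of subtractions in `balance`.
    below<1 : (S : Neighbours) → Pos (- + q S) (1ℤ + + p S)
    below<1 S = pos-≡ (first (+ q S)) (second (+ p S)) (go (q′ S) (1≤q′ S) (below-small S))
      where
      first : ∀ a → - (1ℤ * a) ≡ - a
      first = solve-∀
      second : ∀ b → 1ℤ + 1ℤ * b ≡ 1ℤ + b
      second = solve-∀
      drop : ∀ a n → - ((1ℤ + n) * a) + n * a ≡ - (1ℤ * a)
      drop = solve-∀
      drop′ : ∀ b n → 1ℤ + (1ℤ + n) * b + n * - b ≡ 1ℤ + 1ℤ * b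
      drop′ = solve-∀
      go : ∀ n → 1 ℕ.≤ n → Pos (- (+ n * + q S)) (1ℤ + + n * + p S) →
           Pos (- (1ℤ * + q S)) (1ℤ + 1ℤ * + p S)
      go (suc n) _ pos = pos-≡ (drop (+ q S) (+ n)) (drop′ (+ p S) (+ n)) (pos-+* pos n (below S))

    above<1 : (S : Neighbours) → Pos (+ q′ S) (1ℤ - + p′ S)
    above<1 S = pos-≡ (first (+ q′ S)) (second (+ p′ S)) (go (q S) (1≤q S) (above-small S))
      where
      first : ∀ a → 1ℤ * a ≡ a
      first = solve-∀
      second : ∀ b → 1ℤ - 1ℤ * b ≡ 1ℤ - b
      second = solve-∀
      drop : ∀ a n → (1ℤ + n) * a + n * - a ≡ 1ℤ * a
      drop = solve-∀
      drop′ : ∀ b n → 1ℤ - (1ℤ + n) * b + n * b ≡ 1ℤ - 1ℤ * b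
      drop′ = solve-∀
      go : ∀ n → 1 ℕ.≤ n → Pos (+ n * + q′ S) (1ℤ - + n * + p′ S) →
           Pos (1ℤ * + q′ S) (1ℤ - 1ℤ * + p′ S)
      go (suc n) _ pos = pos-≡ (drop (+ q′ S) (+ n)) (drop′ (+ p′ S) (+ n)) (pos-+* pos n (above S))

    record Grown (Y : ℕ) : Set where
      field
        S    : Neighbours
        Y≤   : Y ℕ.≤ size S
        q≤   : q S ℕ.≤ Y
        q′≤  : q′ S ℕ.≤ Y

    private
      +suc≢0 : ∀ {m} → 1 ℕ.≤ m → + m ≢ 0ℤ
      +suc≢0 (ℕ.s≤s _) ()

      1≤size : (S : Neighbours) → 1 ℕ.≤ size S
      1≤size S = ℕ.≤-trans (1≤q S) (ℕ.m≤m+n _ _)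

      neg-neg : ∀ {b} → - - (+ b) ≡ + b
      neg-neg {zero}  = refl
      neg-neg {suc b} = refl

    compareℕ : ∀ a b → 1 ℕ.≤ a → Pos (+ a) (- + b) ⊎ Pos (- + a) (+ b)
    compareℕ a b 1≤a with compare (+ a) (- + b) (+suc≢0 1≤a)
    ... | inj₁ pos = inj₁ pos
    ... | inj₂ neg = inj₂ (pos-≡ refl (neg-neg {b}) neg)

    -- A new denominator is the previous size, which is still below Y whenever the descent
    -- continues. So neither denominator exceeds Y although their sum reaches it. The size grows by
    -- at least 1 in each step, so Y steps suffice.
    grow : ∀ Y → 1 ℕ.≤ Y → Grown Y
    grow Y 1≤Y = go Y root 1≤Y 1≤Y (ℕ.m≤n+m Y 2)
      where
      go : ∀ fuel S → q S ℕ.≤ Y → q′ S ℕ.≤ Y → Y ℕ.≤ size S ℕ.+ fuel → Grown Y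
      go zero S q≤ q′≤ Y≤ = record { S = S ; Y≤ = subst (Y ℕ.≤_) (ℕ.+-identityʳ _) Y≤ ; q≤ = q≤ ; q′≤ = q′≤ }
      go (suc fuel) S q≤ q′≤ Y≤ with Y ℕ.≤? size S
      ... | yes Y≤S = record { S = S ; Y≤ = Y≤S ; q≤ = q≤ ; q′≤ = q′≤ }
      ... | no  Y≰S with compareℕ (size S) (p S ℕ.+ p′ S) (1≤size S)
      ...   | inj₁ pos = go fuel (raise S pos) (ℕ.<⇒≤ (ℕ.≰⇒> Y≰S)) q′≤
        (ℕ.≤-trans Y≤ (ℕ.≤-trans (ℕ.≤-reflexive (ℕ.+-suc _ fuel))
          (ℕ.+-monoˡ-≤ fuel (ℕ.m<m+n (size S) (1≤q′ S)))))
      ...   | inj₂ neg = go fuel (lower S neg) q≤ (ℕ.<⇒≤ (ℕ.≰⇒> Y≰S))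
        (ℕ.≤-trans Y≤ (ℕ.≤-trans (ℕ.≤-reflexive (ℕ.+-suc _ fuel))
          (ℕ.+-monoˡ-≤ fuel (ℕ.m<n+m (size S) (1≤q S)))))

    -- The distances qθ − p and p′ − q′θ differ by a factor of less than 2.
    record Balanced (B : ℕ) : Set where
      field
        S      : Neighbours
        B≤     : B ℕ.≤ size S
        below≲ : Pos (- + (q′ S ℕ.+ size S)) (+ (p′ S ℕ.+ (p S ℕ.+ p′ S)))
        above≲ : Pos (+ (q S ℕ.+ size S)) (- + (p S ℕ.+ (p S ℕ.+ p′ S)))

    balance : (S : Neighbours) → Balanced (size S)
    balance S = start (compareℕ (size S) (p S ℕ.+ p′ S) (1≤size S))
      where
      B : ℕ
      B = size S

      -- Subtractive Euclid on d = qθ - p and d′ = p′ - q′θ with d > d′: raising the lower neighbour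
      -- replaces d by d - d′, until d < 2d′. The last hypothesis says d < n d′, which makes n a
      -- bound on the remaining steps.
      reduce-below : ∀ n T → B ℕ.≤ size T → Pos (+ size T) (- + (p T ℕ.+ p′ T)) →
                     Pos (- + q T + + n * - + q′ T) (+ p T + + n * + p′ T) → Balanced B
      reduce-below zero T B≤ _ bound = ⊥-elim (¬pos-0
        (pos-≡ (vanish (+ q T) (- + q′ T)) (vanish′ (+ p T) (+ p′ T)) (pos-+ bound (below T))))
        where
        vanish : ∀ a b → - a + 0ℤ * b + a ≡ 0ℤ
        vanish = solve-∀
        vanish′ : ∀ a b → a + 0ℤ * b + - a ≡ 0ℤ
        vanish′ = solve-∀
      reduce-below (suc n) T B≤ pos bound
        with compareℕ (q′ T ℕ.+ size T) (p′ T ℕ.+ (p T ℕ.+ p′ T)) (ℕ.≤-trans (1≤q′ T) (ℕ.m≤m+n _ _))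
      ... | inj₂ done = record { S = T ; B≤ = B≤ ; below≲ = done
                               ; above≲ = pos-≡ refl (sum-neg (+ p T) (+ p′ T)) (pos-+ (below T) pos) }
        where
        sum-neg : ∀ a b → - a + - (a + b) ≡ - (a + (a + b))
        sum-neg = solve-∀
      ... | inj₁ more = reduce-below n (raise T pos) (ℕ.≤-trans B≤ (ℕ.m≤m+n _ _))
        (pos-≡ (comm (+ q′ T) (+ q T)) (cong -_ (comm (+ p′ T) (+ p T))) more)
        (pos-≡ (shiftq (+ q T) (+ q′ T) (+ n)) (shiftp (+ p T) (+ p′ T) (+ n)) bound)
        where
        comm : ∀ a b → a + (b + a) ≡ b + a + a
        comm = solve-∀
        shiftq : ∀ a b n → - a + (1ℤ + n) * - b ≡ - (a + b) + n * - b
        shiftq = solve-∀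
        shiftp : ∀ a b n → a + (1ℤ + n) * b ≡ a + b + n * b
        shiftp = solve-∀

      reduce-above : ∀ n T → B ℕ.≤ size T → Pos (- + size T) (+ (p T ℕ.+ p′ T)) →
                     Pos (+ q′ T + + n * + q T) (- + p′ T + + n * - + p T) → Balanced B
      reduce-above zero T B≤ _ bound = ⊥-elim (¬pos-0
        (pos-≡ (vanish′ (+ q′ T) (+ q T)) (vanish (+ p′ T) (- + p T)) (pos-+ bound (above T))))
        where
        vanish : ∀ a b → - a + 0ℤ * b + a ≡ 0ℤ
        vanish = solve-∀
        vanish′ : ∀ a b → a + 0ℤ * b + - a ≡ 0ℤ
        vanish′ = solve-∀
      reduce-above (suc n) T B≤ neg bound
        with compareℕ (q T ℕ.+ size T) (p T ℕ.+ (p T ℕ.+ p′ T)) (ℕ.≤-trans (1≤q T) (ℕ.m≤m+n _ _))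
      ... | inj₁ done = record { S = T ; B≤ = B≤ ; above≲ = done
                               ; below≲ = pos-≡ (sum-neg (+ q′ T) (+ q T)) refl (pos-+ (above T) neg) }
        where
        sum-neg : ∀ a b → - a + - (b + a) ≡ - (a + (b + a))
        sum-neg = solve-∀
      ... | inj₂ more = reduce-above n (lower T neg) (ℕ.≤-trans B≤ (ℕ.m≤n+m _ (q T)))
        more
        (pos-≡ (shiftp (+ q′ T) (+ q T) (+ n)) (shiftq (+ p′ T) (+ p T) (+ n)) bound)
        where
        shiftq : ∀ a b n → - a + (1ℤ + n) * - b ≡ - (b + a) + n * - b
        shiftq = solve-∀
        shiftp : ∀ a b n → a + (1ℤ + n) * b ≡ b + a + n * b
        shiftp = solve-∀

      start : Pos (+ size S) (- + (p S ℕ.+ p′ S)) ⊎ Pos (- + size S) (+ (p S ℕ.+ p′ S)) → Balanced B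
      -- The number of steps comes from n d′ > 1 > d, where d and d′ are the distances of the lower
      -- and the upper neighbour.
      start (inj₁ pos) with archimedean (above S)
      ... | n , big = reduce-below n S ℕ.≤-refl pos
        (pos-≡ (swap (+ n * - + q′ S) (- + q S)) (cancel (+ n * + p′ S) (+ p S)) (pos-+ big (below<1 S)))
        where
        swap : ∀ a b → a + b ≡ b + a
        swap = solve-∀
        cancel : ∀ a b → a - 1ℤ + (1ℤ + b) ≡ b + a
        cancel = solve-∀
      start (inj₂ neg) with archimedean (below S)
      ... | n , big = reduce-above n S ℕ.≤-refl neg
        (pos-≡ (swap (+ n * + q S) (+ q′ S)) (cancel (+ n * - + p S) (+ p′ S)) (pos-+ big (above<1 S)))
        where
        swap : ∀ a b → a + b ≡ b + a
        swap = solve-∀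
        cancel : ∀ a b → a - 1ℤ + (1ℤ - b) ≡ - b + a
        cancel = solve-∀

    private
      sign-view : ∀ z → (∃[ n ] z ≡ 1ℤ + + n) ⊎ (∃[ n ] z ≡ - + n)
      sign-view (+ zero)   = inj₂ (0 , refl)
      sign-view (+ suc n)  = inj₁ (n , refl)
      sign-view (-[1+ n ]) = inj₂ (suc n , refl)

      0≤* : ∀ m n → 0ℤ ≤ + m * + n
      0≤* m n = subst (0ℤ ≤_) (pos-* m n) (+≤+ ℕ.z≤n)

    module Gap {B : ℕ} (balanced : Balanced B) where
      open Balanced balanced

      X : ℕ
      X = size S

      M : ℤ
      M = + (X ℕ.+ X)

      -- Let d = qθ - p and d′ = p′ - q′θ. Balance gives 2d > d′, and the determinant gives q d′ +
      -- q′ d = 1. Hence 0 < q (2d - d′) + q′ d = 2X d - 1.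
      below-large : Pos (M * + q S) (- (M * + p S) - 1ℤ)
      below-large = pos-≡ (first (+ q S) (+ q′ S))
        (trans (second (+ q S) (+ q′ S) (+ p S) (+ p′ S))
          (trans (cong (λ z → - (+ p S * + q S + + p S * + q S + (+ p S * + q′ S)) - z) (det S))
            (third (+ q S) (+ q′ S) (+ p S))))
        (pos-+* (pos-scale (q S) (1≤q S) above≲) (q′ S) (below S))
        where
        first : ∀ q q′ → q * (q + (q + q′)) + q′ * q ≡ (q + q′ + (q + q′)) * q
        first = solve-∀
        second : ∀ q q′ p p′ → q * - (p + (p + p′)) + q′ * - p ≡ - (p * q + p * q + p * q′) - p′ * q
        second = solve-∀
        third : ∀ q q′ p → - (p * q + p * q + p * q′) - (p * q′ + 1ℤ) ≡ - ((q + q′ + (q + q′)) * p) - 1ℤ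
        third = solve-∀

      above-large : Pos (- (M * + q′ S)) (M * + p′ S - 1ℤ)
      above-large = pos-≡ (first (+ q S) (+ q′ S))
        (trans (second (+ q S) (+ q′ S) (+ p S) (+ p′ S))
          (trans (cong (λ z → + q′ S * + p′ S + + q′ S * + p′ S + + p′ S * + q S + z - 1ℤ) (sym (det S)))
            (third (+ q S) (+ q′ S) (+ p′ S))))
        (pos-+* (pos-scale (q′ S) (1≤q′ S) below≲) (q S) (above S))
        where
        first : ∀ q q′ → q′ * - (q′ + (q + q′)) + q * - q′ ≡ - ((q + q′ + (q + q′)) * q′)
        first = solve-∀
        second : ∀ q q′ p p′ → q′ * (p′ + (p + p′)) + q * p′ ≡ q′ * p′ + q′ * p′ + p′ * q + (p * q′ + 1ℤ) - 1ℤ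
        second = solve-∀
        third : ∀ q q′ p′ → q′ * p′ + q′ * p′ + p′ * q + p′ * q - 1ℤ ≡ (q + q′ + (q + q′)) * p′ - 1ℤ
        third = solve-∀

      -- Here xθ + y is so small that no lθ − t with 0 < l < X lies within σ (xθ + y) of 0.
      module _ (σ : ℕ) (x y : ℤ) (small : Pos (- (+ σ * M * x)) (1ℤ - + σ * M * y)) where

        private
          1≤X+X : 1 ℕ.≤ X ℕ.+ X
          1≤X+X = ℕ.≤-trans (1≤size S) (ℕ.m≤m+n X X)

          not-above-below : ¬ Pos (+ σ * x - + q S) (+ σ * y + + p S)
          not-above-below pos = ¬pos-0 (pos-≡ (vanish (+ σ) M x (+ q S)) (vanish′ (+ σ) M y (+ p S))
            (pos-+ (pos-+ (pos-scale (X ℕ.+ X) 1≤X+X pos) small) below-large))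
            where
            vanish : ∀ s M x q → M * (s * x - q) + - (s * M * x) + M * q ≡ 0ℤ
            vanish = solve-∀
            vanish′ : ∀ s M y p → M * (s * y + p) + (1ℤ - s * M * y) + (- (M * p) - 1ℤ) ≡ 0ℤ
            vanish′ = solve-∀

          not-above-above : ¬ Pos (+ σ * x + + q′ S) (+ σ * y - + p′ S)
          not-above-above pos = ¬pos-0 (pos-≡ (vanish (+ σ) M x (+ q′ S)) (vanish′ (+ σ) M y (+ p′ S))
            (pos-+ (pos-+ (pos-scale (X ℕ.+ X) 1≤X+X pos) small) above-large))
            where
            vanish : ∀ s M x q → M * (s * x + q) + - (s * M * x) + - (M * q) ≡ 0ℤ
            vanish = solve-∀
            vanish′ : ∀ s M y p → M * (s * y - p) + (1ℤ - s * M * y) + (M * p - 1ℤ) ≡ 0ℤ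
            vanish′ = solve-∀

          -- If both coordinates are positive, then l ≥ q + q′ = X; if neither is, then l ≤ 0. With
          -- opposite signs the two contributions to lθ - t have equal sign, so ∣lθ - t∣ is at least
          -- the distance of one of the neighbours, which exceeds 1/(2X) and hence σ (xθ + y).
          by-coordinates : ∀ l t a b → l ≡ a * + q S + b * + q′ S → t ≡ a * + p S + b * + p′ S →
            0ℤ < l → l < + X →
            Pos (+ σ * x - l) (+ σ * y + t) → Pos (+ σ * x + l) (+ σ * y - t) → ⊥
          by-coordinates l t a b refl refl 0<l l<X up down with sign-view a | sign-view b
          ... | inj₁ (m , refl) | inj₁ (n , refl) = <⇒≱ l<X (≤-trans
            (≤-reflexive (sym (+-identityʳ (+ X))))
            (≤-trans (+-monoʳ-≤ (+ X) (+-mono-≤ (0≤* m (q S)) (0≤* n (q′ S))))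
                     (≤-reflexive (expand (+ m) (+ n) (+ q S) (+ q′ S)))))
            where
            expand : ∀ m n q q′ → q + q′ + (m * q + n * q′) ≡ (1ℤ + m) * q + (1ℤ + n) * q′
            expand = solve-∀
          ... | inj₂ (m , refl) | inj₂ (n , refl) = <-irrefl refl
            (subst (0ℤ <_) (cancel (+ m) (+ n) (+ q S) (+ q′ S))
              (+-mono-<-≤ 0<l (+-mono-≤ (0≤* m (q S)) (0≤* n (q′ S)))))
            where
            cancel : ∀ m n q q′ → - m * q + - n * q′ + (m * q + n * q′) ≡ 0ℤ
            cancel = solve-∀
          ... | inj₁ (m , refl) | inj₂ (n , refl) = not-above-below
            (pos-≡ (first (+ σ) x (+ m) (+ n) (+ q S) (+ q′ S)) (second (+ σ) y (+ m) (+ n) (+ p S) (+ p′ S))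
              (pos-+* (pos-+* up m (below S)) n (above S)))
            where
            first : ∀ s x m n q q′ → s * x - ((1ℤ + m) * q + - n * q′) + m * q + n * - q′ ≡ s * x - q
            first = solve-∀
            second : ∀ s y m n p p′ → s * y + ((1ℤ + m) * p + - n * p′) + m * - p + n * p′ ≡ s * y + p
            second = solve-∀
          ... | inj₂ (m , refl) | inj₁ (n , refl) = not-above-above
            (pos-≡ (first (+ σ) x (+ m) (+ n) (+ q S) (+ q′ S)) (second (+ σ) y (+ m) (+ n) (+ p S) (+ p′ S))
              (pos-+* (pos-+* down m (below S)) n (above S)))
            where
            first : ∀ s x m n q q′ → s * x + (- m * q + (1ℤ + n) * q′) + m * q + n * - q′ ≡ s * x + q′
            first = solve-∀
            second : ∀ s y m n p p′ → s * y - (- m * p + (1ℤ + n) * p′) + m * - p + n * p′ ≡ s * y - p′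
            second = solve-∀

        gap : ∀ l t → 0ℤ < l → l < + X →
              Pos (+ σ * x - l) (+ σ * y + t) → Pos (+ σ * x + l) (+ σ * y - t) → ⊥
        -- Cramer's rule: as the determinant is 1, the neighbours form a basis of ℤ² and the
        -- coordinates of (l, t) are integers.
        gap l t = by-coordinates l t (l * + p′ S - t * + q′ S) (t * + q S - l * + p S)
          (trans (trans (unit l) (cong (l *_) (sym one))) (coordinate l t (+ q S) (+ q′ S) (+ p S) (+ p′ S)))
          (trans (trans (unit t) (cong (t *_) (sym one))) (coordinate′ l t (+ q S) (+ q′ S) (+ p S) (+ p′ S)))
          where
          unit : ∀ z → z ≡ z * 1ℤ
          unit = solve-∀
          cancel : ∀ z → z + 1ℤ - z ≡ 1ℤ
          cancel = solve-∀
          one : + p′ S * + q S - + p S * + q′ S ≡ 1ℤ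
          one = trans (cong (_- + p S * + q′ S) (det S)) (cancel (+ p S * + q′ S))
          coordinate : ∀ l t q q′ p p′ → l * (p′ * q - p * q′) ≡ (l * p′ - t * q′) * q + (t * q - l * p) * q′
          coordinate = solve-∀
          coordinate′ : ∀ l t q q′ p p′ → t * (p′ * q - p * q′) ≡ (l * p′ - t * q′) * p + (t * q - l * p) * p′
          coordinate′ = solve-∀

    -- The pair (s r, - s p) stands for δ = s (rθ - p). X is the range in which two carries cannot
    -- both start; `r≤4σX` turns it into a spacing proportional to r.
    record Approximant (σ B : ℕ) : Set where
      field
        X r p : ℕ
        s     : ℤ
        s≡±1  : s ≡ 1ℤ ⊎ s ≡ -1ℤ
        B<r   : B ℕ.< r
        r≤4σX : r ℕ.≤ 4 ℕ.* σ ℕ.* X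
        p≤r   : p ℕ.≤ r
        δ>0   : Pos (s * + r) (- (s * + p))
        σδ<1  : Pos (- (+ σ * (s * + r))) (1ℤ - + σ * - (s * + p))
        gap   : ∀ l t → 0ℤ < l → l < + X →
                Pos (+ σ * (s * + r) - l) (+ σ * - (s * + p) + t) →
                Pos (+ σ * (s * + r) + l) (+ σ * - (s * + p) - t) → ⊥

    approximant : ∀ σ B → 2 ℕ.≤ σ → Approximant σ B
    approximant σ@(suc (suc σ-2)) B (ℕ.s≤s (ℕ.s≤s _)) = choose (ℕ.≤-total (q T) (q′ T))
      where
      open ℕ.≤-Reasoning
      grown₀ = grow (suc B) (ℕ.s≤s ℕ.z≤n)
      balanced = balance (Grown.S grown₀)
      open Gap balanced renaming (gap to small-gap)

      B<X : B ℕ.< X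
      B<X = ℕ.≤-trans (Grown.Y≤ grown₀) (Balanced.B≤ balanced)

      σM : ℕ
      σM = σ ℕ.* (X ℕ.+ X)

      1≤σM : 1 ℕ.≤ σM
      1≤σM = ℕ.*-mono-≤ {1} {σ} {1} {X ℕ.+ X} (ℕ.s≤s ℕ.z≤n) (ℕ.≤-trans (ℕ.s≤s ℕ.z≤n) (ℕ.≤-trans B<X (ℕ.m≤m+n X X)))

      -- With sum at least 2σM, the larger denominator is at least σM = 2σX. The distance belonging
      -- to the smaller one, which becomes r, is less than the reciprocal of the larger one, hence
      -- below 1/(2σX).
      grown = grow (σM ℕ.+ σM) (ℕ.≤-trans 1≤σM (ℕ.m≤m+n σM σM))
      open Grown grown using (q≤; q′≤; Y≤) renaming (S to T)

      4σX : σM ℕ.+ σM ≡ 4 ℕ.* σ ℕ.* X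
      4σX = ring σ X
        where
        ring : ∀ s x → s ℕ.* (x ℕ.+ x) ℕ.+ s ℕ.* (x ℕ.+ x) ≡ 4 ℕ.* s ℕ.* x
        ring = ℕ-Ring.solve-∀

      half : ∀ {m n k} → k ℕ.+ k ℕ.≤ m ℕ.+ n → m ℕ.≤ n → k ℕ.≤ n
      half {m} {n} {k} k+k≤ m≤n with k ℕ.≤? n
      ... | yes k≤n = k≤n
      ... | no  k≰n = ⊥-elim (ℕ.<-irrefl refl (begin-strict
        k ℕ.+ k   ≤⟨ k+k≤ ⟩
        m ℕ.+ n   ≤⟨ ℕ.+-monoˡ-≤ n m≤n ⟩
        n ℕ.+ n   <⟨ ℕ.+-mono-< (ℕ.≰⇒> k≰n) (ℕ.≰⇒> k≰n) ⟩
        k ℕ.+ k   ∎))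

      shrink : ∀ {n k x y} → n ℕ.≤ k → Pos x y →
               Pos (- (+ k * x)) (1ℤ - + k * y) → Pos (- (+ n * x)) (1ℤ - + n * y)
      shrink {n} {k} {x} {y} n≤k δ>0 kδ<1 = pos-≡
        (trans (cong (λ z → - (z * x) + + (k ℕ.∸ n) * x) k≡) (drop (+ n) (+ (k ℕ.∸ n)) x))
        (trans (cong (λ z → 1ℤ - z * y + + (k ℕ.∸ n) * y) k≡) (drop′ (+ n) (+ (k ℕ.∸ n)) y))
        (pos-+* kδ<1 (k ℕ.∸ n) δ>0)
        where
        k≡ : + k ≡ + n + + (k ℕ.∸ n)
        k≡ = cong +_ (sym (ℕ.m+[n∸m]≡n n≤k))
        drop : ∀ n d x → - ((n + d) * x) + d * x ≡ - (n * x)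
        drop = solve-∀
        drop′ : ∀ n d y → 1ℤ - (n + d) * y + d * y ≡ 1ℤ - n * y
        drop′ = solve-∀

      module _ (s : ℤ) (s≡±1 : s ≡ 1ℤ ⊎ s ≡ -1ℤ) (r p k : ℕ) (r≤ : r ℕ.≤ σM ℕ.+ σM) (p≤r : p ℕ.≤ r) (1≤r : 1 ℕ.≤ r)
               (σM≤k : σM ℕ.≤ k) (δ>0 : Pos (s * + r) (- (s * + p)))
               (kδ<1 : Pos (- (+ k * (s * + r))) (1ℤ - + k * - (s * + p))) where
        private
          x y : ℤ
          x = s * + r
          y = - (s * + p)

          σMδ<1 : Pos (- (+ σ * M * x)) (1ℤ - + σ * M * y)
          σMδ<1 = subst (λ z → Pos (- (z * x)) (1ℤ - z * y)) (pos-* σ (X ℕ.+ X)) (shrink σM≤k δ>0 kδ<1)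

          1≤X : 1 ℕ.≤ X
          1≤X = ℕ.≤-trans (ℕ.s≤s ℕ.z≤n) B<X

          -- The point (r, p) itself is at distance δ from 0, and δ < σδ because σ ≥ 2. So `gap`
          -- excludes r < X, and r inherits X > B.
          self-gap : s ≡ 1ℤ ⊎ s ≡ -1ℤ → Pos (+ σ * x - + r) (+ σ * y + + p) × Pos (+ σ * x + + r) (+ σ * y - + p)
          self-gap (inj₁ refl) =
            pos-≡ (minus (+ σ-2) (+ r)) (minus′ (+ σ-2) (+ p)) (pos-+* δ>0 σ-2 δ>0) ,
            pos-≡ (plus (+ σ-2) (+ r)) (plus′ (+ σ-2) (+ p)) (pos-+* δ>0 (suc (suc σ-2)) δ>0)
            where
            minus : ∀ n r → 1ℤ * r + n * (1ℤ * r) ≡ (+ 2 + n) * (1ℤ * r) - r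
            minus = solve-∀
            minus′ : ∀ n p → - (1ℤ * p) + n * - (1ℤ * p) ≡ (+ 2 + n) * - (1ℤ * p) + p
            minus′ = solve-∀
            plus : ∀ n r → 1ℤ * r + (+ 2 + n) * (1ℤ * r) ≡ (+ 2 + n) * (1ℤ * r) + r
            plus = solve-∀
            plus′ : ∀ n p → - (1ℤ * p) + (+ 2 + n) * - (1ℤ * p) ≡ (+ 2 + n) * - (1ℤ * p) - p
            plus′ = solve-∀
          self-gap (inj₂ refl) =
            pos-≡ (plus (+ σ-2) (+ r)) (plus′ (+ σ-2) (+ p)) (pos-+* δ>0 (suc (suc σ-2)) δ>0) ,
            pos-≡ (minus (+ σ-2) (+ r)) (minus′ (+ σ-2) (+ p)) (pos-+* δ>0 σ-2 δ>0)
            where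
            minus : ∀ n r → -1ℤ * r + n * (-1ℤ * r) ≡ (+ 2 + n) * (-1ℤ * r) + r
            minus = solve-∀
            minus′ : ∀ n p → - (-1ℤ * p) + n * - (-1ℤ * p) ≡ (+ 2 + n) * - (-1ℤ * p) - p
            minus′ = solve-∀
            plus : ∀ n r → -1ℤ * r + (+ 2 + n) * (-1ℤ * r) ≡ (+ 2 + n) * (-1ℤ * r) - r
            plus = solve-∀
            plus′ : ∀ n p → - (-1ℤ * p) + (+ 2 + n) * - (-1ℤ * p) ≡ (+ 2 + n) * - (-1ℤ * p) + p
            plus′ = solve-∀

          X≤r : X ℕ.≤ r
          X≤r with X ℕ.≤? r
          ... | yes X≤r = X≤r
          ... | no  X≰r = ⊥-elim (small-gap σ x y σMδ<1 (+ r) (+ p) (+<+ 1≤r) (+<+ (ℕ.≰⇒> X≰r))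
                            (proj₁ (self-gap s≡±1)) (proj₂ (self-gap s≡±1)))

        assemble : Approximant σ B
        assemble = record
          { X = X ; r = r ; p = p ; s = s ; s≡±1 = s≡±1
          ; B<r = ℕ.<-≤-trans B<X X≤r
          ; r≤4σX = subst (r ℕ.≤_) 4σX r≤
          ; p≤r = p≤r ; δ>0 = δ>0
          ; σδ<1 = shrink (ℕ.≤-trans (ℕ.m≤m*n σ (X ℕ.+ X) {{ℕ.>-nonZero (ℕ.≤-trans 1≤X (ℕ.m≤m+n X X))}}) σM≤k) δ>0 kδ<1
          ; gap = small-gap σ x y σMδ<1 }

      choose : q T ℕ.≤ q′ T ⊎ q′ T ℕ.≤ q T → Approximant σ B
      choose (inj₁ q≤q′) = assemble 1ℤ (inj₁ refl) (q T) (p T) (q′ T) q≤ (p≤q T) (1≤q T)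
        (half Y≤ q≤q′)
        (pos-≡ (one (+ q T)) (one′ (+ p T)) (below T))
        (pos-≡ (first (+ q′ T) (+ q T)) (second (+ q′ T) (+ p T)) (below-small T))
        where
        one : ∀ a → a ≡ 1ℤ * a
        one = solve-∀
        one′ : ∀ a → - a ≡ - (1ℤ * a)
        one′ = solve-∀
        first : ∀ k q → - (k * q) ≡ - (k * (1ℤ * q))
        first = solve-∀
        second : ∀ k p → 1ℤ + k * p ≡ 1ℤ - k * - (1ℤ * p)
        second = solve-∀
      choose (inj₂ q′≤q) = assemble -1ℤ (inj₂ refl) (q′ T) (p′ T) (q T) q′≤ (p′≤q′ T) (1≤q′ T)
        (half (subst (σM ℕ.+ σM ℕ.≤_) (ℕ.+-comm (q T) (q′ T)) Y≤) q′≤q)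
        (pos-≡ (one (+ q′ T)) (one′ (+ p′ T)) (above T))
        (pos-≡ (first (+ q T) (+ q′ T)) (second (+ q T) (+ p′ T)) (above-small T))
        where
        one : ∀ a → - a ≡ -1ℤ * a
        one = solve-∀
        one′ : ∀ a → a ≡ - (-1ℤ * a)
        one′ = solve-∀
        first : ∀ k q → k * q ≡ - (k * (-1ℤ * q))
        first = solve-∀
        second : ∀ k p → 1ℤ - k * p ≡ 1ℤ - k * - (-1ℤ * p)
        second = solve-∀

  -- Carries of ⌊mθ + α⌋ along a progression

  0∨1 : ∀ {z} → 0ℤ ≤ z → z ≤ 1ℤ → z ≡ 0ℤ ⊎ z ≡ 1ℤ
  0∨1 {+ 0} _ _ = inj₁ refl
  0∨1 {+ 1} _ _ = inj₂ refl
  0∨1 {+ suc (suc _)} _ (+≤+ (ℕ.s≤s ()))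
  0∨1 { -[1+ _ ]} () _

  monotone-01 : ∀ (c : ℕ → ℤ) σ → c 0 ≡ 0ℤ → (∀ j → c j ≤ c (suc j)) → (∀ j → j ℕ.≤ σ → c j ≤ 1ℤ) →
                (∀ j → j ℕ.≤ σ → c j ≡ 0ℤ) ⊎ (∃[ i ] (i ℕ.< σ × (∀ j → j ℕ.≤ σ → c j ≡ step i j)))
  monotone-01 c zero c0 mono ≤1 = inj₁ λ { zero _ → c0 }
  monotone-01 c (suc σ) c0 mono ≤1 with monotone-01 c σ c0 mono (λ j j≤σ → ≤1 j (ℕ.m≤n⇒m≤1+n j≤σ))
  ... | inj₂ (i , i<σ , c≡step) = inj₂ (i , ℕ.m<n⇒m<1+n i<σ , extend)
    where
    extend : ∀ j → j ℕ.≤ suc σ → c j ≡ step i j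
    extend j j≤ with ℕ.m≤n⇒m<n∨m≡n j≤
    ... | inj₁ j<   = c≡step j (ℕ.s≤s⁻¹ j<)
    ... | inj₂ refl = trans
      (≤-antisym (≤1 (suc σ) ℕ.≤-refl)
        (subst (_≤ c (suc σ)) (trans (c≡step σ ℕ.≤-refl) (step-> i σ i<σ)) (mono σ)))
      (sym (step-> i (suc σ) (ℕ.m<n⇒m<1+n i<σ)))
  ... | inj₁ c≡0 with 0∨1 (subst (_≤ c (suc σ)) (c≡0 σ ℕ.≤-refl) (mono σ)) (≤1 (suc σ) ℕ.≤-refl)
  ...   | inj₁ last≡0 = inj₁ extend
    where
    extend : ∀ j → j ℕ.≤ suc σ → c j ≡ 0ℤ
    extend j j≤ with ℕ.m≤n⇒m<n∨m≡n j≤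
    ... | inj₁ j<   = c≡0 j (ℕ.s≤s⁻¹ j<)
    ... | inj₂ refl = last≡0
  ...   | inj₂ last≡1 = inj₂ (σ , ℕ.≤-refl , extend)
    where
    extend : ∀ j → j ℕ.≤ suc σ → c j ≡ step σ j
    extend j j≤ with ℕ.m≤n⇒m<n∨m≡n j≤
    ... | inj₁ j<   = trans (c≡0 j (ℕ.s≤s⁻¹ j<)) (sym (step-≤ σ j (ℕ.s≤s⁻¹ j<)))
    ... | inj₂ refl = trans last≡1 (sym (step-> σ (suc σ) ℕ.≤-refl))

  -- A sequence k with |k m′ − k m − (m′ − m) θ| < 1, sampled along the progression m, m + r, …, m + σr,
  -- where rθ = p + δ with 0 < δ and σδ < 1.
  module Carry
    {Pos : ℤ → ℤ → Set} (order : Order Pos)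
    (k : ℕ → ℤ) (near : ∀ m m′ → Pos (+ m′ - + m) (k m - k m′ + 1ℤ))
    (σ r : ℕ) (p : ℤ) (1≤σ : 1 ℕ.≤ σ)
    (δ>0 : Pos (+ r) (- p)) (σδ<1 : Pos (- (+ σ * + r)) (1ℤ + + σ * p))
    where

    open OrderProperties order

    carry : ℕ → ℕ → ℤ
    carry m j = k (m ℕ.+ j ℕ.* r) - (k m + + j * p)

    Carries : ℕ → Set
    Carries m = ∃[ i ] (i ℕ.< σ × (∀ j → j ℕ.≤ σ → k (m ℕ.+ j ℕ.* r) ≡ k m + + j * p + step i j))

    Carryless : ℕ → Set
    Carryless m = ∀ j → j ℕ.≤ σ → k (m ℕ.+ j ℕ.* r) ≡ k m + + j * p

    private
      0<1+⇒0≤ : ∀ {z} → 0ℤ < 1ℤ + z → 0ℤ ≤ z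
      0<1+⇒0≤ {z} 0<1+z = subst (0ℤ ≤_) (cancel z) (+-monoʳ-≤ -1ℤ (i<j⇒suc[i]≤j 0<1+z))
        where
        cancel : ∀ z → -1ℤ + (1ℤ + z) ≡ z
        cancel = solve-∀

      carry-0 : ∀ m → carry m 0 ≡ 0ℤ
      carry-0 m = trans (cong (λ n → k n - (k m + 0ℤ * p)) (ℕ.+-identityʳ m)) (cancel (k m) p)
        where
        cancel : ∀ a p → a - (a + 0ℤ * p) ≡ 0ℤ
        cancel = solve-∀

      -- One more stride increases k by more than rθ - 1 = p + δ - 1, hence, being an integer, by at
      -- least p.
      carry-mono : ∀ m j → carry m j ≤ carry m (suc j)
      carry-mono m j = 0≤i-j⇒j≤i (0<1+⇒0≤ (pos⇒0< (pos-≡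
        (first (+ (m ℕ.+ j ℕ.* r)) (+ r)) second (pos-+ (near (m ℕ.+ j ℕ.* r ℕ.+ r) (m ℕ.+ j ℕ.* r)) δ>0))))
        where
        first : ∀ a r → a - (a + r) + r ≡ 0ℤ
        first = solve-∀
        index : m ℕ.+ j ℕ.* r ℕ.+ r ≡ m ℕ.+ suc j ℕ.* r
        index = trans (ℕ.+-assoc m (j ℕ.* r) r) (cong (m ℕ.+_) (ℕ.+-comm (j ℕ.* r) r))
        rearrange : ∀ u v a j p → u - v + 1ℤ + - p ≡ 1ℤ + (u - (a + (1ℤ + j) * p) - (v - (a + j * p)))
        rearrange = solve-∀
        second : k (m ℕ.+ j ℕ.* r ℕ.+ r) - k (m ℕ.+ j ℕ.* r) + 1ℤ + - p ≡ 1ℤ + (carry m (suc j) - carry m j)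
        second = trans (cong (λ n → k n - k (m ℕ.+ j ℕ.* r) + 1ℤ + - p) index)
          (rearrange (k (m ℕ.+ suc j ℕ.* r)) (k (m ℕ.+ j ℕ.* r)) (k m) (+ j) p)

      -- Over j strides k increases by less than jrθ + 1 = jp + jδ + 1, and jδ ≤ σδ < 1.
      carry-≤1 : ∀ m j → j ℕ.≤ σ → carry m j ≤ 1ℤ
      carry-≤1 m j j≤σ = 0≤i-j⇒j≤i (0<1+⇒0≤ (pos⇒0< (pos-≡ first second
        (pos-+* (pos-+ (near m (m ℕ.+ j ℕ.* r)) σδ<1) (σ ℕ.∸ j) δ>0))))
        where
        σ≡ : + σ ≡ + j + + (σ ℕ.∸ j)
        σ≡ = cong +_ (sym (ℕ.m+[n∸m]≡n j≤σ))
        cancel : ∀ m j d r → m + j * r - m + - ((j + d) * r) + d * r ≡ 0ℤ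
        cancel = solve-∀
        first : + (m ℕ.+ j ℕ.* r) - + m + - (+ σ * + r) + + (σ ℕ.∸ j) * + r ≡ 0ℤ
        first = trans (cong₂ (λ u v → + m + u - + m + - (v * + r) + + (σ ℕ.∸ j) * + r) (pos-* j r) σ≡)
          (cancel (+ m) (+ j) (+ (σ ℕ.∸ j)) (+ r))
        rearrange : ∀ a b j d p → a - b + 1ℤ + (1ℤ + (j + d) * p) + d * - p ≡ 1ℤ + (1ℤ - (b - (a + j * p)))
        rearrange = solve-∀
        second : k m - k (m ℕ.+ j ℕ.* r) + 1ℤ + (1ℤ + + σ * p) + + (σ ℕ.∸ j) * - p ≡ 1ℤ + (1ℤ - carry m j)
        second = trans (cong (λ v → k m - k (m ℕ.+ j ℕ.* r) + 1ℤ + (1ℤ + v * p) + + (σ ℕ.∸ j) * - p) σ≡)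
          (rearrange (k m) (k (m ℕ.+ j ℕ.* r)) (+ j) (+ (σ ℕ.∸ j)) p)

      uncarry : ∀ m j {z} → carry m j ≡ z → k (m ℕ.+ j ℕ.* r) ≡ k m + + j * p + z
      uncarry m j eq = trans (split (k (m ℕ.+ j ℕ.* r)) (k m + + j * p)) (cong (_+_ (k m + + j * p)) eq)
        where
        split : ∀ a b → a ≡ b + (a - b)
        split = solve-∀

    carries? : ∀ m → Carryless m ⊎ Carries m
    carries? m with monotone-01 (carry m) σ (carry-0 m) (carry-mono m) (carry-≤1 m)
    ... | inj₁ none = inj₁ λ j j≤σ → trans (uncarry m j (none j j≤σ)) (+-identityʳ _)
    ... | inj₂ (i , i<σ , c≡) = inj₂ (i , i<σ , λ j j≤σ → uncarry m j (c≡ j j≤σ))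

    -- The carry of 1 in k (m + σr) cancels the slack of 1 in `near`, leaving (m′ - m)θ - (k m′ - k
    -- m) < σδ. If m′ carries too, exchanging the roles gives the opposite bound.
    Carries-close : ∀ m m′ → Carries m → Pos (+ σ * + r - (+ m′ - + m)) (- (+ σ * p) + (k m′ - k m))
    Carries-close m m′ (i , i<σ , k≡) = pos-≡ first second (near m′ (m ℕ.+ σ ℕ.* r))
      where
      rearrange : ∀ m m′ x → m + x - m′ ≡ x - (m′ - m)
      rearrange = solve-∀
      first : + (m ℕ.+ σ ℕ.* r) - + m′ ≡ + σ * + r - (+ m′ - + m)
      first = trans (cong (λ z → + m + z - + m′) (pos-* σ r)) (rearrange (+ m) (+ m′) (+ σ * + r))
      rearrange′ : ∀ a b x → b - (a + x + 1ℤ) + 1ℤ ≡ - x + (b - a)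
      rearrange′ = solve-∀
      second : k m′ - k (m ℕ.+ σ ℕ.* r) + 1ℤ ≡ - (+ σ * p) + (k m′ - k m)
      second = trans (cong (λ z → k m′ - z + 1ℤ) (trans (k≡ σ ℕ.≤-refl) (cong (_+_ (k m + + σ * p)) (step-> i σ i<σ))))
        (rearrange′ (k m) (k m′) (+ σ * p))

    -- Without a carry at N, N + r, ..., the value at N + nr would be k N + np, but nrθ exceeds np
    -- by nδ > 1, contrary to `near`. The search runs downwards: each carryless start hands the
    -- contradiction on to the preceding one.
    Carries-infinite : ∃[ n ] Pos (+ n * + r) (+ n * - p - 1ℤ) → ∀ N → ∃[ m ] (N ℕ.≤ m × Carries m)
    Carries-infinite (n , nδ>1) N = search n λ stays → ¬pos-0 (pos-≡ first (second stays)
      (pos-+ (near (N ℕ.+ n ℕ.* r) N) nδ>1))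
      where
      cancel : ∀ N x → N - (N + x) + x ≡ 0ℤ
      cancel = solve-∀
      first : + N - + (N ℕ.+ n ℕ.* r) + + n * + r ≡ 0ℤ
      first = trans (cong (λ z → + N - (+ N + z) + + n * + r) (pos-* n r)) (cancel (+ N) (+ n * + r))
      cancel′ : ∀ a n p → a + n * p - a + 1ℤ + (n * - p - 1ℤ) ≡ 0ℤ
      cancel′ = solve-∀
      second : k (N ℕ.+ n ℕ.* r) ≡ k N + + n * p → k (N ℕ.+ n ℕ.* r) - k N + 1ℤ + (+ n * - p - 1ℤ) ≡ 0ℤ
      second stays = trans (cong (λ z → z - k N + 1ℤ + (+ n * - p - 1ℤ)) stays) (cancel′ (k N) (+ n) p)
      search : ∀ n → ¬ k (N ℕ.+ n ℕ.* r) ≡ k N + + n * p → ∃[ m ] (N ℕ.≤ m × Carries m)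
      search zero    stops = ⊥-elim (stops (trans (cong k (ℕ.+-identityʳ N)) (pad (k N) p)))
        where
        pad : ∀ a p → a ≡ a + 0ℤ * p
        pad = solve-∀
      search (suc n) stops with carries? (N ℕ.+ n ℕ.* r)
      ... | inj₂ carries = N ℕ.+ n ℕ.* r , ℕ.m≤m+n N _ , carries
      ... | inj₁ none    = search n λ stays → stops (begin
        k (N ℕ.+ suc n ℕ.* r)               ≡⟨ cong k index ⟩
        k (N ℕ.+ n ℕ.* r ℕ.+ 1 ℕ.* r)       ≡⟨ none 1 1≤σ ⟩
        k (N ℕ.+ n ℕ.* r) + 1ℤ * p          ≡⟨ cong (_+ 1ℤ * p) stays ⟩
        k N + + n * p + 1ℤ * p              ≡⟨ collect (k N) (+ n) p ⟩
        k N + + suc n * p                   ∎)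
        where
        open ≡-Reasoning
        index : N ℕ.+ suc n ℕ.* r ≡ N ℕ.+ n ℕ.* r ℕ.+ 1 ℕ.* r
        index = ring N n r
          where
          ring : ∀ N n r → N ℕ.+ (1 ℕ.+ n) ℕ.* r ≡ N ℕ.+ n ℕ.* r ℕ.+ 1 ℕ.* r
          ring = ℕ-Ring.solve-∀
        collect : ∀ a n p → a + n * p + 1ℤ * p ≡ a + (1ℤ + n) * p
        collect = solve-∀

  -- Sampling f(⌊mθ + α⌋) at a good denominator

  -- The order on ℤ² for sθ instead of θ.
  rescale : ∀ {Pos} → Order Pos → ∀ s → Order (λ a b → Pos (s * a) b)
  rescale {Pos} order s = record
    { pos-+  = λ {a} {b} {c} pos pos′ → subst (λ z → Pos z _) (sym (*-distribˡ-+ s a c)) (pos-+ pos pos′)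
    ; pos-1  = subst (λ z → Pos z 1ℤ) (sym (*-zeroʳ s)) pos-1
    ; pos⇒0< = λ {b} pos → pos⇒0< (subst (λ z → Pos z b) (*-zeroʳ s) pos)
    }
    where open Order order

  private
    0<i-j⇒j<i : ∀ {i j} → 0ℤ < i - j → j < i
    0<i-j⇒j<i {i} {j} 0<i-j = subst₂ _<_ (+-identityˡ j) (cancel i j) (+-monoˡ-< j 0<i-j)
      where
      cancel : ∀ i j → i - j + j ≡ i
      cancel = solve-∀

  module Sampling
    {Pos : ℤ → ℤ → Set} (order : Order Pos)
    (compare : ∀ a b → a ≢ 0ℤ → Pos a b ⊎ Pos (- a) (- b))
    (archimedean : ∀ {a b} → Pos a b → ∃[ n ] Pos (+ n * a) (+ n * b - 1ℤ))
    (0<θ : Pos 1ℤ 0ℤ) (θ<1 : Pos -1ℤ 1ℤ)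
    (k : ℕ → ℤ) (near : ∀ m m′ → Pos (+ m′ - + m) (k m - k m′ + 1ℤ))
    (F : ℤ → ℤ) (σ : ℕ) (1≤σ : 1 ℕ.≤ σ) (flat : ∀ k p → PolySeq σ (λ j → F (k + + j * p)))
    (bounds : JumpBounds F σ)
    where

    open OrderProperties order
    open Approximation order compare archimedean 0<θ θ<1
    open JumpBounds bounds

    growth : ∀ G → ∃[ M ] (∀ m → M ℕ.≤ m → G ℕ.≤ ∣ k m ∣)
    growth G with archimedean 0<θ
    ... | n , nθ>1 = K ℕ.* n , large
      where
      K : ℕ
      -- For m ≥ Kn the bound from `near` is K < k m - k 0 + 1; the two extra summands pay for k 0
      -- and for the 1.
      K = suc G ℕ.+ ∣ k 0 ∣
      large : ∀ m → K ℕ.* n ℕ.≤ m → G ℕ.≤ ∣ k m ∣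
      large m Kn≤m = ℕ.+-cancelʳ-≤ (∣ k 0 ∣) G (∣ k m ∣) (ℕ.s≤s⁻¹ (ℕ.≤-trans K≤ (ℕ.≤-trans
          (∣i+j∣≤∣i∣+∣j∣ (k m - k 0) 1ℤ)
          (ℕ.≤-trans (ℕ.≤-reflexive (ℕ.+-comm (∣ k m - k 0 ∣) 1)) (ℕ.s≤s (∣i-j∣≤∣i∣+∣j∣ (k m) (k 0)))))))
        where
        m≡ : + m ≡ + K * + n + + (m ℕ.∸ K ℕ.* n)
        m≡ = trans (cong +_ (sym (ℕ.m+[n∸m]≡n Kn≤m))) (cong (_+ + (m ℕ.∸ K ℕ.* n)) (pos-* K n))
        cancel : ∀ K n d → 0ℤ - (K * n + d) + K * (n * 1ℤ) + d * 1ℤ ≡ 0ℤ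
        cancel = solve-∀
        rearrange : ∀ a b K n d → a - b + 1ℤ + K * (n * 0ℤ - 1ℤ) + d * 0ℤ ≡ a - b + 1ℤ - K
        rearrange = solve-∀
        K<k : 0ℤ < k m - k 0 + 1ℤ - + K
        K<k = pos⇒0< (pos-≡
          (trans (cong (λ z → 0ℤ - z + + K * (+ n * 1ℤ) + + (m ℕ.∸ K ℕ.* n) * 1ℤ) m≡)
                 (cancel (+ K) (+ n) (+ (m ℕ.∸ K ℕ.* n))))
          (rearrange (k m) (k 0) (+ K) (+ n) (+ (m ℕ.∸ K ℕ.* n)))
          (pos-+* (pos-+* (near m 0) K nθ>1) (m ℕ.∸ K ℕ.* n) 0<θ))
        below-abs : ∀ {m z} → + m ≤ z → m ℕ.≤ ∣ z ∣
        below-abs (+≤+ m≤n) = m≤n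
        K≤ : K ℕ.≤ ∣ k m - k 0 + 1ℤ ∣
        K≤ = below-abs (0≤i-j⇒j≤i {k m - k 0 + 1ℤ} {+ K} (<⇒≤ K<k))

    slow : ∀ m l → ∣ k (m ℕ.+ l) ∣ ℕ.≤ ∣ k m ∣ ℕ.+ l
    slow m l = begin
      ∣ k (m ℕ.+ l) ∣             ≡⟨ cong ∣_∣ (split (k (m ℕ.+ l)) (k m)) ⟩
      ∣ k m + d ∣                 ≤⟨ ∣i+j∣≤∣i∣+∣j∣ (k m) d ⟩
      ∣ k m ∣ ℕ.+ ∣ d ∣           ≤⟨ ℕ.+-monoʳ-≤ (∣ k m ∣) (between d≥0 d≤l) ⟩
      ∣ k m ∣ ℕ.+ l               ∎
      where
      open ℕ.≤-Reasoning
      d : ℤ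
      d = k (m ℕ.+ l) - k m
      split : ∀ a b → a ≡ b + (a - b)
      split = solve-∀
      between : ∀ {z} → -1ℤ < z → z < + suc l → ∣ z ∣ ℕ.≤ l
      between {+ _}      _        (+<+ z<l) = ℕ.s≤s⁻¹ z<l
      between { -[1+ _ ]} (-<- ()) _
      first : ∀ m l → m - (m + l) + l * 1ℤ ≡ 0ℤ
      first = solve-∀
      second : ∀ a b l → a - b + 1ℤ + l * 0ℤ ≡ a - b - -1ℤ
      second = solve-∀
      d≥0 : -1ℤ < d
      d≥0 = 0<i-j⇒j<i (pos⇒0< (pos-≡ (first (+ m) (+ l)) (second (k (m ℕ.+ l)) (k m) (+ l))
        (pos-+* (near (m ℕ.+ l) m) l 0<θ)))
      first′ : ∀ m l → m + l - m + l * -1ℤ ≡ 0ℤ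
      first′ = solve-∀
      second′ : ∀ a b l → a - b + 1ℤ + l * 1ℤ ≡ 1ℤ + l - (b - a)
      second′ = solve-∀
      d≤l : d < + suc l
      d≤l = 0<i-j⇒j<i (pos⇒0< (pos-≡ (first′ (+ m) (+ l)) (second′ (k m) (k (m ℕ.+ l)) (+ l))
        (pos-+* (near m (m ℕ.+ l)) l θ<1)))

    -- Q bounds the shift by the gap: p ≤ r ≤ 4σl and 1 ≤ l give 1 + σp ≤ (1 + 4σ²) l. C* is the
    -- constant that `variation` then yields; it involves no r.
    Q C* : ℕ
    Q = suc (σ ℕ.* (4 ℕ.* σ))
    C* = C ℕ.* (suc L ℕ.* Q ℕ.+ 2 ℕ.+ Q) ℕ.^ D ℕ.* 2

    module AtScale {B : ℕ} (approximation : Approximant σ B) where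
      open Approximant approximation public

      w : ℕ → ℤ
      w m = difference σ (λ j → F (k (m ℕ.+ j ℕ.* r)))

      -- For s = -1 the sequence -k is not made of floors, but it has the same closeness property
      -- with respect to -θ. This is why `Carry` is stated for that property alone.
      near-s : ∀ m m′ → Pos (s * (+ m′ - + m)) (s * k m - s * k m′ + 1ℤ)
      near-s m m′ with s≡±1
      ... | inj₁ refl = pos-≡ (first (+ m) (+ m′)) (second (k m) (k m′)) (near m m′)
        where
        first : ∀ a b → b - a ≡ 1ℤ * (b - a)
        first = solve-∀
        second : ∀ a b → a - b + 1ℤ ≡ 1ℤ * a - 1ℤ * b + 1ℤ
        second = solve-∀
      ... | inj₂ refl = pos-≡ (first (+ m) (+ m′)) (second (k m) (k m′)) (near m′ m)
        where
        first : ∀ a b → a - b ≡ -1ℤ * (b - a)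
        first = solve-∀
        second : ∀ a b → b - a + 1ℤ ≡ -1ℤ * a - -1ℤ * b + 1ℤ
        second = solve-∀

      σδ<1′ : Pos (s * - (+ σ * + r)) (1ℤ + + σ * (s * + p))
      σδ<1′ = pos-≡ (first (+ σ) s (+ r)) (second (+ σ) s (+ p)) σδ<1
        where
        first : ∀ σ s r → - (σ * (s * r)) ≡ s * - (σ * r)
        first = solve-∀
        second : ∀ σ s p → 1ℤ - σ * - (s * p) ≡ 1ℤ + σ * (s * p)
        second = solve-∀

      open Carry (rescale order s) (λ m → s * k m) near-s σ r (s * + p) 1≤σ δ>0 σδ<1′

      unsign : ∀ {s} → s ≡ 1ℤ ⊎ s ≡ -1ℤ → ∀ {x y q e} → s * x ≡ s * y + s * q + e → x ≡ y + q + s * e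
      unsign (inj₁ refl) {x} {y} {q} {e} eq = trans (one x) (trans eq (expand y q e))
        where
        one : ∀ x → x ≡ 1ℤ * x
        one = solve-∀
        expand : ∀ y q e → 1ℤ * y + 1ℤ * q + e ≡ y + q + 1ℤ * e
        expand = solve-∀
      unsign (inj₂ refl) {x} {y} {q} {e} eq = trans (one x) (trans (cong -_ eq) (expand y q e))
        where
        one : ∀ x → x ≡ - (-1ℤ * x)
        one = solve-∀
        expand : ∀ y q e → - (-1ℤ * y + -1ℤ * q + e) ≡ y + q + -1ℤ * e
        expand = solve-∀

      swap : ∀ j s p → j * (s * p) ≡ s * (j * p)
      swap = solve-∀

      Carries⇒window : ∀ {m} → Carries m → ∃[ i ] (i ℕ.< σ × w m ≡ jump-window F σ s i (k m) (+ p))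
      Carries⇒window {m} (i , i<σ , k≡) = i , i<σ , difference-cong σ λ j j≤σ →
        cong F (unsign s≡±1 {k (m ℕ.+ j ℕ.* r)} {k m} {+ j * + p} {step i j}
          (trans (k≡ j j≤σ) (cong (λ z → s * k m + z + step i j) (swap (+ j) s (+ p)))))

      Carryless⇒w≡0 : ∀ {m} → Carryless m → w m ≡ 0ℤ
      Carryless⇒w≡0 {m} k≡ = trans
        (difference-cong σ λ j j≤σ → cong F (trans
          (unsign s≡±1 {k (m ℕ.+ j ℕ.* r)} {k m} {+ j * + p} {0ℤ}
            (trans (k≡ j j≤σ) (trans (cong (_+_ (s * k m)) (swap (+ j) s (+ p)))
                                     (sym (+-identityʳ (s * k m + s * (+ j * + p)))))))
          (trans (cong (_+_ (k m + + j * + p)) (*-zeroʳ s)) (+-identityʳ (k m + + j * + p)))))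
        (difference-PolySeq σ {λ j → F (k m + + j * + p)} (flat (k m) (+ p)))

      w≢0⇒Carries : ∀ {m} → w m ≢ 0ℤ → Carries m
      w≢0⇒Carries {m} w≢0 = [ (λ none → ⊥-elim (w≢0 (Carryless⇒w≡0 none))) , (λ carries → carries) ]′ (carries? m)

      w-infinite : ∀ N → ∃[ m ] (N ℕ.≤ m × w m ≢ 0ℤ)
      w-infinite N with archimedean δ>0 | growth (suc L ℕ.* suc (σ ℕ.* p))
      ... | n , nδ>1 | M , large with Carries-infinite (n , pos-≡ (swap (+ n) s (+ r)) refl nδ>1) (N ℕ.⊔ M)
      ...   | m , N⊔M≤m , carries with Carries⇒window carries
      ...     | i , i<σ , w≡ = m , ℕ.m⊔n≤o⇒m≤o N M N⊔M≤m , λ w≡0 →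
        jump-window≢0 s≡±1 i (k m) (+ p) i<σ (large m (ℕ.m⊔n≤o⇒n≤o N M N⊔M≤m)) (trans (sym w≡) w≡0)

      spacing : ∀ m l → 1 ℕ.≤ l → w m ≢ 0ℤ → w (m ℕ.+ l) ≢ 0ℤ → X ℕ.≤ l
      spacing m l 1≤l w≢0 w′≢0 with X ℕ.≤? l
      ... | yes X≤l = X≤l
      ... | no  X≰l = ⊥-elim (close s≡±1)
        where
        m′ = m ℕ.+ l
        forth = Carries-close m m′ (w≢0⇒Carries w≢0)
        back  = Carries-close m′ m (w≢0⇒Carries w′≢0)
        excluded = gap (+ l) (k m′ - k m) (+<+ 1≤l) (+<+ (ℕ.≰⇒> X≰l))
        close : s ≡ 1ℤ ⊎ s ≡ -1ℤ → ⊥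
        close (inj₁ s≡1) = excluded
          (pos-≡ (first (+ σ) (+ r) (+ m) (+ l) s≡1) (second (+ σ) (+ p) (k m) (k m′) s≡1) forth)
          (pos-≡ (first′ (+ σ) (+ r) (+ m) (+ l) s≡1) (second′ (+ σ) (+ p) (k m) (k m′) s≡1) back)
          where
          first : ∀ {s} σ r m l → s ≡ 1ℤ → s * (σ * r - (m + l - m)) ≡ σ * (s * r) - l
          first σ r m l refl = ring σ r m l
            where
            ring : ∀ σ r m l → 1ℤ * (σ * r - (m + l - m)) ≡ σ * (1ℤ * r) - l
            ring = solve-∀
          second : ∀ {s} σ p a b → s ≡ 1ℤ → - (σ * (s * p)) + (s * b - s * a) ≡ σ * - (s * p) + (b - a)
          second σ p a b refl = ring σ p a b
            where
            ring : ∀ σ p a b → - (σ * (1ℤ * p)) + (1ℤ * b - 1ℤ * a) ≡ σ * - (1ℤ * p) + (b - a)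
            ring = solve-∀
          first′ : ∀ {s} σ r m l → s ≡ 1ℤ → s * (σ * r - (m - (m + l))) ≡ σ * (s * r) + l
          first′ σ r m l refl = ring σ r m l
            where
            ring : ∀ σ r m l → 1ℤ * (σ * r - (m - (m + l))) ≡ σ * (1ℤ * r) + l
            ring = solve-∀
          second′ : ∀ {s} σ p a b → s ≡ 1ℤ → - (σ * (s * p)) + (s * a - s * b) ≡ σ * - (s * p) - (b - a)
          second′ σ p a b refl = ring σ p a b
            where
            ring : ∀ σ p a b → - (σ * (1ℤ * p)) + (1ℤ * a - 1ℤ * b) ≡ σ * - (1ℤ * p) - (b - a)
            ring = solve-∀
        -- Changing the sign of θ exchanges the two one-sided bounds.
        close (inj₂ s≡-1) = excluded
          (pos-≡ (first′ (+ σ) (+ r) (+ m) (+ l) s≡-1) (second′ (+ σ) (+ p) (k m) (k m′) s≡-1) back)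
          (pos-≡ (first (+ σ) (+ r) (+ m) (+ l) s≡-1) (second (+ σ) (+ p) (k m) (k m′) s≡-1) forth)
          where
          first : ∀ {s} σ r m l → s ≡ -1ℤ → s * (σ * r - (m + l - m)) ≡ σ * (s * r) + l
          first σ r m l refl = ring σ r m l
            where
            ring : ∀ σ r m l → -1ℤ * (σ * r - (m + l - m)) ≡ σ * (-1ℤ * r) + l
            ring = solve-∀
          second : ∀ {s} σ p a b → s ≡ -1ℤ → - (σ * (s * p)) + (s * b - s * a) ≡ σ * - (s * p) - (b - a)
          second σ p a b refl = ring σ p a b
            where
            ring : ∀ σ p a b → - (σ * (-1ℤ * p)) + (-1ℤ * b - -1ℤ * a) ≡ σ * - (-1ℤ * p) - (b - a)
            ring = solve-∀
          first′ : ∀ {s} σ r m l → s ≡ -1ℤ → s * (σ * r - (m - (m + l))) ≡ σ * (s * r) - l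
          first′ σ r m l refl = ring σ r m l
            where
            ring : ∀ σ r m l → -1ℤ * (σ * r - (m - (m + l))) ≡ σ * (-1ℤ * r) - l
            ring = solve-∀
          second′ : ∀ {s} σ p a b → s ≡ -1ℤ → - (σ * (s * p)) + (s * a - s * b) ≡ σ * - (s * p) + (b - a)
          second′ σ p a b refl = ring σ p a b
            where
            ring : ∀ σ p a b → - (σ * (-1ℤ * p)) + (-1ℤ * a - -1ℤ * b) ≡ σ * - (-1ℤ * p) + (b - a)
            ring = solve-∀

      r≤4σl : ∀ m l → 1 ℕ.≤ l → w m ≢ 0ℤ → w (m ℕ.+ l) ≢ 0ℤ → r ℕ.≤ 4 ℕ.* σ ℕ.* l
      r≤4σl m l 1≤l w≢0 w′≢0 = ℕ.≤-trans r≤4σX (ℕ.*-monoʳ-≤ (4 ℕ.* σ) (spacing m l 1≤l w≢0 w′≢0))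

      w-variation : ∀ m l → 1 ℕ.≤ l → w m ≢ 0ℤ → w (m ℕ.+ l) ≢ 0ℤ →
                    ∣ w (m ℕ.+ l) ∣ ℕ.≤ C* ℕ.* (l ℕ.^ D ℕ.+ ∣ w m ∣)
      w-variation m l 1≤l w≢0 w′≢0 =
        let i  , i<σ  , w≡  = Carries⇒window {m} (w≢0⇒Carries {m} w≢0)
            i′ , i′<σ , w′≡ = Carries⇒window {m ℕ.+ l} (w≢0⇒Carries {m ℕ.+ l} w′≢0)
        in variation D C (suc L) Q
             {x = ∣ k m ∣} {y = ∣ k (m ℕ.+ l) ∣} {h = suc (σ ℕ.* p)} {l = l} {U = ∣ w (m ℕ.+ l) ∣} {V = ∣ w m ∣}
             h≤Ql (slow m l)
             (subst₂ (λ u z → ∣ u ∣ ℕ.≤ C ℕ.* z ℕ.^ D) (sym w′≡)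
               (sym (ℕ.+-suc (∣ k (m ℕ.+ l) ∣) (σ ℕ.* p)))
               (window-upper s≡±1 i′ (k (m ℕ.+ l)) (+ p) i′<σ))
             (λ large → subst (λ u → ∣ k m ∣ ℕ.^ D ℕ.≤ 2 ℕ.* ∣ u ∣) (sym w≡)
               (window-lower s≡±1 i (k m) (+ p) i<σ large))
        where
        h≤Ql : suc (σ ℕ.* p) ℕ.≤ Q ℕ.* l
        h≤Ql = ℕ.+-mono-≤ 1≤l (ℕ.≤-trans
          (ℕ.*-monoʳ-≤ σ (ℕ.≤-trans p≤r (r≤4σl m l 1≤l w≢0 w′≢0)))
          (ℕ.≤-reflexive (sym (ℕ.*-assoc σ (4 ℕ.* σ) l))))

open import Defs
open import Data.Integer.Base as ℤ using (ℤ; +_; -[1+_]; 0ℤ; 1ℤ; -1ℤ)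
import Data.Integer.Properties as ℤ
import Data.Integer.Tactic.RingSolver as ℤ-Ring
open import Data.Rational.Base as ℚ using (ℚ; mkℚ; 0ℚ; 1ℚ)
import Data.Rational.Properties as ℚ
open import Data.Rational.Solver using (module +-*-Solver)
open import Data.Rational.Unnormalised.Base as ℚᵘ using (mkℚᵘ; *≡*; *≤*; *<*)
import Data.Rational.Unnormalised.Properties as ℚᵘ
open import Algebra.Properties.Monoid.Sum ℤ.+-0-monoid using (sum)
open +-*-Solver

-- Integers among the rationals and rationals among the reals

ι : ℤ → ℚ
ι z = z ℚ./ 1

ι-ℚᵘ : ∀ z → ℚ.toℚᵘ (ι z) ℚᵘ.≃ mkℚᵘ z 0
ι-ℚᵘ z = ℚ.toℚᵘ-fromℚᵘ (mkℚᵘ z 0)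

ι-+ : ∀ a b → ι (a ℤ.+ b) ≡ ι a ℚ.+ ι b
ι-+ a b = ℚ.toℚᵘ-injective (begin
  ℚ.toℚᵘ (ι (a ℤ.+ b))               ≈⟨ ι-ℚᵘ (a ℤ.+ b) ⟩
  mkℚᵘ (a ℤ.+ b) 0                   ≈⟨ *≡* (ring a b) ⟩
  mkℚᵘ a 0 ℚᵘ.+ mkℚᵘ b 0             ≈⟨ ℚᵘ.+-cong (ι-ℚᵘ a) (ι-ℚᵘ b) ⟨
  ℚ.toℚᵘ (ι a) ℚᵘ.+ ℚ.toℚᵘ (ι b)     ≈⟨ ℚ.toℚᵘ-homo-+ (ι a) (ι b) ⟨
  ℚ.toℚᵘ (ι a ℚ.+ ι b)               ∎)
  where
  open ℚᵘ.≃-Reasoning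
  ring : ∀ a b → (a ℤ.+ b) ℤ.* 1ℤ ≡ (a ℤ.* 1ℤ ℤ.+ b ℤ.* 1ℤ) ℤ.* 1ℤ
  ring = ℤ-Ring.solve-∀

ι-* : ∀ a b → ι (a ℤ.* b) ≡ ι a ℚ.* ι b
ι-* a b = ℚ.toℚᵘ-injective (begin
  ℚ.toℚᵘ (ι (a ℤ.* b))               ≈⟨ ι-ℚᵘ (a ℤ.* b) ⟩
  mkℚᵘ (a ℤ.* b) 0                   ≈⟨ *≡* refl ⟩
  mkℚᵘ a 0 ℚᵘ.* mkℚᵘ b 0             ≈⟨ ℚᵘ.*-cong (ι-ℚᵘ a) (ι-ℚᵘ b) ⟨
  ℚ.toℚᵘ (ι a) ℚᵘ.* ℚ.toℚᵘ (ι b)     ≈⟨ ℚ.toℚᵘ-homo-* (ι a) (ι b) ⟨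
  ℚ.toℚᵘ (ι a ℚ.* ι b)               ∎)
  where open ℚᵘ.≃-Reasoning

ι-neg : ∀ a → ι (ℤ.- a) ≡ ℚ.- ι a
ι-neg a = ℚ.toℚᵘ-injective (begin
  ℚ.toℚᵘ (ι (ℤ.- a))                 ≈⟨ ι-ℚᵘ (ℤ.- a) ⟩
  ℚᵘ.- mkℚᵘ a 0                      ≈⟨ ℚᵘ.-‿cong (ι-ℚᵘ a) ⟨
  ℚᵘ.- ℚ.toℚᵘ (ι a)                  ≈⟨ ℚ.toℚᵘ-homo‿- (ι a) ⟨
  ℚ.toℚᵘ (ℚ.- ι a)                   ∎)
  where open ℚᵘ.≃-Reasoning

ι-mono-≤ : ∀ {a b} → a ℤ.≤ b → ι a ℚ.≤ ι b
ι-mono-≤ {a} {b} a≤b = ℚ.toℚᵘ-cancel-≤ (ℚᵘ.≤-respˡ-≃ (ℚᵘ.≃-sym (ι-ℚᵘ a)) (ℚᵘ.≤-respʳ-≃ (ℚᵘ.≃-sym (ι-ℚᵘ b))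
  (*≤* (ℤ.*-monoʳ-≤-nonNeg 1ℤ a≤b))))

ι-mono-< : ∀ {a b} → a ℤ.< b → ι a ℚ.< ι b
ι-mono-< {a} {b} a<b = ℚ.toℚᵘ-cancel-< (ℚᵘ.<-respˡ-≃ (ℚᵘ.≃-sym (ι-ℚᵘ a)) (ℚᵘ.<-respʳ-≃ (ℚᵘ.≃-sym (ι-ℚᵘ b))
  (*<* (ℤ.*-monoʳ-<-pos 1ℤ a<b))))

ι-cancel-< : ∀ {a b} → ι a ℚ.< ι b → a ℤ.< b
ι-cancel-< {a} {b} ιa<ιb with a ℤ.<? b
... | yes a<b = a<b
... | no  a≮b = ⊥-elim (ℚ.<-irrefl refl (ℚ.<-≤-trans ιa<ιb (ι-mono-≤ (ℤ.≮⇒≥ a≮b))))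

archimedeanℚ : ∀ ε → 0ℚ ℚ.< ε → ∃[ n ] 1ℚ ℚ.≤ ι (+ n) ℚ.* ε
-- The denominator is the witness: its product with ε is the numerator, a positive integer.
archimedeanℚ ε@(mkℚ (+ suc a) d _) _ = suc d , ℚ.toℚᵘ-cancel-≤ (ℚᵘ.≤-respʳ-≃ (ℚᵘ.≃-sym product≃)
    (*≤* (ℤ.+≤+ (ℕ.s≤s ℕ.z≤n))))
  where
  open ℚᵘ.≃-Reasoning
  product≃ : ℚ.toℚᵘ (ι (+ suc d) ℚ.* ε) ℚᵘ.≃ mkℚᵘ (+ suc a) 0
  product≃ = begin
    ℚ.toℚᵘ (ι (+ suc d) ℚ.* ε)             ≈⟨ ℚ.toℚᵘ-homo-* (ι (+ suc d)) ε ⟩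
    ℚ.toℚᵘ (ι (+ suc d)) ℚᵘ.* ℚ.toℚᵘ ε     ≈⟨ ℚᵘ.*-congʳ (ι-ℚᵘ (+ suc d)) ⟩
    mkℚᵘ (+ suc d) 0 ℚᵘ.* mkℚᵘ (+ suc a) d ≈⟨ *≡* (ring′ (+ suc d) (+ suc a)) ⟩
    mkℚᵘ (+ suc a) 0                       ∎
    where
    ring′ : ∀ d a → (d ℤ.* a) ℤ.* 1ℤ ≡ a ℤ.* (1ℤ ℤ.* d)
    ring′ = ℤ-Ring.solve-∀
archimedeanℚ (mkℚ (+ 0) d _) (ℚ.*<* (ℤ.+<+ ()))
archimedeanℚ (mkℚ -[1+ _ ] d _) (ℚ.*<* ())

pointwise-≤ : ∀ x y → (∀ n → seq x n ℚ.≤ seq y n) → x ≤ y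
pointwise-≤ x y x≤y (ε , 0<ε , N , y+ε≤x) = ℚ.<-irrefl refl (begin-strict
  seq y N            ≡⟨ ℚ.+-identityʳ (seq y N) ⟨
  seq y N ℚ.+ 0ℚ     <⟨ ℚ.+-monoʳ-< (seq y N) 0<ε ⟩
  seq y N ℚ.+ ε      ≤⟨ y+ε≤x N ℕ.≤-refl ⟩
  seq x N            ≤⟨ x≤y N ⟩
  seq y N            ∎)
  where open ℚ.≤-Reasoning

0<fromℚ : ∀ q → 0ℚ ℚ.< q → fromℕ 0 < fromℚ q
0<fromℚ q 0<q = q , 0<q , 0 , λ _ _ → ℚ.≤-reflexive (ℚ.+-identityˡ q)

seq-^ : ∀ x n j → seq (fromℕ x ^ n) j ≡ ι (+ (x ℕ.^ n))
seq-^ x zero    j = refl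
seq-^ x (suc n) j = trans (cong (ι (+ x) ℚ.*_) (seq-^ x n j))
  (trans (sym (ι-* (+ x) (+ (x ℕ.^ n)))) (cong ι (sym (ℤ.pos-* x (x ℕ.^ n)))))

-- The order of the real exponents is a negation, so it is used through the decidable order of a and
-- be in ℕ: a wrong order there would separate the two reals by at least 1. Exponentiation is
-- monotone in the exponent because d ≥ 1.
natural-power : ∀ d e → 1 ℕ.≤ d → IsPower d (fromℕ e) (fromℕ (d ℕ.^ e))
natural-power d e 1≤d =
  pointwise-≤ (fromℕ 0) (fromℕ (d ℕ.^ e)) (λ _ → ι-mono-≤ {0ℤ} {+ (d ℕ.^ e)} (ℤ.+≤+ ℕ.z≤n)) , λ a b _ →
    (λ a≤be → pointwise-≤ (fromℕ (d ℕ.^ a)) (fromℕ (d ℕ.^ e) ^ b)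
      λ j → subst (ι (+ (d ℕ.^ a)) ℚ.≤_) (sym (seq-^ (d ℕ.^ e) b j))
      (ι-mono-≤ (ℤ.+≤+ (subst (d ℕ.^ a ℕ.≤_) (sym (power b))
        (ℕ.^-monoʳ-≤ d {{ℕ.>-nonZero 1≤d}} (ℕ.≮⇒≥ λ be<a → a≤be (separated {a} {b} be<a))))))) ,
    (λ be≤a → pointwise-≤ (fromℕ (d ℕ.^ e) ^ b) (fromℕ (d ℕ.^ a))
      λ j → subst (ℚ._≤ ι (+ (d ℕ.^ a))) (sym (seq-^ (d ℕ.^ e) b j))
      (ι-mono-≤ (ℤ.+≤+ (subst (ℕ._≤ d ℕ.^ a) (sym (power b))
        (ℕ.^-monoʳ-≤ d {{ℕ.>-nonZero 1≤d}} (ℕ.≮⇒≥ λ a<be → be≤a (separated′ {a} {b} a<be)))))))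
  where
  power : ∀ b → (d ℕ.^ e) ℕ.^ b ≡ d ℕ.^ (b ℕ.* e)
  power b = trans (ℕ.^-*-assoc d e b) (cong (d ℕ.^_) (ℕ.*-comm e b))
  product : ∀ b → ι (+ b) ℚ.* ι (+ e) ≡ ι (+ (b ℕ.* e))
  product b = trans (sym (ι-* (+ b) (+ e))) (cong ι (sym (ℤ.pos-* b e)))
  add-1 : ∀ {x y} → x ℕ.< y → ι (+ x) ℚ.+ 1ℚ ℚ.≤ ι (+ y)
  add-1 {x} {y} x<y = subst (ℚ._≤ ι (+ y)) (ι-+ (+ x) 1ℤ) (ι-mono-≤ (ℤ.+≤+ (subst (ℕ._≤ y) (ℕ.+-comm 1 x) x<y)))
  separated : ∀ {a b} → b ℕ.* e ℕ.< a → fromℕ b * fromℕ e < fromℕ a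
  separated {a} {b} be<a = 1ℚ , ℚ.positive⁻¹ 1ℚ , 0 , λ _ _ →
    subst (λ z → z ℚ.+ 1ℚ ℚ.≤ ι (+ a)) (sym (product b)) (add-1 be<a)
  separated′ : ∀ {a b} → a ℕ.< b ℕ.* e → fromℕ a < fromℕ b * fromℕ e
  separated′ {a} {b} a<be = 1ℚ , ℚ.positive⁻¹ 1ℚ , 0 , λ _ _ →
    subst (ι (+ a) ℚ.+ 1ℚ ℚ.≤_) (sym (product b)) (add-1 a<be)

-- The order on ℤ + ℤθ given by a real θ

module Rotation (θ : ℝ) (0<θ : fromℕ 0 < θ) (θ<1 : θ < fromℕ 1) (irrational : Irrational θ) where

  value : ℤ → ℤ → ℕ → ℚ
  value a b n = ι a ℚ.* seq θ n ℚ.+ ι b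

  record Pos (a b : ℤ) : Set where
    constructor positive
    field
      ε     : ℚ
      ε>0   : 0ℚ ℚ.< ε
      N     : ℕ
      value≥ : ∀ n → N ℕ.≤ n → ε ℚ.≤ value a b n

  private
    value-+ : ∀ a b c d n → value a b n ℚ.+ value c d n ≡ value (a ℤ.+ c) (b ℤ.+ d) n
    value-+ a b c d n = trans
      (solve 5 (λ a b c d t → (a :* t :+ b) :+ (c :* t :+ d) := (a :+ c) :* t :+ (b :+ d)) refl
        (ι a) (ι b) (ι c) (ι d) (seq θ n))
      (sym (cong₂ (λ u v → u ℚ.* seq θ n ℚ.+ v) (ι-+ a c) (ι-+ b d)))

    value-0 : ∀ b n → value 0ℤ b n ≡ ι b
    value-0 b n = trans (cong (ℚ._+ ι b) (ℚ.*-zeroˡ (seq θ n))) (ℚ.+-identityˡ (ι b))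

  order : Order Pos
  order = record
    { pos-+ = λ { {a} {b} {c} {d} (positive ε ε>0 N ε≤) (positive ε′ ε′>0 N′ ε′≤) →
        positive (ε ℚ.+ ε′) (ℚ.+-mono-< ε>0 ε′>0) (N ℕ.⊔ N′) λ n N⊔N′≤n →
          subst (ε ℚ.+ ε′ ℚ.≤_) (value-+ a b c d n)
            (ℚ.+-mono-≤ (ε≤ n (ℕ.m⊔n≤o⇒m≤o N N′ N⊔N′≤n)) (ε′≤ n (ℕ.m⊔n≤o⇒n≤o N N′ N⊔N′≤n))) }
    ; pos-1 = positive 1ℚ (ℚ.positive⁻¹ 1ℚ) 0 λ n _ → ℚ.≤-reflexive (sym (value-0 1ℤ n))
    ; pos⇒0< = λ { {b} (positive ε ε>0 N ε≤) →
        ι-cancel-< (ℚ.<-≤-trans ε>0 (subst (ε ℚ.≤_) (value-0 b N) (ε≤ N ℕ.≤-refl))) }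
    }

  pos-θ : Pos 1ℤ 0ℤ
  pos-θ = let ε , ε>0 , N , h = 0<θ in positive ε ε>0 N λ n N≤n → begin
    ε                                 ≡⟨ ℚ.+-identityˡ ε ⟨
    ι 0ℤ ℚ.+ ε                        ≤⟨ h n N≤n ⟩
    seq θ n                           ≡⟨ ℚ.*-identityˡ (seq θ n) ⟨
    1ℚ ℚ.* seq θ n                    ≡⟨ ℚ.+-identityʳ _ ⟨
    value 1ℤ 0ℤ n                     ∎
    where open ℚ.≤-Reasoning

  private
    move : ∀ {ε t u : ℚ} → t ℚ.+ ε ℚ.≤ u → ε ℚ.≤ u ℚ.- t
    move {ε} {t} {u} h = begin
      ε                    ≡⟨ solve 2 (λ ε t → ε := t :+ ε :- t) refl ε t ⟩
      t ℚ.+ ε ℚ.- t        ≤⟨ ℚ.+-monoˡ-≤ (ℚ.- t) h ⟩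
      u ℚ.- t              ∎
      where open ℚ.≤-Reasoning

  pos-1-θ : Pos -1ℤ 1ℤ
  pos-1-θ = let ε , ε>0 , N , h = θ<1 in positive ε ε>0 N λ n N≤n → ℚ.≤-trans (move {ε} {seq θ n} {1ℚ} (h n N≤n))
    (ℚ.≤-reflexive (solve 1 (λ t → con 1ℚ :- t := con (ι -1ℤ) :* t :+ con 1ℚ) refl (seq θ n)))

  private
    -- The sign of Aθ + b, with A = a + 1, is the side of -b/A on which θ lies, and irrationality
    -- decides this side. The margin ε of the apartness becomes Aε.
    compare-suc : ∀ a b → Pos (+ suc a) b ⊎ Pos (ℤ.- (+ suc a)) (ℤ.- b)
    compare-suc a b = from-apart (irrational q)
      where
      open ℚ.≤-Reasoning
      A : ℚ
      A = ι (+ suc a)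
      0<A : 0ℚ ℚ.< A
      0<A = ι-mono-< {0ℤ} {+ suc a} (ℤ.+<+ (ℕ.s≤s ℕ.z≤n))
      instance
        A-pos : ℚ.Positive A
        A-pos = ℚ.positive 0<A
        A-nonNeg : ℚ.NonNegative A
        A-nonNeg = ℚ.pos⇒nonNeg A
        A-nonZero : ℚ.NonZero A
        A-nonZero = ℚ.pos⇒nonZero A
      q : ℚ
      q = ℚ.1/ A ℚ.* ι (ℤ.- b)
      Aq : A ℚ.* q ≡ ℚ.- ι b
      Aq = trans (sym (ℚ.*-assoc A (ℚ.1/ A) (ι (ℤ.- b))))
        (trans (cong (ℚ._* ι (ℤ.- b)) (ℚ.*-inverseʳ A)) (trans (ℚ.*-identityˡ (ι (ℤ.- b))) (ι-neg b)))
      0<Aε : ∀ {ε} → 0ℚ ℚ.< ε → 0ℚ ℚ.< A ℚ.* ε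
      0<Aε {ε} ε>0 = subst (ℚ._< A ℚ.* ε) (ℚ.*-zeroʳ A) (ℚ.*-monoʳ-<-pos A ε>0)
      from-apart : θ # fromℚ q → Pos (+ suc a) b ⊎ Pos (ℤ.- (+ suc a)) (ℤ.- b)
      from-apart (inj₁ (ε , ε>0 , N , h)) = inj₂ (positive (A ℚ.* ε) (0<Aε ε>0) N λ n N≤n → begin
        A ℚ.* ε                                           ≤⟨ ℚ.*-monoˡ-≤-nonNeg A (move (h n N≤n)) ⟩
        A ℚ.* (q ℚ.- seq θ n)                           
          ≡⟨ solve 3 (λ A q t → A :* (q :- t) := (:- A) :* t :+ A :* q) refl A q (seq θ n) ⟩
        (ℚ.- A) ℚ.* seq θ n ℚ.+ A ℚ.* q                 
          ≡⟨ cong₂ (λ u v → u ℚ.* seq θ n ℚ.+ v) (sym (ι-neg (+ suc a))) (trans Aq (sym (ι-neg b))) ⟩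
        value (ℤ.- (+ suc a)) (ℤ.- b) n                   ∎)
      from-apart (inj₂ (ε , ε>0 , N , h)) = inj₁ (positive (A ℚ.* ε) (0<Aε ε>0) N λ n N≤n → begin
        A ℚ.* ε                                           ≤⟨ ℚ.*-monoˡ-≤-nonNeg A (move (h n N≤n)) ⟩
        A ℚ.* (seq θ n ℚ.- q)                           
          ≡⟨ solve 3 (λ A q t → A :* (t :- q) := A :* t :- A :* q) refl A q (seq θ n) ⟩
        A ℚ.* seq θ n ℚ.- A ℚ.* q                         ≡⟨ cong (λ v → A ℚ.* seq θ n ℚ.- v) Aq ⟩
        A ℚ.* seq θ n ℚ.- ℚ.- ι b                       
          ≡⟨ solve 2 (λ u b → u :- (:- b) := u :+ b) refl (A ℚ.* seq θ n) (ι b) ⟩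
        value (+ suc a) b n                               ∎)

  compare : ∀ a b → a ≢ 0ℤ → Pos a b ⊎ Pos (ℤ.- a) (ℤ.- b)
  compare (+ zero)   b a≢0 = ⊥-elim (a≢0 refl)
  compare (+ suc a)  b a≢0 = compare-suc a b
  compare (-[1+ a ]) b a≢0 with compare-suc a (ℤ.- b)
  ... | inj₁ pos = inj₂ pos
  ... | inj₂ neg = inj₁ (subst (Pos -[1+ a ]) (ℤ.neg-involutive b) neg)

  archimedean : ∀ {a b} → Pos a b → ∃[ n ] Pos (+ n ℤ.* a) (+ n ℤ.* b ℤ.- 1ℤ)
  archimedean {a} {b} (positive ε ε>0 N ε≤) with archimedeanℚ ε ε>0
  -- Doubling m leaves a margin of 1 after the subtraction of 1.
  ... | m , 1≤mε = m ℕ.+ m , positive 1ℚ (ℚ.positive⁻¹ 1ℚ) N λ n N≤n → begin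
    1ℚ                                   
      ≤⟨ move {1ℚ} {1ℚ} {M ℚ.* value a b n ℚ.+ M ℚ.* value a b n}
           (ℚ.+-mono-≤ (large n N≤n) (large n N≤n)) ⟩
    M ℚ.* value a b n ℚ.+ M ℚ.* value a b n ℚ.- 1ℚ
      ≡⟨ solve 4 (λ M a b t → M :* (a :* t :+ b) :+ M :* (a :* t :+ b) :- con 1ℚ
                       := ((M :+ M) :* a) :* t :+ ((M :+ M) :* b :- con 1ℚ))
         refl M (ι a) (ι b) (seq θ n) ⟩
    (M ℚ.+ M) ℚ.* ι a ℚ.* seq θ n ℚ.+ ((M ℚ.+ M) ℚ.* ι b ℚ.- 1ℚ)
      ≡⟨ cong₂ (λ u v → u ℚ.* seq θ n ℚ.+ v)
           (trans (cong (ℚ._* ι a) (sym (ι-+ (+ m) (+ m)))) (sym (ι-* (+ (m ℕ.+ m)) a)))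
           (trans (cong (λ z → z ℚ.* ι b ℚ.- 1ℚ) (sym (ι-+ (+ m) (+ m))))
             (trans (cong (ℚ._- 1ℚ) (sym (ι-* (+ (m ℕ.+ m)) b))) (sym (ι-+ (+ (m ℕ.+ m) ℤ.* b) -1ℤ)))) ⟩
    value (+ (m ℕ.+ m) ℤ.* a) (+ (m ℕ.+ m) ℤ.* b ℤ.- 1ℤ) n ∎
    where
    open ℚ.≤-Reasoning
    M : ℚ
    M = ι (+ m)
    large : ∀ n → N ℕ.≤ n → 1ℚ ℚ.≤ M ℚ.* value a b n
    large n N≤n = ℚ.≤-trans 1≤mε (ℚ.*-monoˡ-≤-nonNeg M {{ℚ.nonNegative (ι-mono-≤ {0ℤ} {+ m} (ℤ.+≤+ ℕ.z≤n))}} (ε≤ n N≤n))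

  module _ (α : ℝ) (k : ℕ → ℤ) (floor : ∀ m → IsFloor (fromℕ m * θ + α) (k m)) where

    -- The value is the sum of m′θ + α - k m′, which is at least 0, and k m + 1 - (mθ + α), which is
    -- positive. Since the first bound is a negation, `compare` decides the sign and the negative
    -- outcome is refuted; m = m′ is separate because `compare` asks for a nonzero coefficient of θ.
    floor-near : ∀ m m′ → Pos (+ m′ ℤ.- + m) (k m ℤ.- k m′ ℤ.+ 1ℤ)
    floor-near m m′ with m ℕ.≟ m′
    ... | yes refl =
      subst₂ Pos (sym (ℤ.+-inverseʳ (+ m))) (sym (cong (ℤ._+ 1ℤ) (ℤ.+-inverseʳ (k m)))) (Order.pos-1 order)
    ... | no m≢m′ with compare (+ m′ ℤ.- + m) (k m ℤ.- k m′ ℤ.+ 1ℤ)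
                         (λ eq → m≢m′ (sym (ℤ.+-injective (ℤ.i-j≡0⇒i≡j (+ m′) (+ m) eq))))
    ...   | inj₁ pos = pos
    ...   | inj₂ (positive ε ε>0 N ε≤) with proj₂ (floor m)
    ...     | ε′ , ε′>0 , N′ , below = ⊥-elim (proj₁ (floor m′)
      (ε , ε>0 , N ℕ.⊔ N′ , λ n N⊔N′≤n → begin
        ι (+ m′) ℚ.* t n ℚ.+ a n ℚ.+ ε
          ≤⟨ ℚ.+-monoʳ-≤ (ι (+ m′) ℚ.* t n ℚ.+ a n) (ε≤ n (ℕ.m⊔n≤o⇒m≤o N N′ N⊔N′≤n)) ⟩
        ι (+ m′) ℚ.* t n ℚ.+ a n ℚ.+ value (ℤ.- (+ m′ ℤ.- + m)) (ℤ.- (k m ℤ.- k m′ ℤ.+ 1ℤ)) n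
          ≡⟨ cong₂ (λ u v → ι (+ m′) ℚ.* t n ℚ.+ a n ℚ.+ (u ℚ.* t n ℚ.+ v)) expand expand′ ⟩
        ι (+ m′) ℚ.* t n ℚ.+ a n ℚ.+ ((ι (+ m) ℚ.- ι (+ m′)) ℚ.* t n ℚ.+ (ι (k m′) ℚ.- (ι (k m) ℚ.+ 1ℚ)))
          ≡⟨ solve 6 (λ m m′ t a k k′ → m′ :* t :+ a :+ ((m :- m′) :* t :+ (k′ :- (k :+ con 1ℚ)))
                       := (m :* t :+ a) :+ (k′ :- (k :+ con 1ℚ))) refl
               (ι (+ m)) (ι (+ m′)) (t n) (a n) (ι (k m)) (ι (k m′)) ⟩
        (ι (+ m) ℚ.* t n ℚ.+ a n) ℚ.+ (ι (k m′) ℚ.- (ι (k m) ℚ.+ 1ℚ))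
          ≤⟨ ℚ.+-monoˡ-≤ (ι (k m′) ℚ.- (ι (k m) ℚ.+ 1ℚ))
               (ℚ.≤-trans (grow-by {ι (+ m) ℚ.* t n ℚ.+ a n} ε′>0) (below n (ℕ.m⊔n≤o⇒n≤o N N′ N⊔N′≤n))) ⟩
        ι (k m ℤ.+ 1ℤ) ℚ.+ (ι (k m′) ℚ.- (ι (k m) ℚ.+ 1ℚ))
          ≡⟨ cong (ℚ._+ (ι (k m′) ℚ.- (ι (k m) ℚ.+ 1ℚ))) (ι-+ (k m) 1ℤ) ⟩
        (ι (k m) ℚ.+ 1ℚ) ℚ.+ (ι (k m′) ℚ.- (ι (k m) ℚ.+ 1ℚ))
          ≡⟨ solve 2 (λ u v → u :+ (v :- u) := v) refl (ι (k m) ℚ.+ 1ℚ) (ι (k m′)) ⟩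
        ι (k m′) ∎))
      where
      open ℚ.≤-Reasoning
      t a : ℕ → ℚ
      t = seq θ
      a = seq α
      grow-by : ∀ {x ε} → 0ℚ ℚ.< ε → x ℚ.≤ x ℚ.+ ε
      grow-by {x} {ε} ε>0 = subst (ℚ._≤ x ℚ.+ ε) (ℚ.+-identityʳ x) (ℚ.+-monoʳ-≤ x (ℚ.<⇒≤ ε>0))
      swap : ∀ a b → ℤ.- (a ℤ.- b) ≡ b ℤ.- a
      swap = ℤ-Ring.solve-∀
      swap′ : ∀ a b → ℤ.- (a ℤ.- b ℤ.+ 1ℤ) ≡ b ℤ.- (a ℤ.+ 1ℤ)
      swap′ = ℤ-Ring.solve-∀
      ι-minus : ∀ a b → ι (a ℤ.- b) ≡ ι a ℚ.- ι b
      ι-minus a b = trans (ι-+ a (ℤ.- b)) (cong (ι a ℚ.+_) (ι-neg b))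
      expand : ι (ℤ.- (+ m′ ℤ.- + m)) ≡ ι (+ m) ℚ.- ι (+ m′)
      expand = trans (cong ι (swap (+ m′) (+ m))) (ι-minus (+ m) (+ m′))
      expand′ : ι (ℤ.- (k m ℤ.- k m′ ℤ.+ 1ℤ)) ≡ ι (k m′) ℚ.- (ι (k m) ℚ.+ 1ℚ)
      expand′ = trans (cong ι (swap′ (k m) (k m′))) 
        (trans (ι-minus (k m′) (k m ℤ.+ 1ℤ)) (cong (λ z → ι (k m′) ℚ.- z) (ι-+ (k m) 1ℤ)))

-- Verification of Condition (*)

module Main
  (θ α : ℝ) (0<θ : fromℕ 0 < θ) (θ<1 : θ < fromℕ 1) (irrational : Irrational θ)
  (F : ℤ → ℤ) (σ : ℕ) (2≤σ : 2 ℕ.≤ σ) (flat : ∀ k p → PolySeq σ (λ j → F (k ℤ.+ + j ℤ.* p)))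
  (bounds : JumpBounds F σ)
  (k : ℕ → ℤ) (floor : ∀ m → IsFloor (fromℕ m * θ + α) (k m))
  where

  open Rotation θ 0<θ θ<1 irrational
  open Approximation order compare archimedean pos-θ pos-1-θ
  open Sampling order compare archimedean pos-θ pos-1-θ k (floor-near α k floor) F σ (ℕ.<⇒≤ 2≤σ) flat bounds
  open JumpBounds bounds using (D)

  opaque
    approximation : ∀ n → Approximant σ n
    approximation n = approximant σ n 2≤σ

  r : ℕ → ℕ
  r n = Approximant.r (approximation n)

  w : ℕ → ℕ → ℤ
  w n = AtScale.w (approximation n)

  gap-bound : ∀ n m m′ → w n m ≢ 0ℤ → w n m′ ≢ 0ℤ → m ℕ.< m′ → r n ℕ.≤ 4 ℕ.* σ ℕ.* (m′ ℕ.∸ m)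
  gap-bound n m m′ w≢0 w′≢0 m<m′ = AtScale.r≤4σl (approximation n) m (m′ ℕ.∸ m) (ℕ.m<n⇒0<n∸m m<m′) w≢0
    (subst (λ z → w n z ≢ 0ℤ) (sym (ℕ.m+[n∸m]≡n (ℕ.<⇒≤ m<m′))) w′≢0)

  gap-bound-∣-∣ : ∀ n m m′ → w n m ≢ 0ℤ → w n m′ ≢ 0ℤ → m ≢ m′ → r n ℕ.≤ 4 ℕ.* σ ℕ.* ℕ.∣ m - m′ ∣
  gap-bound-∣-∣ n m m′ w≢0 w′≢0 m≢m′ with ℕ.<-cmp m m′
  ... | tri< m<m′ _ _ = subst (λ z → r n ℕ.≤ 4 ℕ.* σ ℕ.* z) (sym (ℕ.m≤n⇒∣m-n∣≡n∸m (ℕ.<⇒≤ m<m′)))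
                          (gap-bound n m m′ w≢0 w′≢0 m<m′)
  ... | tri≈ _ m≡m′ _ = ⊥-elim (m≢m′ m≡m′)
  ... | tri> _ _ m′<m = subst (λ z → r n ℕ.≤ 4 ℕ.* σ ℕ.* z) (sym (ℕ.m≤n⇒∣n-m∣≡n∸m (ℕ.<⇒≤ m′<m)))
                          (gap-bound n m′ m w′≢0 w≢0 m′<m)

  S : ℚ
  S = ι (+ (4 ℕ.* σ))

  instance
    S-pos : ℚ.Positive S
    S-pos = ℚ.positive (ι-mono-< {0ℤ} {+ (4 ℕ.* σ)} (ℤ.+<+ (ℕ.*-mono-≤ {1} {4} (ℕ.s≤s ℕ.z≤n) (ℕ.<⇒≤ 2≤σ))))
    S-nonZero : ℚ.NonZero S
    S-nonZero = ℚ.pos⇒nonZero S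
    1/S-pos : ℚ.Positive (ℚ.1/ S)
    1/S-pos = ℚ.1/pos⇒pos S
    1/S-nonNeg : ℚ.NonNegative (ℚ.1/ S)
    1/S-nonNeg = ℚ.pos⇒nonNeg (ℚ.1/ S)

  quotient-≤ : ∀ {x y} → x ℕ.≤ 4 ℕ.* σ ℕ.* y → ℚ.1/ S ℚ.* ι (+ x) ℚ.≤ ι (+ y)
  quotient-≤ {x} {y} x≤ = begin
    ℚ.1/ S ℚ.* ι (+ x)                  ≤⟨ ℚ.*-monoˡ-≤-nonNeg (ℚ.1/ S) (ι-mono-≤ (ℤ.+≤+ x≤)) ⟩
    ℚ.1/ S ℚ.* ι (+ (4 ℕ.* σ ℕ.* y))    
      ≡⟨ cong (ℚ.1/ S ℚ.*_) (trans (cong ι (ℤ.pos-* (4 ℕ.* σ) y)) (ι-* (+ (4 ℕ.* σ)) (+ y))) ⟩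
    ℚ.1/ S ℚ.* (S ℚ.* ι (+ y))          ≡⟨ ℚ.*-assoc (ℚ.1/ S) S (ι (+ y)) ⟨
    ℚ.1/ S ℚ.* S ℚ.* ι (+ y)            ≡⟨ cong (ℚ._* ι (+ y)) (ℚ.*-inverseˡ S) ⟩
    1ℚ ℚ.* ι (+ y)                      ≡⟨ ℚ.*-identityˡ (ι (+ y)) ⟩
    ι (+ y)                             ∎
    where open ℚ.≤-Reasoning

  -- The constant is `suc C*` because C′ has to be positive.
  variation-bound : ∀ n m m′ → w n m ≢ 0ℤ → w n m′ ≢ 0ℤ → m ℕ.< m′ →
    ℤ.∣ w n m′ ∣ ℕ.≤ suc C* ℕ.* ((m′ ℕ.∸ m) ℕ.^ D ℕ.+ ℤ.∣ w n m ∣)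
  variation-bound n m m′ w≢0 w′≢0 m<m′ = ℕ.≤-trans
    (subst (λ z → ℤ.∣ w n z ∣ ℕ.≤ C* ℕ.* ((m′ ℕ.∸ m) ℕ.^ D ℕ.+ ℤ.∣ w n m ∣)) back
      (AtScale.w-variation (approximation n) m (m′ ℕ.∸ m) (ℕ.m<n⇒0<n∸m m<m′) w≢0
        (subst (λ z → w n z ≢ 0ℤ) (sym back) w′≢0)))
    (ℕ.*-monoˡ-≤ ((m′ ℕ.∸ m) ℕ.^ D ℕ.+ ℤ.∣ w n m ∣) (ℕ.n≤1+n C*))
    where
    back : m ℕ.+ (m′ ℕ.∸ m) ≡ m′
    back = ℕ.m+[n∸m]≡n (ℕ.<⇒≤ m<m′)

  ι-product-≤ : ∀ {u c x y} → u ℕ.≤ c ℕ.* (x ℕ.+ y) → ι (+ u) ℚ.≤ ι (+ c) ℚ.* (ι (+ x) ℚ.+ ι (+ y))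
  ι-product-≤ {u} {c} {x} {y} u≤ = begin
    ι (+ u)                              ≤⟨ ι-mono-≤ (ℤ.+≤+ u≤) ⟩
    ι (+ (c ℕ.* (x ℕ.+ y)))              ≡⟨ trans (cong ι (ℤ.pos-* c (x ℕ.+ y))) (ι-* (+ c) (+ (x ℕ.+ y))) ⟩
    ι (+ c) ℚ.* ι (+ (x ℕ.+ y))          ≡⟨ cong (ι (+ c) ℚ.*_) (ι-+ (+ x) (+ y)) ⟩
    ι (+ c) ℚ.* (ι (+ x) ℚ.+ ι (+ y))    ∎
    where open ℚ.≤-Reasoning

  sum-w : ℕ → ℕ → ℤ
  sum-w n m = sum {suc σ} (λ i → weight σ (toℕ i) ℤ.* F (k (m ℕ.+ toℕ i ℕ.* r n)))

  w≡sum : ∀ n m → w n m ≡ sum-w n m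
  w≡sum n m = sym (sum≡Σ< (suc σ) (λ j → weight σ j ℤ.* F (k (m ℕ.+ j ℕ.* r n))))

  from-sum : ∀ n m → sum-w n m ≢ 0ℤ → w n m ≢ 0ℤ
  from-sum n m sum≢0 w≡0 = sum≢0 (trans (sym (w≡sum n m)) w≡0)

  condition⋆ : Condition⋆ (λ m → F (k m))
  condition⋆ = record
    { σ = σ
    ; b = λ i → weight σ (toℕ i)
    ; r = r
    ; r-positive = λ n → ℕ.≤-trans (ℕ.s≤s ℕ.z≤n) (Approximant.B<r (approximation n))
    ; r-unbounded = λ B → B , Approximant.B<r (approximation B)
    ; Δ-infinite = λ n N → let m , N≤m , w≢0 = AtScale.w-infinite (approximation n) N in
        m , N≤m , λ sum≡0 → w≢0 (trans (w≡sum n m) sum≡0)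
    ; expanding-gaps = fromℚ (ℚ.1/ S) , 0<fromℚ (ℚ.1/ S) (ℚ.positive⁻¹ (ℚ.1/ S)) , λ n m m′ m∈Δ m′∈Δ m≢m′ →
        pointwise-≤ (fromℚ (ℚ.1/ S) * fromℕ (r n)) (fromℕ ℕ.∣ m - m′ ∣) λ _ →
          quotient-≤ (gap-bound-∣-∣ n m m′ (from-sum n m m∈Δ) (from-sum n m′ m′∈Δ) m≢m′)
    ; polynomial-variation = fromℕ D , fromℕ (suc C*) ,
        pointwise-≤ (fromℕ 0) (fromℕ D) (λ _ → ι-mono-≤ {0ℤ} {+ D} (ℤ.+≤+ ℕ.z≤n)) ,
        0<fromℚ (ι (+ suc C*)) (ι-mono-< {0ℤ} {+ suc C*} (ℤ.+<+ (ℕ.s≤s ℕ.z≤n))) , λ n m m′ m∈Δ m′∈Δ m<m′ →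
        fromℕ ((m′ ℕ.∸ m) ℕ.^ D) , natural-power (m′ ℕ.∸ m) D (ℕ.m<n⇒0<n∸m m<m′) ,
        subst₂ (λ u v → fromℕ ℤ.∣ u ∣ ≤ fromℕ (suc C*) * (fromℕ ((m′ ℕ.∸ m) ℕ.^ D) + fromℕ ℤ.∣ v ∣))
          (w≡sum n m′) (w≡sum n m)
          (pointwise-≤ (fromℕ ℤ.∣ w n m′ ∣) (fromℕ (suc C*) * (fromℕ ((m′ ℕ.∸ m) ℕ.^ D) + fromℕ ℤ.∣ w n m ∣)) λ _ →
            ι-product-≤ {ℤ.∣ w n m′ ∣} {suc C*} {(m′ ℕ.∸ m) ℕ.^ D} {ℤ.∣ w n m ∣}
              (variation-bound n m m′ (from-sum n m m∈Δ) (from-sum n m′ m′∈Δ) m<m′))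
    }

mainTheorem2 : (θ α : ℝ) → fromℕ 0 < θ → θ < fromℕ 1 → fromℕ 0 < α → α < fromℕ 1 → Irrational θ →
    (f : Poly) → NonConstant f →
    (⌊_θ+α⌋ : ℕ → ℤ) → (∀ m → IsFloor (fromℕ m * θ + α) (⌊ m θ+α⌋)) →
    Condition⋆ (λ m → eval f (⌊ m θ+α⌋))
mainTheorem2 θ α 0<θ θ<1 _ _ irrational []       ()          k floor
mainTheorem2 θ α 0<θ θ<1 _ _ irrational (a₀ ∷ f) nonconstant k floor =
  Main.condition⋆ θ α 0<θ θ<1 irrational
    -- One more difference than there are coefficients: this annihilates f along progressions and
    -- shows 2 ≤ σ at once.
    (eval (a₀ ∷ f)) (suc (suc (length f))) (ℕ.s≤s (ℕ.s≤s ℕ.z≤n)) flat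
    (jump-bounds (eval (a₀ ∷ f)) (suc (length f)) (eval-jump a₀ f nonconstant) flat) k floor
  where
  flat : ∀ k p → PolySeq (suc (suc (length f))) (λ j → eval (a₀ ∷ f) (k ℤ.+ + j ℤ.* p))
  flat k p = PolySeq-suc (suc (length f)) {λ j → eval (a₀ ∷ f) (k ℤ.+ + j ℤ.* p)} (eval-PolySeq (a₀ ∷ f) k p)
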